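{- Let $a,k,d,e$ be integers with $1\le a\le k$, $1\le d\le k$, and either $e=d$ or $2e=d$. Let ${}_d\overline{B}_{dk+e,\,da}(n)$ be the number of partitions of $n$ such that $$\phi_i+\phi_{i+1}<dk+e\ \text{ for all } i\ge1,\qquad \phi_1<da,\qquad d\mid\phi_{2i+1}\ \text{ for all } i\ge 0.$$ Then $$\sum_{n\ge0}{}_d\overline{B}_{dk+e,\,da}(n)\,q^n=\frac{(q^{da},q^{2dk-da+2e+d},q^{2dk+2e+d};q^{2dk+2e+d})_\infty}{(q^{d};q^{2d})_\infty\,(q^2;q^2)_\infty}.$$
   Context: A partition of a nonnegative integer $n$ is a finite non-increasing sequence of positive integers summing to $n$ (the empty partition is the unique partition of $0$). For a partition and an integer $i\ge1$, $\phi_i$ denotes the number of times $i$ occurs as a part. For $|q|<1$: $(a;q)_n=(1-a)(1-aq)\cdots(1-aq^{n-1})$, $(a;q)_\infty=\lim_{n\to\infty}(a;q)_n$, and $(a_1,\dots,a_r;q)_\infty=(a_1;q)_\infty\cdots(a_r;q)_\infty$. The identity is of formal power series in $q$. -}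

module Defs where

open import Data.Nat.Base using (ℕ; zero; suc; _+_; _*_; _∸_; _≤_; _<_; _≥_; z≤n; s≤s)
open import Data.Nat.Properties as ℕ using (_≟_; _≤?_; _<?_; allUpTo?)
open import Data.Nat.Divisibility using (_∣_; _∣?_)
open import Data.Nat.ListAction using (sum)
open import Data.Integer.Base as ℤ using (ℤ; 0ℤ; 1ℤ)
import Data.Integer.Properties as ℤ
open import Data.Fin.Base as Fin using (Fin; toℕ)
open import Data.Fin.Properties using (toℕ≤pred[n])
open import Data.List.Base using (List; []; _∷_; length; filter; map; foldr; upTo; cartesianProductWith)
open import Data.List.Properties using (∷-injective; filter-none)
open import Data.List.Membership.Propositional using (_∈_)
open import Data.List.Membership.Propositional.Properties using (∈-filter⁺; ∈-filter⁻; ∈-upTo⁺; ∈-cartesianProductWith⁺; ∈-cartesianProductWith⁻)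
open import Data.List.Relation.Unary.All as All using (All; []; _∷_)
open import Data.List.Relation.Unary.Any using (here; there)
open import Data.List.Relation.Unary.AllPairs using ([]; _∷_)
open import Data.List.Relation.Unary.Linked using (Linked; linked?)
open import Data.List.Relation.Unary.Unique.Propositional using (Unique)
import Data.List.Relation.Unary.Unique.Propositional.Properties as Unique
open import Data.Product.Base using (_×_; _,_; proj₁; proj₂; ∃-syntax)
open import Function.Base using (_∘_)
open import Function.Bundles using (_⇔_; mk⇔)
open import Relation.Nullary using (Dec; yes; no; contradiction)
open import Relation.Nullary.Decidable using (map′; _×-dec_; _→-dec_)
open import Relation.Unary using (Decidable)
open import Relation.Binary.PropositionalEquality using (_≡_; refl; sym; trans; cong; cong₂; subst)
open import Algebra.Properties.Semiring.Sum ℤ.+-*-semiring as ∑ using (sum-syntax)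

record IsPartition (n : ℕ) (λs : List ℕ) : Set where
  constructor mkIsPartition
  field
    nonIncreasing : Linked _≥_ λs
    positive      : All (1 ≤_) λs
    sums          : sum λs ≡ n

φ : ℕ → List ℕ → ℕ
φ i λs = length (filter (i ≟_) λs)

record Admissible (d k e a : ℕ) (λs : List ℕ) : Set where
  constructor mkAdmissible
  field
    adjacent : ∀ i → 1 ≤ i → φ i λs + φ (suc i) λs < d * k + e
    ones     : φ 1 λs < d * a
    odds     : ∀ i → d ∣ φ (2 * i + 1) λs

IsBPartition : (d k e a n : ℕ) → List ℕ → Set
IsBPartition d k e a n λs = IsPartition n λs × Admissible d k e a λs

isPartition? : ∀ n → Decidable (IsPartition n)
isPartition? n λs =
  map′ (λ { (p , q , r) → mkIsPartition p q r })
       (λ { (mkIsPartition p q r) → p , q , r })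
       (linked? (λ x y → y ≤? x) λs ×-dec All.all? (1 ≤?_) λs ×-dec (sum λs ≟ n))

parts≤sum : ∀ xs → All (_≤ sum xs) xs
parts≤sum []       = []
parts≤sum (x ∷ xs) =
  ℕ.m≤m+n x (sum xs) ∷ All.map (λ p → ℕ.≤-trans p (ℕ.m≤n+m (sum xs) x)) (parts≤sum xs)

φ-large : ∀ i λs → sum λs < i → φ i λs ≡ 0
φ-large i λs s<i = cong length (filter-none (i ≟_)
  (All.map (λ { x≤s refl → ℕ.<-irrefl refl (ℕ.≤-<-trans x≤s s<i) }) (parts≤sum λs)))

all-eventually? : {P : ℕ → Set} → Decidable P → ∀ N →
                  (∀ {i} → N ≤ i → P N → P i) → Dec (∀ i → P i)
all-eventually? {P} P? N const = map′ to (λ p {i} _ → p i) (allUpTo? P? (suc N))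
  where
  to : (∀ {i} → i < suc N → P i) → ∀ i → P i
  to p i with N ≤? i
  ... | yes N≤i = const N≤i (p ℕ.≤-refl)
  ... | no  N≰i = p (ℕ.m<n⇒m<1+n (ℕ.≰⇒> N≰i))

admissible? : ∀ d k e a → Decidable (Admissible d k e a)
admissible? d k e a λs =
  map′ (λ { (p , q , r) → mkAdmissible p q r })
       (λ { (mkAdmissible p q r) → p , q , r })
       (all-eventually? (λ i → (1 ≤? i) →-dec (φ i λs + φ (suc i) λs <? d * k + e)) N adj
        ×-dec (φ 1 λs <? d * a)
        ×-dec all-eventually? (λ i → d ∣? φ (2 * i + 1) λs) N odd)
  where
  N = suc (sum λs)

  φ≡ : ∀ {i j} → N ≤ i → N ≤ j → φ i λs ≡ φ j λs
  φ≡ p q = trans (φ-large _ λs p) (sym (φ-large _ λs q))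

  adj : ∀ {i} → N ≤ i → (1 ≤ N → φ N λs + φ (suc N) λs < d * k + e) →
        1 ≤ i → φ i λs + φ (suc i) λs < d * k + e
  adj N≤i h _ = subst (_< d * k + e)
    (cong₂ _+_ (φ≡ ℕ.≤-refl N≤i) (φ≡ (ℕ.n≤1+n N) (ℕ.m≤n⇒m≤1+n N≤i)))
    (h (s≤s z≤n))

  i≤2i+1 : ∀ {i} → i ≤ 2 * i + 1
  i≤2i+1 {i} = ℕ.≤-trans (ℕ.m≤m+n i _) (ℕ.m≤m+n _ 1)

  odd : ∀ {i} → N ≤ i → d ∣ φ (2 * N + 1) λs → d ∣ φ (2 * i + 1) λs
  odd N≤i = subst (d ∣_) (φ≡ i≤2i+1 (ℕ.≤-trans N≤i i≤2i+1))

isBPartition? : ∀ d k e a n → Decidable (IsBPartition d k e a n)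
isBPartition? d k e a n λs = isPartition? n λs ×-dec admissible? d k e a λs

-- All lists of length at most l with entries at most m.
boundedLists : (l m : ℕ) → List (List ℕ)
boundedLists zero    m = [] ∷ []
boundedLists (suc l) m = [] ∷ cartesianProductWith _∷_ (upTo (suc m)) (boundedLists l m)

-- A partition of n has at most n parts, each at most n, so the filtered
-- list is a duplicate-free enumeration: see ∈-BPartitions, BPartitions-unique.
BPartitions : (d k e a n : ℕ) → List (List ℕ)
BPartitions d k e a n = filter (isBPartition? d k e a n) (boundedLists n n)

-- The number written ${}_d\overline{B}_{dk+e,da}(n)$.
B̅ : (d k e a n : ℕ) → ℕ
B̅ d k e a n = length (BPartitions d k e a n)

∈-boundedLists : ∀ l m {xs} → length xs ≤ l → All (_≤ m) xs → xs ∈ boundedLists l m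
∈-boundedLists zero    m {[]}     _       _        = here refl
∈-boundedLists (suc l) m {[]}     _       _        = here refl
∈-boundedLists (suc l) m {x ∷ xs} (s≤s p) (q ∷ qs) =
  there (∈-cartesianProductWith⁺ _∷_ (∈-upTo⁺ (s≤s q)) (∈-boundedLists l m p qs))

boundedLists-unique : ∀ l m → Unique (boundedLists l m)
boundedLists-unique zero    m = [] ∷ []
boundedLists-unique (suc l) m =
  All.tabulate nonempty ∷
  Unique.cartesianProductWith⁺ _∷_ ∷-injective (Unique.upTo⁺ (suc m)) (boundedLists-unique l m)
  where
  nonempty : ∀ {xs} → xs ∈ cartesianProductWith _∷_ (upTo (suc m)) (boundedLists l m) →
             [] ≡ xs → _
  nonempty xs∈ refl
    with _ , _ , _ , _ , () ← ∈-cartesianProductWith⁻ _∷_ (upTo (suc m)) (boundedLists l m) xs∈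

length≤sum : ∀ {xs} → All (1 ≤_) xs → length xs ≤ sum xs
length≤sum []       = z≤n
length≤sum (p ∷ ps) = ℕ.+-mono-≤ p (length≤sum ps)

∈-BPartitions : ∀ d k e a n λs → λs ∈ BPartitions d k e a n ⇔ IsBPartition d k e a n λs
∈-BPartitions d k e a n λs = mk⇔
  (proj₂ ∘ ∈-filter⁻ (isBPartition? d k e a n) {xs = boundedLists n n})
  (λ p → ∈-filter⁺ (isBPartition? d k e a n) (candidate (proj₁ p)) p)
  where
  candidate : IsPartition n λs → λs ∈ boundedLists n n
  candidate (mkIsPartition _ pos refl) = ∈-boundedLists _ _ (length≤sum pos) (parts≤sum λs)

BPartitions-unique : ∀ d k e a n → Unique (BPartitions d k e a n)
BPartitions-unique d k e a n =
  Unique.filter⁺ (isBPartition? d k e a n) (boundedLists-unique n n)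

-- Formal power series in q over ℤ: f n is the coefficient of qⁿ.
Series : Set
Series = ℕ → ℤ

infix  4 _≋_
infixl 6 _⊖_
infixl 7 _⊛_ _⊘_
infixr 8 _^ˢ_ q^_

_≋_ : Series → Series → Set
f ≋ g = ∀ n → f n ≡ g n

𝟙 : Series
𝟙 zero    = 1ℤ
𝟙 (suc _) = 0ℤ

q : Series
q zero          = 0ℤ
q (suc zero)    = 1ℤ
q (suc (suc _)) = 0ℤ

_⊖_ : Series → Series → Series
(f ⊖ g) n = f n ℤ.- g n

_⊛_ : Series → Series → Series
(f ⊛ g) n = ∑[ i < suc n ] (f (toℕ i) ℤ.* g (n ∸ toℕ i))

_^ˢ_ : Series → ℕ → Series
f ^ˢ zero  = 𝟙
f ^ˢ suc n = f ⊛ (f ^ˢ n)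

q^_ : ℕ → Series
q^ n = q ^ˢ n

-- Row n lists the coefficients of 1/f backwards from qⁿ: the entry at i is
-- the coefficient of qⁿ⁻ⁱ (entries with i > n are never used).
inverseRow : Series → ℕ → ℕ → ℤ
inverseRow f zero    _       = 1ℤ
inverseRow f (suc n) zero    = ℤ.- (∑[ i < suc n ] (f (suc (toℕ i)) ℤ.* inverseRow f n (toℕ i)))
inverseRow f (suc n) (suc i) = inverseRow f n i

-- The reciprocal of a series with constant term 1: see inverseʳ.
inverse : Series → Series
inverse f n = inverseRow f n 0

_⊘_ : Series → Series → Series
f ⊘ g = f ⊛ inverse g

inverseRow-shift : ∀ f n i → inverseRow f n i ≡ inverse f (n ∸ i)
inverseRow-shift f zero    zero    = refl
inverseRow-shift f zero    (suc i) = refl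
inverseRow-shift f (suc n) zero    = refl
inverseRow-shift f (suc n) (suc i) = inverseRow-shift f n i

inverseʳ : ∀ f → f 0 ≡ 1ℤ → f ⊛ inverse f ≋ 𝟙
inverseʳ f f₀ zero    rewrite f₀ = refl
inverseʳ f f₀ (suc n) rewrite f₀ =
  trans (cong₂ ℤ._+_ (ℤ.*-identityˡ (ℤ.- S)) (sym S≡)) (ℤ.+-inverseˡ S)
  where
  S : ℤ
  S = ∑[ i < suc n ] (f (suc (toℕ i)) ℤ.* inverseRow f n (toℕ i))

  S≡ : S ≡ ∑[ i < suc n ] (f (suc (toℕ i)) ℤ.* inverse f (n ∸ toℕ i))
  S≡ = ∑.sum-cong-≗ {suc n} λ i → cong (f (suc (toℕ i)) ℤ.*_) (inverseRow-shift f n (toℕ i))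

-- ⟨ a ⨾ x ⟩ n = (1 − a)(1 − a x) ⋯ (1 − a xⁿ⁻¹)
⟨_⨾_⟩ : Series → Series → ℕ → Series
⟨ a ⨾ x ⟩ zero    = 𝟙
⟨ a ⨾ x ⟩ (suc n) = ⟨ a ⨾ x ⟩ n ⊛ (𝟙 ⊖ a ⊛ x ^ˢ n)

-- When a and x have zero constant term, the factor 1 − a xʲ is 1 modulo qʲ⁺¹,
-- so the coefficient of qᵐ is final from the m-th partial product onwards;
-- ⟨⨾⟩-converges shows that this is the limit of ⟨ a ⨾ x ⟩ n as n → ∞.
⟨_⨾_⟩∞ : Series → Series → Series
⟨ a ⨾ x ⟩∞ m = ⟨ a ⨾ x ⟩ m m

⟨_⨾_⟩∞* : List Series → Series → Series
⟨ as ⨾ x ⟩∞* = foldr _⊛_ 𝟙 (map ⟨_⨾ x ⟩∞ as)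

infix 4 _⟶_
_⟶_ : (ℕ → Series) → Series → Set
s ⟶ f = ∀ m → ∃[ N ] (∀ n → N ≤ n → s n m ≡ f m)

sum-zero : ∀ {n} (t : Fin n → ℤ) → (∀ i → t i ≡ 0ℤ) → ∑[ i < n ] t i ≡ 0ℤ
sum-zero {n} t t≡0 = trans (∑.sum-cong-≗ t≡0) (∑.sum-replicate-zero n)

Vanishes : ℕ → Series → Set
Vanishes r f = ∀ i → i < r → f i ≡ 0ℤ

⊛-vanishes : ∀ r s f g → Vanishes r f → Vanishes s g → Vanishes (r + s) (f ⊛ g)
⊛-vanishes r s f g vf vg n n<r+s = sum-zero _ term
  where
  term : ∀ (i : Fin (suc n)) → f (toℕ i) ℤ.* g (n ∸ toℕ i) ≡ 0ℤ
  term i with toℕ i <? r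
  ... | yes i<r = trans (cong (ℤ._* g (n ∸ toℕ i)) (vf _ i<r)) (ℤ.*-zeroˡ (g (n ∸ toℕ i)))
  ... | no  i≮r = trans (cong (f (toℕ i) ℤ.*_) (vg _ n∸i<s)) (ℤ.*-zeroʳ (f (toℕ i)))
    where
    n∸i<s : n ∸ toℕ i < s
    n∸i<s = ℕ.+-cancelˡ-< (toℕ i) _ _
      (subst (_< toℕ i + s) (sym (ℕ.m+[n∸m]≡n (toℕ≤pred[n] i)))
        (ℕ.<-≤-trans n<r+s (ℕ.+-monoˡ-≤ s (ℕ.≮⇒≥ i≮r))))

vanishes₁ : ∀ f → f 0 ≡ 0ℤ → Vanishes 1 f
vanishes₁ f f₀ zero    _        = f₀
vanishes₁ f f₀ (suc _) (s≤s ())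

^-vanishes : ∀ f → f 0 ≡ 0ℤ → ∀ n → Vanishes n (f ^ˢ n)
^-vanishes f f₀ zero    _ ()
^-vanishes f f₀ (suc n) = ⊛-vanishes 1 n f (f ^ˢ n) (vanishes₁ f f₀) (^-vanishes f f₀ n)

⊛-identityʳ-upTo : ∀ m f g → Vanishes (suc m) g → (f ⊛ (𝟙 ⊖ g)) m ≡ f m
⊛-identityʳ-upTo zero    f g vg
  rewrite vg 0 (s≤s z≤n) = trans (ℤ.+-identityʳ _) (ℤ.*-identityʳ (f 0))
⊛-identityʳ-upTo (suc m) f g vg
  rewrite vg (suc m) ℕ.≤-refl =
    trans (cong₂ ℤ._+_ (ℤ.*-zeroʳ (f 0))
            (⊛-identityʳ-upTo m (f ∘ suc) g (λ i i<m → vg i (ℕ.m<n⇒m<1+n i<m))))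
          (ℤ.+-identityˡ (f (suc m)))

⟨⨾⟩-converges : ∀ a x → a 0 ≡ 0ℤ → x 0 ≡ 0ℤ → ⟨ a ⨾ x ⟩ ⟶ ⟨ a ⨾ x ⟩∞
⟨⨾⟩-converges a x a₀ x₀ m = m , λ n m≤n →
  subst (λ n → ⟨ a ⨾ x ⟩ n m ≡ ⟨ a ⨾ x ⟩∞ m) (ℕ.m∸n+n≡m m≤n) (stable (n ∸ m))
  where
  stable : ∀ j → ⟨ a ⨾ x ⟩ (j + m) m ≡ ⟨ a ⨾ x ⟩ m m
  stable zero    = refl
  stable (suc j) = trans
    (⊛-identityʳ-upTo m (⟨ a ⨾ x ⟩ (j + m)) (a ⊛ x ^ˢ (j + m))
      (λ i i≤m → ⊛-vanishes 1 (j + m) a (x ^ˢ (j + m)) (vanishes₁ a a₀) (^-vanishes x x₀ (j + m)) i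
        (ℕ.≤-trans i≤m (s≤s (ℕ.m≤n+m m j)))))
    (stable j)

-- With these, ⟨⨾⟩-converges applies to ⟨ q^ m ⨾ q^ n ⟩∞ for m, n ≥ 1, and
-- inverseʳ to products of such symbols.
q^-constant : ∀ n → 1 ≤ n → (q^ n) 0 ≡ 0ℤ
q^-constant (suc n) _ = ^-vanishes q refl (suc n) 0 (s≤s z≤n)

⟨⨾⟩∞-constant : ∀ a x → ⟨ a ⨾ x ⟩∞ 0 ≡ 1ℤ
⟨⨾⟩∞-constant a x = refl

⊛-constant : ∀ f g → f 0 ≡ 1ℤ → g 0 ≡ 1ℤ → (f ⊛ g) 0 ≡ 1ℤ
⊛-constant f g f₀ g₀ rewrite f₀ | g₀ = refl

{-# OPTIONS --safe #-}

-- Write Q = q^d, w = 2e/d ∈ {1, 2} and N = 2k + w + 1.  Peeling off the parts 2r+1 and 2r+2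
-- gives a recurrence from the generating functions of admissible partitions with all parts
-- > 2r to those with all parts > 2r + 2.  After multiplication by ∏_{i > r} (1 - q²ⁱ)/(1 - Q²ⁱ)
-- it depends on d only through Q, and it is solved by the explicit alternating series
--   H_b(r) = Σₙ (-1)ⁿ Q^(N n(n+1)/2 + (N-1) r n - b n) (1 - Q^(b (2r+2n+1))) (Qⁿ⁺¹; Q)₂ᵣ
-- divided by (Q; Q)∞: both sides satisfy the recurrence and tend to 1 as r → ∞.  At r = 0 the
-- series is a theta series, summed by Jacobi's triple product.  All identities are proved in
-- ℤ[[q]]/(q^L) with denominators cleared, where every sum and product is finite.

module Submission where

open import Defs
open import Level using (0ℓ)
open import Algebra.Bundles using (CommutativeRing)
import Algebra.Properties.Semiring.Sum
import Algebra.Solver.Ring as RingSolver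
open import Algebra.Solver.Ring.AlmostCommutativeRing using (fromCommutativeRing; _-Raw-AlmostCommutative⟶_)
open import Data.Fin.Base using (toℕ)
open import Data.Fin.Properties using (toℕ≤pred[n])
open import Data.Integer.Base as ℤ using (ℤ; +_; -[1+_]; 0ℤ; 1ℤ)
import Data.Integer.Properties as ℤ
open import Data.Integer.Tactic.RingSolver using () renaming (solve-∀ to ℤ-solve-∀)
open import Data.List.Base using (List; []; _∷_; _++_; length; filter; map; concatMap; replicate; downFrom)
open import Data.List.Membership.Propositional using (_∈_; find; lose)
open import Data.List.Membership.Propositional.Properties using (∈-filter⁺; ∈-filter⁻; ∈-downFrom⁺; ∈-downFrom⁻; ∈-concatMap⁺; ∈-concatMap⁻; ∈-map⁺; ∈-map⁻)
open import Data.List.Membership.Propositional.Properties.WithK using (unique∧set⇒bag)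
open import Data.List.Properties using (filter-none; filter-all; filter-++; filter-accept; filter-reject; length-++; length-replicate; ++-cancelʳ)
open import Data.List.Relation.Binary.BagAndSetEquality using (∼bag⇒↭)
open import Data.List.Relation.Binary.Permutation.Propositional.Properties using (↭-length)
open import Data.List.Relation.Unary.All as All using (All; []; _∷_)
import Data.List.Relation.Unary.All.Properties as All
open import Data.List.Relation.Unary.AllPairs using ([]; _∷_)
open import Data.List.Relation.Unary.Any using (here)
open import Data.List.Relation.Unary.Linked as Linked using (Linked; []; [-]; _∷_)
open import Data.List.Relation.Unary.Unique.Propositional using (Unique)
import Data.List.Relation.Unary.Unique.Propositional.Properties as Unique
open import Data.Maybe.Base using (Maybe; just; nothing)
open import Data.Nat.Base using (ℕ; zero; suc; _+_; _*_; _∸_; _≤_; _<_; _≥_; z≤n; s≤s)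
open import Data.Nat.DivMod using (_%_; _/_; m≡m%n+[m/n]*n; [m+kn]%n≡m%n; m*n%n≡0)
open import Data.Nat.Divisibility using (_∣_; _∣?_; _∣0; m∣m*n; ∣m+n∣m⇒∣n; >⇒∤)
open import Data.Nat.ListAction using (sum)
open import Data.Nat.ListAction.Properties using (sum-++)
import Data.Nat.Properties as ℕ
open import Data.Nat.Tactic.RingSolver using (solve-∀)
open import Data.Product.Base using (_×_; _,_; proj₂; ∃-syntax)
open import Data.Sum.Base using (_⊎_; inj₁; inj₂)
open import Function.Base using (_∘_)
open import Function.Bundles using (mk⇔; module Equivalence)
open import Relation.Binary.PropositionalEquality as ≡ using (_≡_; _≢_)
open import Relation.Nullary using (Dec; yes; no; ¬_; contradiction)
open import Relation.Nullary.Decidable using (_→-dec_)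
open import Relation.Unary using (Decidable)

-- Identities in an arbitrary commutative ring

-- The multiplicity of an odd part is a multiple of `d`, so a bound on it matters only after
-- rounding up to a multiple of `d`. The multiplicities of an even part therefore fall into blocks
-- of `d` consecutive values that leave the same rounded bound for the next part; if the part is i
-- and t = qⁱ, each block contributes a factor (1 - t^d)/(1 - t), which is the origin of the
-- normalising product. Only the first block is short: it has `e` values and contributes (1 -
-- t^e)/(1 - t). The hypothesis on `e` lets this boundary case close: for e = d the block is full,
-- and for 2e = d the missing factor 1 + t^e comes out of a reflection symmetry.
--
-- Peeling one part at a time passes through partitions with all parts > 2r + 1, so H needs a
-- companion series E. The relations between H and E are not termwise: each holds up to a difference
-- a(n) - a(n+1), where a(n) contains 1 - Qⁿ and so vanishes at n = 0, while nilpotency of Q makes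
-- it vanish at the upper end.

module IntegerSolver (R : CommutativeRing 0ℓ 0ℓ) where

  open CommutativeRing R using (Carrier; _≈_; 0#; 1#; -_; setoid; refl; reflexive; sym; trans; +-cong; +-congˡ; +-congʳ; +-comm; +-assoc; +-identityʳ; -‿cong; -‿inverseʳ; ring; semiring; +-abelianGroup)
  open CommutativeRing R using () renaming (_+_ to _⊕_; _*_ to _⊗_)
  open import Algebra.Properties.Semiring.Mult.TCOptimised semiring using (1+×; ×-homo-+; ×1-homo-*) renaming (_×_ to _·_)
  open import Algebra.Properties.Ring ring using (-‿distribˡ-*; -‿distribʳ-*; -‿involutive; -0#≈0#)
  open import Algebra.Properties.AbelianGroup +-abelianGroup using (⁻¹-∙-comm)
  open import Relation.Binary.Reasoning.Setoid setoid

  -- Integer coefficients have decidable equality, which the carrier need not have, so the solver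
  -- can cancel terms such as 1 - 1. With the optimised multiple, `1 · 1#` reduces to `1#`, hence
  -- `con 1ℤ` denotes `1#` definitionally.
  ⟦_⟧ : ℤ → Carrier
  ⟦ + n      ⟧ = n · 1#
  ⟦ -[1+ n ] ⟧ = - (suc n · 1#)

  ⊖-homo : ∀ m n → ⟦ m ℤ.⊖ n ⟧ ≈ (m · 1#) ⊕ (- (n · 1#))
  ⊖-homo m zero = sym (trans (+-congˡ -0#≈0#) (+-identityʳ _))
  ⊖-homo zero (suc n) = sym (trans (+-comm _ _) (+-identityʳ _))
  ⊖-homo (suc m) (suc n) = begin
    ⟦ suc m ℤ.⊖ suc n ⟧                              ≡⟨ ≡.cong ⟦_⟧ (ℤ.[1+m]⊖[1+n]≡m⊖n m n) ⟩
    ⟦ m ℤ.⊖ n ⟧                                      ≈⟨ ⊖-homo m n ⟩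
    (m · 1#) ⊕ (- (n · 1#))                          ≈⟨ +-congʳ (sym (trans (+-assoc _ _ _) (trans (+-congˡ (-‿inverseʳ 1#)) (+-identityʳ _)))) ⟩
    (((m · 1#) ⊕ 1#) ⊕ (- 1#)) ⊕ (- (n · 1#))        ≈⟨ +-assoc _ _ _ ⟩
    ((m · 1#) ⊕ 1#) ⊕ ((- 1#) ⊕ (- (n · 1#)))        ≈⟨ +-cong (trans (+-comm _ _) (sym (1+× m 1#))) (⁻¹-∙-comm 1# (n · 1#)) ⟩
    (suc m · 1#) ⊕ (- (1# ⊕ (n · 1#)))               ≈⟨ +-congˡ (-‿cong (sym (1+× n 1#))) ⟩
    (suc m · 1#) ⊕ (- (suc n · 1#))                  ∎

  -‿homo : ∀ i → ⟦ ℤ.- i ⟧ ≈ - ⟦ i ⟧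
  -‿homo (+ zero)   = sym -0#≈0#
  -‿homo (+ suc n)  = refl
  -‿homo (-[1+ n ]) = sym (-‿involutive _)

  +-homo : ∀ i j → ⟦ i ℤ.+ j ⟧ ≈ ⟦ i ⟧ ⊕ ⟦ j ⟧
  +-homo (+ m)      (+ n)      = ×-homo-+ 1# m n
  +-homo (+ m)      (-[1+ n ]) = ⊖-homo m (suc n)
  +-homo (-[1+ m ]) (+ n)      = trans (⊖-homo n (suc m)) (+-comm _ _)
  +-homo (-[1+ m ]) (-[1+ n ]) = begin
    - (suc (suc (m + n)) · 1#)              ≡⟨ ≡.cong (λ k → - (suc k · 1#)) (≡.sym (ℕ.+-suc m n)) ⟩
    - ((suc m + suc n) · 1#)                ≈⟨ -‿cong (×-homo-+ 1# (suc m) (suc n)) ⟩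
    - ((suc m · 1#) ⊕ (suc n · 1#))         ≈⟨ sym (⁻¹-∙-comm _ _) ⟩
    (- (suc m · 1#)) ⊕ (- (suc n · 1#))     ∎

  *-homo⁺ : ∀ m j → ⟦ + m ℤ.* j ⟧ ≈ ⟦ + m ⟧ ⊗ ⟦ j ⟧
  *-homo⁺ m (+ n) = trans (reflexive (≡.cong ⟦_⟧ (≡.sym (ℤ.pos-* m n)))) (×1-homo-* m n)
  *-homo⁺ m (-[1+ n ]) = begin
    ⟦ + m ℤ.* -[1+ n ] ⟧              ≡⟨ ≡.cong ⟦_⟧ (≡.sym (ℤ.neg-distribʳ-* (+ m) (+ suc n))) ⟩
    ⟦ ℤ.- (+ m ℤ.* + suc n) ⟧         ≈⟨ -‿homo (+ m ℤ.* + suc n) ⟩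
    - ⟦ + m ℤ.* + suc n ⟧             ≈⟨ -‿cong (*-homo⁺ m (+ suc n)) ⟩
    - (⟦ + m ⟧ ⊗ ⟦ + suc n ⟧)         ≈⟨ -‿distribʳ-* _ _ ⟩
    ⟦ + m ⟧ ⊗ (- ⟦ + suc n ⟧)         ∎

  *-homo : ∀ i j → ⟦ i ℤ.* j ⟧ ≈ ⟦ i ⟧ ⊗ ⟦ j ⟧
  *-homo (+ m)      j = *-homo⁺ m j
  *-homo (-[1+ m ]) j = begin
    ⟦ -[1+ m ] ℤ.* j ⟧              ≡⟨ ≡.cong ⟦_⟧ (≡.sym (ℤ.neg-distribˡ-* (+ suc m) j)) ⟩
    ⟦ ℤ.- (+ suc m ℤ.* j) ⟧         ≈⟨ -‿homo (+ suc m ℤ.* j) ⟩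
    - ⟦ + suc m ℤ.* j ⟧             ≈⟨ -‿cong (*-homo⁺ (suc m) j) ⟩
    - (⟦ + suc m ⟧ ⊗ ⟦ j ⟧)         ≈⟨ -‿distribˡ-* _ _ ⟩
    (- ⟦ + suc m ⟧) ⊗ ⟦ j ⟧         ∎

  morphism : ℤ.+-*-rawRing -Raw-AlmostCommutative⟶ fromCommutativeRing R
  morphism = record
    { ⟦_⟧ = ⟦_⟧ ; +-homo = +-homo ; *-homo = *-homo ; -‿homo = -‿homo ; 0-homo = refl ; 1-homo = refl }

  _coeff≟_ : ∀ i j → Maybe (⟦ i ⟧ ≈ ⟦ j ⟧)
  i coeff≟ j with i ℤ.≟ j
  ... | yes ≡.refl = just refl
  ... | no  _      = nothing

  open RingSolver ℤ.+-*-rawRing (fromCommutativeRing R) morphism _coeff≟_ public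
    using (solve; _:=_; _:+_; _:*_; _:-_; :-_; con)

-- Finite sums, telescoping and q-Pochhammer symbols

module Sums (R : CommutativeRing 0ℓ 0ℓ) where

  open CommutativeRing R hiding (_+_; _*_; _-_; zero)
  open CommutativeRing R using () renaming (_+_ to infixl 6 _⊕_; _-_ to infixl 6 _⊝_; _*_ to infixl 7 _⊗_)
  open import Algebra.Properties.Semiring.Exp semiring using (_^_; ^-homo-*; ^-congˡ)
  open import Relation.Binary.Reasoning.Setoid setoid
  open IntegerSolver R

  Σ : (ℕ → Carrier) → ℕ → Carrier
  Σ f zero    = 0#
  Σ f (suc n) = Σ f n ⊕ f n

  Σ-cong : ∀ {f g} n → (∀ i → i < n → f i ≈ g i) → Σ f n ≈ Σ g n
  Σ-cong zero    h = refl
  Σ-cong (suc n) h = +-cong (Σ-cong n (λ i i<n → h i (ℕ.m<n⇒m<1+n i<n))) (h n ℕ.≤-refl)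

  Σ-+ : ∀ f g n → Σ (λ i → f i ⊕ g i) n ≈ Σ f n ⊕ Σ g n
  Σ-+ f g zero    = sym (+-identityʳ _)
  Σ-+ f g (suc n) = trans (+-congʳ (Σ-+ f g n))
    (solve 4 (λ a b c d → (a :+ b) :+ (c :+ d) := (a :+ c) :+ (b :+ d)) refl (Σ f n) (Σ g n) (f n) (g n))

  Σ-*ˡ : ∀ a f n → Σ (λ i → a ⊗ f i) n ≈ a ⊗ Σ f n
  Σ-*ˡ a f zero    = sym (zeroʳ a)
  Σ-*ˡ a f (suc n) = trans (+-congʳ (Σ-*ˡ a f n)) (sym (distribˡ a _ _))

  Σ-zero : ∀ f n → (∀ i → i < n → f i ≈ 0#) → Σ f n ≈ 0#
  Σ-zero f zero    h = refl
  Σ-zero f (suc n) h = trans (+-cong (Σ-zero f n (λ i i<n → h i (ℕ.m<n⇒m<1+n i<n))) (h n ℕ.≤-refl)) (+-identityʳ _)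

  Σ-suc : ∀ f n → Σ f (suc n) ≈ f 0 ⊕ Σ (λ i → f (suc i)) n
  Σ-suc f zero    = +-comm _ _
  Σ-suc f (suc n) = trans (+-congʳ (Σ-suc f n)) (+-assoc _ _ _)

  -- The flux `a` carries the mismatch between `f` and `g` from one index to the next, so only its
  -- two boundary values survive summation.
  Σ-shift : ∀ (f g a : ℕ → Carrier) n → (∀ i → f i ⊕ a (suc i) ≈ a i ⊕ g i) → Σ f n ⊕ a n ≈ a 0 ⊕ Σ g n
  Σ-shift f g a zero    h = +-comm _ _
  Σ-shift f g a (suc n) h = begin
    (Σ f n ⊕ f n) ⊕ a (suc n)   ≈⟨ +-assoc _ _ _ ⟩
    Σ f n ⊕ (f n ⊕ a (suc n))   ≈⟨ +-congˡ (h n) ⟩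
    Σ f n ⊕ (a n ⊕ g n)         ≈⟨ sym (+-assoc _ _ _) ⟩
    (Σ f n ⊕ a n) ⊕ g n         ≈⟨ +-congʳ (Σ-shift f g a n h) ⟩
    (a 0 ⊕ Σ g n) ⊕ g n         ≈⟨ +-assoc _ _ _ ⟩
    a 0 ⊕ (Σ g n ⊕ g n)         ∎

  Σ-telescope : ∀ (f g a : ℕ → Carrier) n → (∀ i → f i ⊕ a (suc i) ≈ a i ⊕ g i) → a 0 ≈ 0# → a n ≈ 0# → Σ f n ≈ Σ g n
  Σ-telescope f g a n h a₀ aₙ = begin
    Σ f n           ≈⟨ sym (+-identityʳ _) ⟩
    Σ f n ⊕ 0#      ≈⟨ +-congˡ (sym aₙ) ⟩
    Σ f n ⊕ a n     ≈⟨ Σ-shift f g a n h ⟩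
    a 0 ⊕ Σ g n     ≈⟨ +-congʳ a₀ ⟩
    0# ⊕ Σ g n      ≈⟨ +-identityˡ _ ⟩
    Σ g n           ∎

  poch : Carrier → Carrier → ℕ → Carrier
  poch a x zero    = 1#
  poch a x (suc n) = poch a x n ⊗ (1# ⊝ a ⊗ x ^ n)

  1⊝-cong : ∀ {x y} → x ≈ y → 1# ⊝ x ≈ 1# ⊝ y
  1⊝-cong h = +-congˡ (-‿cong h)

  poch-shift : ∀ a x n → poch a x (suc n) ≈ (1# ⊝ a) ⊗ poch (a ⊗ x) x n
  poch-shift a x zero    = solve 1 (λ a → con 1ℤ :* (con 1ℤ :- a :* con 1ℤ) := (con 1ℤ :- a) :* con 1ℤ) refl a
  poch-shift a x (suc n) = begin
    poch a x (suc n) ⊗ (1# ⊝ a ⊗ (x ⊗ x ^ n))                  ≈⟨ *-cong (poch-shift a x n) (1⊝-cong (sym (*-assoc a x _))) ⟩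
    ((1# ⊝ a) ⊗ poch (a ⊗ x) x n) ⊗ (1# ⊝ (a ⊗ x) ⊗ x ^ n)     ≈⟨ *-assoc _ _ _ ⟩
    (1# ⊝ a) ⊗ (poch (a ⊗ x) x n ⊗ (1# ⊝ (a ⊗ x) ⊗ x ^ n))     ∎

  poch-cong : ∀ {a b x y} n → a ≈ b → x ≈ y → poch a x n ≈ poch b y n
  poch-cong zero    _ _ = refl
  poch-cong (suc n) h k = *-cong (poch-cong n h k) (1⊝-cong (*-cong h (^-congˡ n k)))

  ^-zero : ∀ x ℓ e → x ^ ℓ ≈ 0# → ℓ ≤ e → x ^ e ≈ 0#
  ^-zero x ℓ e h ℓ≤e = begin
    x ^ e                 ≡⟨ ≡.cong (x ^_) (≡.sym (ℕ.m+[n∸m]≡n ℓ≤e)) ⟩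
    x ^ (ℓ + (e ∸ ℓ))     ≈⟨ ^-homo-* x ℓ (e ∸ ℓ) ⟩
    x ^ ℓ ⊗ x ^ (e ∸ ℓ)   ≈⟨ *-congʳ h ⟩
    0# ⊗ x ^ (e ∸ ℓ)      ≈⟨ zeroˡ _ ⟩
    0#                    ∎

  sgn : ℕ → Carrier
  sgn n = (- 1#) ^ n

-- This is n(n - 1)/2, the triangular number of index n - 1.
tri : ℕ → ℕ
tri zero    = 0
tri (suc n) = tri n + n

-- Telescoping relations between the series H and E

module QDifference (R : CommutativeRing 0ℓ 0ℓ) (Q : CommutativeRing.Carrier R) where

  open CommutativeRing R hiding (_+_; _*_; _-_; zero)
  open CommutativeRing R using () renaming (_+_ to infixl 6 _⊕_; _-_ to infixl 6 _⊝_; _*_ to infixl 7 _⊗_)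
  open import Algebra.Properties.Semiring.Exp semiring using (_^_; ^-homo-*; ^-congʳ)
  open import Relation.Binary.Reasoning.Setoid setoid
  open IntegerSolver R
  open Sums R

  p : ℕ → Carrier
  p e = Q ^ e

  p-cong : ∀ {a b} → a ≡ b → p a ≈ p b
  p-cong = ^-congʳ Q

  p-split : ∀ {e} a b → e ≡ a + b → p e ≈ p a ⊗ p b
  p-split a b e≡ = trans (p-cong e≡) (^-homo-* Q a b)

  p-split₃ : ∀ {e} a b c → e ≡ a + b + c → p e ≈ p a ⊗ p b ⊗ p c
  p-split₃ a b c e≡ = trans (p-split (a + b) c e≡) (*-congʳ (^-homo-* Q a b))

  pr : ℕ → ℕ → Carrier
  pr n s = poch (p (suc n)) Q s

  pr-suc : ∀ n s → pr n (suc s) ≈ pr n s ⊗ (1# ⊝ p (suc n + s))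
  pr-suc n s = *-congˡ (1⊝-cong (sym (^-homo-* Q (suc n) s)))

  -- Splits off the first factor of (Qⁿ⁺¹; Q)ₛ₊₁, where `pr-suc` splits off the last. Comparing the
  -- two is what moves a flux term from index n + 1 back to index n.
  pr-shift : ∀ n s → pr n (suc s) ≈ (1# ⊝ p (suc n)) ⊗ pr (suc n) s
  pr-shift n s = trans (poch-shift _ Q s) (*-congˡ (poch-cong s (*-comm _ _) refl))

  -- The n-th term of H_b(r) when b + b̄ = N = ν + 1; writing N n(n+1)/2 - b n as
  -- N n(n-1)/2 + b̄ n keeps the exponents natural numbers.
  hterm : (ν b b̄ r n : ℕ) → Carrier
  hterm ν b b̄ r n = sgn n ⊗ pr n (2 * r) ⊗
    (p (suc ν * tri n + ν * r * n + b̄ * n) ⊝ p (suc ν * tri n + ν * r * n + (suc ν + b) * n + b * (2 * r + 1)))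

  -- With c = ν - 2 β, these sum to the companion series, for partitions into parts > 2r + 1.
  eterm : (ν β c r n : ℕ) → Carrier
  eterm ν β c r n = sgn n ⊗ pr n (suc (2 * r)) ⊗ p (suc ν * tri n + ν * r * n + (suc ν + β) * n) ⊗ (1# ⊝ p (c * (n + r + 1)))

  -- Passing from b = β to β + 1 changes the first power of the H term by the factor 1 - Qⁿ, which
  -- yields the flux a(n), and the second by 1 - Q^(n+1+2r), which lengthens the Pochhammer symbol
  -- to that of E. The part of the latter not accounted for by the factor 1 - Q^(c(n+r+1)) of E is
  -- -a(n+1).
  H-E-term : ∀ β c r n → let ν = 2 * β + c in
    let a = λ n → sgn n ⊗ pr n (2 * r) ⊗ (1# ⊝ p n) ⊗ p (suc ν * tri n + ν * r * n + (β + c) * n) in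
    hterm ν (suc β) (β + c) r n ⊕ a (suc n) ≈ a n ⊕ (hterm ν β (suc (β + c)) r n ⊕ p ((2 * r + 1) * β) ⊗ eterm ν β c r n)
  H-E-term β c r n = begin
    s ⊗ k ⊗ (u ⊝ p v₁) ⊕ (- 1# ⊗ s) ⊗ kk ⊗ (1# ⊝ y₁) ⊗ p u₁
      ≈⟨ +-cong (*-congˡ (+-congˡ (-‿cong v₁≈))) (*-congˡ u₁≈) ⟩
    s ⊗ k ⊗ (u ⊝ z ⊗ v ⊗ w) ⊕ (- 1# ⊗ s) ⊗ kk ⊗ (1# ⊝ y₁) ⊗ (z ⊗ v ⊗ g)
      ≈⟨ solve 9 (λ s k u z v w kk y₁ g →
           s :* k :* (u :- z :* v :* w) :+ ((:- con 1ℤ) :* s) :* kk :* (con 1ℤ :- y₁) :* (z :* v :* g)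
           := s :* k :* (u :- z :* v :* w) :- s :* ((con 1ℤ :- y₁) :* kk) :* (z :* v :* g)) refl s k u z v w kk y₁ g ⟩
    s ⊗ k ⊗ (u ⊝ z ⊗ v ⊗ w) ⊝ s ⊗ ((1# ⊝ y₁) ⊗ kk) ⊗ (z ⊗ v ⊗ g)
      ≈⟨ +-congˡ (-‿cong (*-congʳ (*-congˡ (trans (sym (pr-shift n (2 * r))) (pr-suc n (2 * r)))))) ⟩
    s ⊗ k ⊗ (u ⊝ z ⊗ v ⊗ w) ⊝ s ⊗ (k ⊗ (1# ⊝ w)) ⊗ (z ⊗ v ⊗ g)
      ≈⟨ solve 8 (λ s k u z v w y g →
           s :* k :* (u :- z :* v :* w) :- s :* (k :* (con 1ℤ :- w)) :* (z :* v :* g)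
           := s :* k :* (con 1ℤ :- y) :* u :+ (s :* k :* (u :* y :- z :* v) :+ z :* (s :* (k :* (con 1ℤ :- w)) :* v :* (con 1ℤ :- g))))
         refl s k u z v w y g ⟩
    s ⊗ k ⊗ (1# ⊝ y) ⊗ u ⊕ (s ⊗ k ⊗ (u ⊗ y ⊝ z ⊗ v) ⊕ z ⊗ (s ⊗ (k ⊗ (1# ⊝ w)) ⊗ v ⊗ (1# ⊝ g)))
      ≈⟨ +-congˡ (+-cong (*-congˡ (+-cong (sym uy≈) (-‿cong (sym zv≈))))
           (*-congˡ (*-congʳ (*-congʳ (*-congˡ (sym (pr-suc n (2 * r)))))))) ⟩
    _ ∎
    where
    ν = 2 * β + c
    s = sgn n
    k = pr n (2 * r)
    kk = pr (suc n) (2 * r)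
    y = p n
    y₁ = p (suc n)
    w = p (suc n + 2 * r)
    u = p (suc ν * tri n + ν * r * n + (β + c) * n)
    vₑ = suc ν * tri n + ν * r * n + (suc ν + β) * n
    v = p vₑ
    z = p ((2 * r + 1) * β)
    g = p (c * (n + r + 1))
    v₁ = suc ν * tri n + ν * r * n + (suc ν + suc β) * n + suc β * (2 * r + 1)
    u₁ = suc ν * tri (suc n) + ν * r * suc n + (β + c) * suc n
    v₁≈ : p v₁ ≈ z ⊗ v ⊗ w
    v₁≈ = p-split₃ ((2 * r + 1) * β) vₑ (suc n + 2 * r) (e β c r n (tri n))
      where
      e : ∀ β c r n t → suc (2 * β + c) * t + (2 * β + c) * r * n + (suc (2 * β + c) + suc β) * n + suc β * (2 * r + 1)
        ≡ (2 * r + 1) * β + (suc (2 * β + c) * t + (2 * β + c) * r * n + (suc (2 * β + c) + β) * n) + (suc n + 2 * r)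
      e = solve-∀
    u₁≈ : p u₁ ≈ z ⊗ v ⊗ g
    u₁≈ = p-split₃ ((2 * r + 1) * β) vₑ (c * (n + r + 1)) (e β c r n (tri n))
      where
      e : ∀ β c r n t → suc (2 * β + c) * (t + n) + (2 * β + c) * r * suc n + (β + c) * suc n
        ≡ (2 * r + 1) * β + (suc (2 * β + c) * t + (2 * β + c) * r * n + (suc (2 * β + c) + β) * n) + c * (n + r + 1)
      e = solve-∀
    uy≈ : p (suc ν * tri n + ν * r * n + suc (β + c) * n) ≈ u ⊗ y
    uy≈ = p-split (suc ν * tri n + ν * r * n + (β + c) * n) n (e β c r n (tri n))
      where
      e : ∀ β c r n t → suc (2 * β + c) * t + (2 * β + c) * r * n + suc (β + c) * n ≡ suc (2 * β + c) * t + (2 * β + c) * r * n + (β + c) * n + n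
      e = solve-∀
    zv≈ : p (suc ν * tri n + ν * r * n + (suc ν + β) * n + β * (2 * r + 1)) ≈ z ⊗ v
    zv≈ = p-split ((2 * r + 1) * β) vₑ (e β c r n (tri n))
      where
      e : ∀ β c r n t → suc (2 * β + c) * t + (2 * β + c) * r * n + (suc (2 * β + c) + β) * n + β * (2 * r + 1)
        ≡ (2 * r + 1) * β + (suc (2 * β + c) * t + (2 * β + c) * r * n + (suc (2 * β + c) + β) * n)
      e = solve-∀

  -- With g, y, t as named in the proof, 1 - g y t = (1 - y) + y (1 - g) + g y (1 - t). The three
  -- summands give the flux a(n), the E term at β + 1, and the first power of the H term at r + 1,
  -- whose Pochhammer symbol absorbs 1 - t. The second power of that H term is a(n+1).
  E-E-term : ∀ β c r n → let ν = 2 * suc β + c in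
    let a = λ n → sgn n ⊗ pr n (suc (2 * r)) ⊗ (1# ⊝ p n) ⊗ p (suc ν * tri n + ν * r * n + (suc ν + β) * n) in
    eterm ν β (2 + c) r n ⊕ a (suc n) ≈ a n ⊕ (eterm ν (suc β) c r n ⊕ p (suc r * c) ⊗ hterm ν (suc β) (2 + β + c) (suc r) n)
  E-E-term β c r n = begin
    s ⊗ k ⊗ u ⊗ (1# ⊝ p ((2 + c) * (n + r + 1))) ⊕ (- 1# ⊗ s) ⊗ kk ⊗ (1# ⊝ y₁) ⊗ u₁
      ≈⟨ +-congʳ (*-congˡ (1⊝-cong gyt≈)) ⟩
    s ⊗ k ⊗ u ⊗ (1# ⊝ g ⊗ y ⊗ t) ⊕ (- 1# ⊗ s) ⊗ kk ⊗ (1# ⊝ y₁) ⊗ u₁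
      ≈⟨ solve 9 (λ s k u g y t kk y₁ u₁ →
           s :* k :* u :* (con 1ℤ :- g :* y :* t) :+ ((:- con 1ℤ) :* s) :* kk :* (con 1ℤ :- y₁) :* u₁
           := s :* k :* u :* (con 1ℤ :- g :* y :* t) :- s :* ((con 1ℤ :- y₁) :* kk) :* u₁) refl s k u g y t kk y₁ u₁ ⟩
    s ⊗ k ⊗ u ⊗ (1# ⊝ g ⊗ y ⊗ t) ⊝ s ⊗ ((1# ⊝ y₁) ⊗ kk) ⊗ u₁
      ≈⟨ +-congˡ (-‿cong (*-congʳ (*-congˡ (trans (sym (pr-shift n (suc (2 * r)))) (pr-suc n (suc (2 * r))))))) ⟩
    s ⊗ k ⊗ u ⊗ (1# ⊝ g ⊗ y ⊗ t) ⊝ s ⊗ (k ⊗ (1# ⊝ t)) ⊗ u₁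
      ≈⟨ solve 7 (λ s k u g y t u₁ →
           s :* k :* u :* (con 1ℤ :- g :* y :* t) :- s :* (k :* (con 1ℤ :- t)) :* u₁
           := s :* k :* (con 1ℤ :- y) :* u :+ (s :* k :* (u :* y) :* (con 1ℤ :- g) :+ s :* (k :* (con 1ℤ :- t)) :* (u :* g :* y :- u₁)))
         refl s k u g y t u₁ ⟩
    s ⊗ k ⊗ (1# ⊝ y) ⊗ u ⊕ (s ⊗ k ⊗ (u ⊗ y) ⊗ (1# ⊝ g) ⊕ s ⊗ (k ⊗ (1# ⊝ t)) ⊗ (u ⊗ g ⊗ y ⊝ u₁))
      ≈⟨ +-congˡ (+-cong (*-congʳ (*-congˡ (sym uy≈))) (*-cong (*-congˡ k'≈) (+-cong first≈ (-‿cong second≈)))) ⟩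
    s ⊗ k ⊗ (1# ⊝ y) ⊗ u ⊕ (eterm ν (suc β) c r n ⊕ s ⊗ pr n (2 * suc r) ⊗ (z ⊗ p h₁ ⊝ z ⊗ p h₂))
      ≈⟨ +-congˡ (+-congˡ (solve 5 (λ s k z a b → s :* k :* (z :* a :- z :* b) := z :* (s :* k :* (a :- b))) refl s (pr n (2 * suc r)) z (p h₁) (p h₂))) ⟩
    _ ∎
    where
    ν = 2 * suc β + c
    s = sgn n
    k = pr n (suc (2 * r))
    kk = pr (suc n) (suc (2 * r))
    y = p n
    y₁ = p (suc n)
    t = p (suc n + suc (2 * r))
    uₑ = suc ν * tri n + ν * r * n + (suc ν + β) * n
    u = p uₑ
    gₑ = c * (n + r + 1)
    g = p gₑ
    z = p (suc r * c)
    u₁ = p (suc ν * tri (suc n) + ν * r * suc n + (suc ν + β) * suc n)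
    h₁ = suc ν * tri n + ν * suc r * n + (2 + β + c) * n
    h₂ = suc ν * tri n + ν * suc r * n + (suc ν + suc β) * n + suc β * (2 * suc r + 1)
    gyt≈ : p ((2 + c) * (n + r + 1)) ≈ g ⊗ y ⊗ t
    gyt≈ = p-split₃ gₑ n (suc n + suc (2 * r)) (e c r n)
      where
      e : ∀ c r n → (2 + c) * (n + r + 1) ≡ c * (n + r + 1) + n + (suc n + suc (2 * r))
      e = solve-∀
    uy≈ : p (suc ν * tri n + ν * r * n + (suc ν + suc β) * n) ≈ u ⊗ y
    uy≈ = p-split uₑ n (e (suc ν * tri n + ν * r * n) (suc ν) β n)
      where
      e : ∀ a m β n → a + (m + suc β) * n ≡ a + (m + β) * n + n
      e = solve-∀
    k'≈ : k ⊗ (1# ⊝ t) ≈ pr n (2 * suc r)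
    k'≈ = trans (sym (pr-suc n (suc (2 * r)))) (reflexive (≡.cong (pr n) (≡.sym (ℕ.*-suc 2 r))))
    first≈ : u ⊗ g ⊗ y ≈ z ⊗ p h₁
    first≈ = trans (sym (p-split₃ uₑ gₑ n ≡.refl)) (p-split (suc r * c) h₁ (e β c r n (tri n)))
      where
      e : ∀ β c r n t → suc (2 * suc β + c) * t + (2 * suc β + c) * r * n + (suc (2 * suc β + c) + β) * n + c * (n + r + 1) + n
        ≡ suc r * c + (suc (2 * suc β + c) * t + (2 * suc β + c) * suc r * n + (2 + β + c) * n)
      e = solve-∀
    second≈ : u₁ ≈ z ⊗ p h₂
    second≈ = p-split (suc r * c) h₂ (e β c r n (tri n))
      where
      e : ∀ β c r n t → suc (2 * suc β + c) * (t + n) + (2 * suc β + c) * r * suc n + (suc (2 * suc β + c) + β) * suc n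
        ≡ suc r * c + (suc (2 * suc β + c) * t + (2 * suc β + c) * suc r * n + (suc (2 * suc β + c) + suc β) * n + suc β * (2 * suc r + 1))
      e = solve-∀

  -- Formally the case c = -1 of `E-E-term`. There the E term at β + 1 is -Q^(-(r+1)) times the E
  -- term at β with c = 1, so both E terms combine on one side; multiplication by Q^(r+1) clears the
  -- negative exponents and produces the factor 1 + Q^(r+1).
  E-H-term : ∀ β r n → let ν = 2 * β + 1 in
    let a = λ n → p (r + 1) ⊗ (sgn n ⊗ pr n (suc (2 * r)) ⊗ (1# ⊝ p n) ⊗ p (suc ν * tri n + ν * r * n + (suc ν + β) * n)) in
    (1# ⊕ p (r + 1)) ⊗ eterm ν β 1 r n ⊕ a (suc n) ≈ a n ⊕ hterm ν (suc β) (suc β) (suc r) n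
  E-H-term β r n = begin
    (1# ⊕ x) ⊗ (s ⊗ k ⊗ u ⊗ (1# ⊝ p (1 * (n + r + 1)))) ⊕ x ⊗ ((- 1# ⊗ s) ⊗ kk ⊗ (1# ⊝ y₁) ⊗ u₁)
      ≈⟨ +-congʳ (*-congˡ (*-congˡ (1⊝-cong (p-split n (r + 1) (e n r))))) ⟩
    (1# ⊕ x) ⊗ (s ⊗ k ⊗ u ⊗ (1# ⊝ y ⊗ x)) ⊕ x ⊗ ((- 1# ⊗ s) ⊗ kk ⊗ (1# ⊝ y₁) ⊗ u₁)
      ≈⟨ solve 8 (λ s k u x y kk y₁ u₁ →
           (con 1ℤ :+ x) :* (s :* k :* u :* (con 1ℤ :- y :* x)) :+ x :* (((:- con 1ℤ) :* s) :* kk :* (con 1ℤ :- y₁) :* u₁)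
           := (con 1ℤ :+ x) :* (s :* k :* u :* (con 1ℤ :- y :* x)) :- s :* ((con 1ℤ :- y₁) :* kk) :* (x :* u₁)) refl s k u x y kk y₁ u₁ ⟩
    (1# ⊕ x) ⊗ (s ⊗ k ⊗ u ⊗ (1# ⊝ y ⊗ x)) ⊝ s ⊗ ((1# ⊝ y₁) ⊗ kk) ⊗ (x ⊗ u₁)
      ≈⟨ +-congˡ (-‿cong (*-cong (*-congˡ (trans (sym (pr-shift n (suc (2 * r)))) k'≈)) second≈)) ⟩
    (1# ⊕ x) ⊗ (s ⊗ k ⊗ u ⊗ (1# ⊝ y ⊗ x)) ⊝ s ⊗ (k ⊗ (1# ⊝ y ⊗ x ⊗ x)) ⊗ p h₂
      ≈⟨ solve 6 (λ s k u x y h →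
           (con 1ℤ :+ x) :* (s :* k :* u :* (con 1ℤ :- y :* x)) :- s :* (k :* (con 1ℤ :- y :* x :* x)) :* h
           := x :* (s :* k :* (con 1ℤ :- y) :* u) :+ s :* (k :* (con 1ℤ :- y :* x :* x)) :* (u :- h)) refl s k u x y (p h₂) ⟩
    x ⊗ (s ⊗ k ⊗ (1# ⊝ y) ⊗ u) ⊕ s ⊗ (k ⊗ (1# ⊝ y ⊗ x ⊗ x)) ⊗ (u ⊝ p h₂)
      ≈⟨ +-congˡ (*-cong (*-congˡ (trans (sym k'≈) (reflexive (≡.cong (pr n) (≡.sym (ℕ.*-suc 2 r)))))) (+-congʳ (p-cong (e₁ β r n (tri n))))) ⟩
    _ ∎
    where
    ν = 2 * β + 1
    x = p (r + 1)
    s = sgn n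
    k = pr n (suc (2 * r))
    kk = pr (suc n) (suc (2 * r))
    y = p n
    y₁ = p (suc n)
    u = p (suc ν * tri n + ν * r * n + (suc ν + β) * n)
    u₁ₑ = suc ν * tri (suc n) + ν * r * suc n + (suc ν + β) * suc n
    u₁ = p u₁ₑ
    h₂ = suc ν * tri n + ν * suc r * n + (suc ν + suc β) * n + suc β * (2 * suc r + 1)
    e : ∀ n r → 1 * (n + r + 1) ≡ n + (r + 1)
    e = solve-∀
    e₁ : ∀ β r n t → suc (2 * β + 1) * t + (2 * β + 1) * r * n + (suc (2 * β + 1) + β) * n
      ≡ suc (2 * β + 1) * t + (2 * β + 1) * suc r * n + suc β * n
    e₁ = solve-∀
    e₂ : ∀ n r → suc n + suc (2 * r) ≡ n + (r + 1) + (r + 1)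
    e₂ = solve-∀
    k'≈ : pr n (suc (suc (2 * r))) ≈ k ⊗ (1# ⊝ y ⊗ x ⊗ x)
    k'≈ = trans (pr-suc n (suc (2 * r))) (*-congˡ (1⊝-cong (p-split₃ n (r + 1) (r + 1) (e₂ n r))))
    second≈ : x ⊗ u₁ ≈ p h₂
    second≈ = sym (p-split (r + 1) u₁ₑ (e₃ β r n (tri n)))
      where
      e₃ : ∀ β r n t → suc (2 * β + 1) * t + (2 * β + 1) * suc r * n + (suc (2 * β + 1) + suc β) * n + suc β * (2 * suc r + 1)
        ≡ r + 1 + (suc (2 * β + 1) * (t + n) + (2 * β + 1) * r * suc n + (suc (2 * β + 1) + β) * suc n)
      e₃ = solve-∀

  module Nilpotent (ℓ : ℕ) (nil : Q ^ ℓ ≈ 0#) where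

    p-zero : ∀ e → ℓ ≤ e → p e ≈ 0#
    p-zero e = ^-zero Q ℓ e nil

    H : (ν b b̄ r : ℕ) → Carrier
    H ν b b̄ r = Σ (hterm ν b b̄ r) ℓ

    E : (ν β c r : ℕ) → Carrier
    E ν β c r = Σ (eterm ν β c r) ℓ

    at-zero : ∀ x k u → x ⊗ k ⊗ (1# ⊝ p 0) ⊗ u ≈ 0#
    at-zero x k u = solve 3 (λ x k u → x :* k :* (con 1ℤ :- con 1ℤ) :* u := con 0ℤ) refl x k u

    at-ℓ : ∀ x e → ℓ ≤ e → x ⊗ p e ≈ 0#
    at-ℓ x e h = trans (*-congˡ (p-zero e h)) (zeroʳ x)

    ℓ≤ : ∀ e f → ℓ ≤ e + suc f * ℓ
    ℓ≤ e f = ℕ.≤-trans (ℕ.m≤m+n ℓ (f * ℓ)) (ℕ.m≤n+m _ e)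

    -- Writing `suc c` keeps the coefficient of n in the exponent of the flux positive even at β =
    -- 0, so that the flux vanishes at n = ℓ.
    H-step : ∀ β c r → let ν = 2 * β + suc c in
      H ν (suc β) (β + suc c) r ≈ H ν β (suc (β + suc c)) r ⊕ p ((2 * r + 1) * β) ⊗ E ν β (suc c) r
    H-step β c r = begin
      Σ (hterm ν (suc β) (β + suc c) r) ℓ
        ≈⟨ Σ-telescope (hterm ν (suc β) (β + suc c) r) (λ n → hterm ν β (suc (β + suc c)) r n ⊕ p ((2 * r + 1) * β) ⊗ eterm ν β (suc c) r n)
             (λ n → sgn n ⊗ pr n (2 * r) ⊗ (1# ⊝ p n) ⊗ p (suc ν * tri n + ν * r * n + (β + suc c) * n)) ℓ
             (H-E-term β (suc c) r) (at-zero _ _ _)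
             (at-ℓ _ _ (≡.subst (λ f → ℓ ≤ suc ν * tri ℓ + ν * r * ℓ + f * ℓ) (≡.sym (ℕ.+-suc β c)) (ℓ≤ (suc ν * tri ℓ + ν * r * ℓ) (β + c)))) ⟩
      Σ (λ n → hterm ν β (suc (β + suc c)) r n ⊕ p ((2 * r + 1) * β) ⊗ eterm ν β (suc c) r n) ℓ
        ≈⟨ Σ-+ _ _ ℓ ⟩
      Σ (hterm ν β (suc (β + suc c)) r) ℓ ⊕ Σ (λ n → p ((2 * r + 1) * β) ⊗ eterm ν β (suc c) r n) ℓ
        ≈⟨ +-congˡ (Σ-*ˡ _ _ ℓ) ⟩
      _ ∎
      where ν = 2 * β + suc c

    E-step : ∀ β c r → let ν = 2 * suc β + c in
      E ν β (2 + c) r ≈ E ν (suc β) c r ⊕ p (suc r * c) ⊗ H ν (suc β) (2 + β + c) (suc r)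
    E-step β c r = begin
      Σ (eterm ν β (2 + c) r) ℓ
        ≈⟨ Σ-telescope (eterm ν β (2 + c) r) (λ n → eterm ν (suc β) c r n ⊕ p (suc r * c) ⊗ hterm ν (suc β) (2 + β + c) (suc r) n)
             (λ n → sgn n ⊗ pr n (suc (2 * r)) ⊗ (1# ⊝ p n) ⊗ p (suc ν * tri n + ν * r * n + (suc ν + β) * n)) ℓ
             (E-E-term β c r) (at-zero _ _ _) (at-ℓ _ (suc ν * tri ℓ + ν * r * ℓ + (suc ν + β) * ℓ) (ℓ≤ (suc ν * tri ℓ + ν * r * ℓ) (ν + β))) ⟩
      Σ (λ n → eterm ν (suc β) c r n ⊕ p (suc r * c) ⊗ hterm ν (suc β) (2 + β + c) (suc r) n) ℓ
        ≈⟨ Σ-+ _ _ ℓ ⟩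
      Σ (eterm ν (suc β) c r) ℓ ⊕ Σ (λ n → p (suc r * c) ⊗ hterm ν (suc β) (2 + β + c) (suc r) n) ℓ
        ≈⟨ +-congˡ (Σ-*ˡ _ _ ℓ) ⟩
      _ ∎
      where ν = 2 * suc β + c

    E-top-odd : ∀ ν β r → E ν β 0 r ≈ 0#
    E-top-odd ν β r = Σ-zero _ ℓ λ n _ → trans (*-congˡ (-‿inverseʳ 1#)) (zeroʳ _)

    E-top-even : ∀ β r → let ν = 2 * β + 1 in (1# ⊕ p (r + 1)) ⊗ E ν β 1 r ≈ H ν (suc β) (suc β) (suc r)
    E-top-even β r = trans (sym (Σ-*ˡ _ _ ℓ))
      (Σ-telescope (λ n → (1# ⊕ p (r + 1)) ⊗ eterm ν β 1 r n) (hterm ν (suc β) (suc β) (suc r))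
        (λ n → p (r + 1) ⊗ (sgn n ⊗ pr n (suc (2 * r)) ⊗ (1# ⊝ p n) ⊗ p (suc ν * tri n + ν * r * n + (suc ν + β) * n))) ℓ
        (E-H-term β r) (trans (*-congˡ (at-zero _ _ _)) (zeroʳ _)) (trans (*-congˡ (at-ℓ _ (suc ν * tri ℓ + ν * r * ℓ + (suc ν + β) * ℓ) (ℓ≤ (suc ν * tri ℓ + ν * r * ℓ) (ν + β)))) (zeroʳ _)))
      where ν = 2 * β + 1

    -- At b = 0 the two powers in every term coincide. This mirrors the empty family of partitions
    -- with fewer than 0 copies of a part and starts the recursion in b.
    H-zero : ∀ ν r → H ν 0 (suc ν) r ≈ 0#
    H-zero ν r = Σ-zero _ ℓ λ n _ → trans (*-congˡ (trans (+-congˡ (-‿cong (p-cong (e ν r n (tri n))))) (-‿inverseʳ _))) (zeroʳ _)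
      where
      e : ∀ ν r n t → suc ν * t + ν * r * n + (suc ν + 0) * n + 0 * (2 * r + 1) ≡ suc ν * t + ν * r * n + suc ν * n
      e = solve-∀

    -- For n ≥ 1 both exponents are at least r ≥ ℓ, and at n = 0 the second is b (2r + 1) ≥ ℓ while
    -- the first is 0. Only the Pochhammer symbol of the term n = 0 is left.
    H-limit : 1 ≤ ℓ → ∀ ν b b̄ r → ℓ ≤ r → H (suc ν) (suc b) b̄ r ≈ pr 0 (2 * r)
    H-limit (s≤s {n = ℓ'} _) ν b b̄ r ℓ≤r = begin
      Σ (hterm (suc ν) (suc b) b̄ r) (suc ℓ')                    ≈⟨ Σ-suc _ ℓ' ⟩
      h 0 ⊕ Σ (λ n → h (suc n)) ℓ'  ≈⟨ +-cong head (Σ-zero _ ℓ' λ n _ → tail n) ⟩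
      pr 0 (2 * r) ⊕ 0#                                         ≈⟨ +-identityʳ _ ⟩
      pr 0 (2 * r)                                              ∎
      where
      h = hterm (suc ν) (suc b) b̄ r
      ℓ≤r* : ∀ x n f → ℓ ≤ x + suc ν * r * suc n + f
      ℓ≤r* x n f = ℕ.≤-trans ℓ≤r (ℕ.≤-trans (ℕ.≤-trans (ℕ.m≤m+n r (ν * r)) (ℕ.m≤m*n _ (suc n)))
        (ℕ.≤-trans (ℕ.m≤n+m _ x) (ℕ.m≤m+n _ f)))
      tail : ∀ n → h (suc n) ≈ 0#
      tail n = begin
        h (suc n)
          ≈⟨ *-congˡ (+-cong (p-zero (x + b̄ * suc n) (ℓ≤r* xₜ n (b̄ * suc n)))
               (-‿cong (p-zero (x + y + z) (ℕ.≤-trans (ℓ≤r* xₜ n y) (ℕ.m≤m+n (x + y) z))))) ⟩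
        sgn (suc n) ⊗ pr (suc n) (2 * r) ⊗ (0# ⊝ 0#)  ≈⟨ *-congˡ (-‿inverseʳ 0#) ⟩
        sgn (suc n) ⊗ pr (suc n) (2 * r) ⊗ 0#         ≈⟨ zeroʳ _ ⟩
        0#                                            ∎
        where
        xₜ = suc (suc ν) * tri (suc n)
        x = xₜ + suc ν * r * suc n
        y = (suc (suc ν) + suc b) * suc n
        z = suc b * (2 * r + 1)
      ℓ≤b : ℓ ≤ suc b * (2 * r + 1)
      ℓ≤b = ℕ.≤-trans ℓ≤r (ℕ.≤-trans (ℕ.≤-trans (ℕ.m≤m+n r _) (ℕ.m≤m+n (2 * r) 1)) (ℕ.m≤n*m _ (suc b)))
      head : h 0 ≈ pr 0 (2 * r)
      head = begin
        1# ⊗ pr 0 (2 * r) ⊗ (p (e₀ + b̄ * 0) ⊝ p (e₀ + (suc (suc ν) + suc b) * 0 + suc b * (2 * r + 1)))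
          ≈⟨ *-congˡ (+-cong (p-cong (e ν r b̄)) (-‿cong (p-zero _ (ℕ.≤-trans ℓ≤b (ℕ.m≤n+m _ (e₀ + (suc (suc ν) + suc b) * 0)))))) ⟩
        1# ⊗ pr 0 (2 * r) ⊗ (1# ⊝ 0#)
          ≈⟨ solve 1 (λ x → con 1ℤ :* x :* (con 1ℤ :- con 0ℤ) := x) refl (pr 0 (2 * r)) ⟩
        pr 0 (2 * r) ∎
        where
        e₀ = suc (suc ν) * 0 + suc ν * r * 0
        e : ∀ ν r b̄ → suc (suc ν) * 0 + suc ν * r * 0 + b̄ * 0 ≡ 0
        e = solve-∀

-- w = 2 e / d, so that the modulus of the theorem is d (2 k + w + 1).
Parity : (d e w : ℕ) → Set
Parity d e w = (e ≡ d × w ≡ 2) ⊎ (2 * e ≡ d × w ≡ 1)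

module _ {d e w : ℕ} where

  2e≡wd : Parity d e w → 2 * e ≡ w * d
  2e≡wd (inj₁ (≡.refl , ≡.refl)) = ≡.refl
  2e≡wd (inj₂ (≡.refl , ≡.refl)) = ≡.sym (ℕ.+-identityʳ _)

  e≤d : Parity d e w → e ≤ d
  e≤d (inj₁ (≡.refl , _)) = ℕ.≤-refl
  e≤d (inj₂ (≡.refl , _)) = ℕ.m≤m+n e _

  w-positive : Parity d e w → ∃[ w′ ] w ≡ suc w′
  w-positive (inj₁ (_ , ≡.refl)) = 1 , ≡.refl
  w-positive (inj₂ (_ , ≡.refl)) = 0 , ≡.refl

-- The recurrence over pairs of part sizes and its solution

module Levels
  (R : CommutativeRing 0ℓ 0ℓ) (q : CommutativeRing.Carrier R) (d k e w : ℕ)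
  (parity : Parity d e w)
  where

  open CommutativeRing R hiding (_+_; _*_; _-_; zero)
  open CommutativeRing R using () renaming (_+_ to infixl 6 _⊕_; _-_ to infixl 6 _⊝_; _*_ to infixl 7 _⊗_)
  open import Algebra.Properties.Semiring.Exp semiring using (_^_; ^-homo-*; ^-congʳ; ^-assocʳ)
  open import Relation.Binary.Reasoning.Setoid setoid
  open IntegerSolver R
  open Sums R

  Q : Carrier
  Q = q ^ d

  open QDifference R Q

  M ν : ℕ
  M = d * k + e
  ν = 2 * k + w

  q^≈p : ∀ {m} n → m ≡ d * n → q ^ m ≈ p n
  q^≈p n m≡ = trans (^-congʳ q m≡) (sym (^-assocʳ q d n))

  geo : Carrier → ℕ → Carrier
  geo t n = Σ (t ^_) n

  geo-closed : ∀ t n → geo t n ⊗ (1# ⊝ t) ≈ 1# ⊝ t ^ n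
  geo-closed t zero    = trans (zeroˡ _) (sym (-‿inverseʳ 1#))
  geo-closed t (suc n) = begin
    (geo t n ⊕ t ^ n) ⊗ (1# ⊝ t)                ≈⟨ distribʳ _ _ _ ⟩
    geo t n ⊗ (1# ⊝ t) ⊕ t ^ n ⊗ (1# ⊝ t)       ≈⟨ +-congʳ (geo-closed t n) ⟩
    (1# ⊝ t ^ n) ⊕ t ^ n ⊗ (1# ⊝ t)             ≈⟨ solve 2 (λ x t → (con 1ℤ :- x) :+ x :* (con 1ℤ :- t) := con 1ℤ :- t :* x) refl (t ^ n) t ⟩
    1# ⊝ t ⊗ t ^ n                              ∎

  -- V j r / W j r is the product of the factors (1 - t ^ d) / (1 - t) of the even
  -- layers t = q²ʳ⁺², …, by which the series H differs from the partition series.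
  W V : ℕ → ℕ → Carrier
  W zero    r = 1#
  W (suc j) r = (1# ⊝ q ^ (2 * r + 2)) ⊗ W j (suc r)
  V zero    r = 1#
  V (suc j) r = (1# ⊝ (q ^ (2 * r + 2)) ^ d) ⊗ V j (suc r)

  module Truncation (ℓ : ℕ) (1≤ℓ : 1 ≤ ℓ) (nil : Q ^ ℓ ≈ 0#) where

    open Nilpotent ℓ nil

    -- These are used with β + i = k and b = β + 1. Carrying i = k - β as a second index gives c = ν
    -- - 2β = 2i + w without subtraction.
    Hb Eb : (β i r : ℕ) → Carrier
    Hb β i r = H ν (suc β) (β + (2 * i + w)) r
    Eb β i r = E ν β (2 * i + w) r

    H-step′ : ∀ ν β c r → ν ≡ 2 * β + c → ∃[ c′ ] c ≡ suc c′ →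
      H ν (suc β) (β + c) r ≈ H ν β (suc (β + c)) r ⊕ p ((2 * r + 1) * β) ⊗ E ν β c r
    H-step′ _ β _ r ≡.refl (c′ , ≡.refl) = H-step β c′ r

    positive : ∀ i → ∃[ c′ ] 2 * i + w ≡ suc c′
    positive i with w′ , w≡ ← w-positive parity = 2 * i + w′ , ≡.trans (≡.cong (λ x → 2 * i + x) w≡) (ℕ.+-suc (2 * i) w′)

    ν≡ : ∀ β i → β + i ≡ k → ν ≡ 2 * β + (2 * i + w)
    ν≡ β i ≡.refl = lemma β i w
      where
      lemma : ∀ β i w → 2 * (β + i) + w ≡ 2 * β + (2 * i + w)
      lemma = solve-∀

    Hb-zero : ∀ r → Hb 0 k r ≈ p ((2 * r + 1) * 0) ⊗ Eb 0 k r
    Hb-zero r = begin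
      Hb 0 k r                                             ≈⟨ H-step′ ν 0 ν r ≡.refl (positive k) ⟩
      H ν 0 (suc ν) r ⊕ p ((2 * r + 1) * 0) ⊗ E ν 0 ν r    ≈⟨ +-congʳ (H-zero ν r) ⟩
      0# ⊕ p ((2 * r + 1) * 0) ⊗ E ν 0 ν r                 ≈⟨ +-identityˡ _ ⟩
      p ((2 * r + 1) * 0) ⊗ Eb 0 k r                       ∎

    Hb-suc : ∀ β i r → suc β + i ≡ k → Hb (suc β) i r ≈ Hb β (suc i) r ⊕ p ((2 * r + 1) * suc β) ⊗ Eb (suc β) i r
    Hb-suc β i r h = trans (H-step′ ν (suc β) (2 * i + w) r (ν≡ (suc β) i h) (positive i))
      (+-congʳ (reflexive (≡.cong (λ b̄ → H ν (suc β) b̄ r) (lemma β i w))))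
      where
      lemma : ∀ β i w → suc (suc β + (2 * i + w)) ≡ β + (2 * suc i + w)
      lemma = solve-∀

    E-step′ : ∀ ν β c r → ν ≡ 2 * suc β + c →
      E ν β (2 + c) r ≈ E ν (suc β) c r ⊕ p (suc r * c) ⊗ H ν (suc β) (2 + β + c) (suc r)
    E-step′ _ β c r ≡.refl = E-step β c r

    Eb-suc : ∀ β i r → suc β + i ≡ k → Eb β (suc i) r ≈ Eb (suc β) i r ⊕ p (suc r * (2 * i + w)) ⊗ Hb β (suc i) (suc r)
    Eb-suc β i r h = begin
      Eb β (suc i) r
        ≡⟨ ≡.cong (λ c → E ν β c r) (lemma₁ i w) ⟩
      E ν β (2 + (2 * i + w)) r
        ≈⟨ E-step′ ν β (2 * i + w) r (ν≡ (suc β) i h) ⟩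
      Eb (suc β) i r ⊕ p (suc r * (2 * i + w)) ⊗ H ν (suc β) (2 + β + (2 * i + w)) (suc r)
        ≡⟨ ≡.cong (λ b̄ → Eb (suc β) i r ⊕ p (suc r * (2 * i + w)) ⊗ H ν (suc β) b̄ (suc r)) (lemma₂ β i w) ⟩
      Eb (suc β) i r ⊕ p (suc r * (2 * i + w)) ⊗ Hb β (suc i) (suc r) ∎
      where
      lemma₁ : ∀ i w → 2 * suc i + w ≡ 2 + (2 * i + w)
      lemma₁ = solve-∀
      lemma₂ : ∀ β i w → 2 + β + (2 * i + w) ≡ β + (2 * suc i + w)
      lemma₂ = solve-∀

    -- The short block supplies 1 - t^e where the normalisation expects 1 - t^d. For e = d, one more
    -- E step reaches c = 0, where E vanishes, so Eb is Hb one level up. For 2e = d, t^e = Q^(r+1)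
    -- and (1 - t^e)(1 + t^e) = 1 - t^d supplies the factor required by `E-top-even`.
    Eb-top : ∀ r → (1# ⊝ (q ^ (2 * r + 2)) ^ e) ⊗ Hb k 0 (suc r) ≈ (1# ⊝ (q ^ (2 * r + 2)) ^ d) ⊗ Eb k 0 r
    Eb-top r = case parity
      where
      t = q ^ (2 * r + 2)
      lemma : ∀ k → 2 * k + 2 ≡ 2 * suc k + 0
      lemma = solve-∀
      case : Parity d e w → (1# ⊝ t ^ e) ⊗ Hb k 0 (suc r) ≈ (1# ⊝ t ^ d) ⊗ Eb k 0 r
      case (inj₁ (≡.refl , ≡.refl)) = *-congˡ (sym (begin
        Eb k 0 r
          ≈⟨ E-step′ ν k 0 r (lemma k) ⟩
        E ν (suc k) 0 r ⊕ p (suc r * 0) ⊗ H ν (suc k) (2 + k + 0) (suc r)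
          ≈⟨ +-cong (E-top-odd ν (suc k) r) (*-cong (p-cong (ℕ.*-zeroʳ (suc r))) (reflexive (≡.cong (λ b̄ → H ν (suc k) b̄ (suc r)) (lemma₂ k)))) ⟩
        0# ⊕ 1# ⊗ Hb k 0 (suc r)
          ≈⟨ trans (+-identityˡ _) (*-identityˡ _) ⟩
        Hb k 0 (suc r) ∎))
        where
        lemma₂ : ∀ k → 2 + k + 0 ≡ k + (2 * 0 + 2)
        lemma₂ = solve-∀
      case (inj₂ (2e≡d , ≡.refl)) = begin
        (1# ⊝ t ^ e) ⊗ Hb k 0 (suc r)
          ≡⟨ ≡.cong (λ b̄ → (1# ⊝ t ^ e) ⊗ H ν (suc k) b̄ (suc r)) (ℕ.+-comm k 1) ⟩
        (1# ⊝ t ^ e) ⊗ H ν (suc k) (suc k) (suc r)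
          ≈⟨ *-congˡ (sym (E-top-even k r)) ⟩
        (1# ⊝ t ^ e) ⊗ ((1# ⊕ p (r + 1)) ⊗ Eb k 0 r)
          ≈⟨ *-congˡ (*-congʳ (+-congˡ (sym t^e≈))) ⟩
        (1# ⊝ t ^ e) ⊗ ((1# ⊕ t ^ e) ⊗ Eb k 0 r)
          ≈⟨ solve 2 (λ x y → (con 1ℤ :- x) :* ((con 1ℤ :+ x) :* y) := (con 1ℤ :- x :* x) :* y) refl (t ^ e) (Eb k 0 r) ⟩
        (1# ⊝ t ^ e ⊗ t ^ e) ⊗ Eb k 0 r
          ≈⟨ *-congʳ (1⊝-cong (trans (sym (^-homo-* t e e)) (^-congʳ t (≡.trans (≡.cong (λ x → e + x) (≡.sym (ℕ.+-identityʳ e))) 2e≡d)))) ⟩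
        (1# ⊝ t ^ d) ⊗ Eb k 0 r ∎
        where
        lemma₃ : ∀ r e → (2 * r + 2) * e ≡ 2 * e * (r + 1)
        lemma₃ = solve-∀
        t^e≈ : t ^ e ≈ p (r + 1)
        t^e≈ = trans (^-assocʳ q (2 * r + 2) e) (q^≈p (r + 1) (≡.trans (lemma₃ r e) (≡.cong (_* (r + 1)) 2e≡d)))

    -- The solution of the recurrence uses only these equations. Here `j` counts the remaining pairs
    -- of part sizes above 2r, and `B` is the strict bound on the multiplicity of 2r + 1 in `Odd`
    -- and of 2r + 2 in `Even`.
    module Recurrence
      (Odd Even : (j r B : ℕ) → Carrier)
      (Odd-base : ∀ r B → Odd 0 r B ≈ 1#)
      (Odd-skip : ∀ j r b x → x < d → Odd j r (d * b + suc x) ≈ Odd j r (d * suc b))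
      (Odd-zero : ∀ j r → Odd (suc j) r (d * 0) ≈ 0#)
      (Odd-step : ∀ j r b → Odd (suc j) r (d * suc b) ≈ Odd (suc j) r (d * b) ⊕ q ^ ((2 * r + 1) * (d * b)) ⊗ Even j r (M ∸ d * b))
      (Even-zero : ∀ j r → Even j r 0 ≈ 0#)
      (Even-step : ∀ j r m → Even j r (suc m) ≈ Even j r m ⊕ q ^ ((2 * r + 2) * m) ⊗ Odd j (suc r) (M ∸ m))
      where

      -- Along the run, the bound left for part 2r + 3 stays in the interval (d b, d (b + 1)], on
      -- which `Odd` is constant; the multiplicities m, ..., m + s - 1 then sum to a geometric
      -- series.
      Even-run : ∀ j r b m s → (∀ s′ → s′ < s → ∃[ x ] (x < d × M ∸ (m + s′) ≡ d * b + suc x)) →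
        Even j r (m + s) ≈ Even j r m ⊕ q ^ ((2 * r + 2) * m) ⊗ geo (q ^ (2 * r + 2)) s ⊗ Odd j (suc r) (d * suc b)
      Even-run j r b m zero    h = begin
        Even j r (m + 0)                         ≡⟨ ≡.cong (Even j r) (ℕ.+-identityʳ m) ⟩
        Even j r m                               ≈⟨ solve 3 (λ x y z → x := x :+ y :* con 0ℤ :* z) refl (Even j r m) (q ^ ((2 * r + 2) * m)) (Odd j (suc r) (d * suc b)) ⟩
        Even j r m ⊕ q ^ ((2 * r + 2) * m) ⊗ 0# ⊗ Odd j (suc r) (d * suc b) ∎
      Even-run j r b m (suc s) h with x , x<d , M∸≡ ← h s ℕ.≤-refl = begin
        Even j r (m + suc s)
          ≡⟨ ≡.cong (Even j r) (ℕ.+-suc m s) ⟩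
        Even j r (suc (m + s))
          ≈⟨ Even-step j r (m + s) ⟩
        Even j r (m + s) ⊕ q ^ ((2 * r + 2) * (m + s)) ⊗ Odd j (suc r) (M ∸ (m + s))
          ≈⟨ +-cong (Even-run j r b m s (λ s′ s′<s → h s′ (ℕ.m<n⇒m<1+n s′<s)))
               (*-cong pow≈ (trans (reflexive (≡.cong (Odd j (suc r)) M∸≡)) (Odd-skip j (suc r) b x x<d))) ⟩
        Even j r m ⊕ y ⊗ geo t s ⊗ o ⊕ (y ⊗ t ^ s) ⊗ o
          ≈⟨ solve 5 (λ a y g u o → a :+ y :* g :* o :+ (y :* u) :* o := a :+ y :* (g :+ u) :* o) refl (Even j r m) y (geo t s) (t ^ s) o ⟩
        Even j r m ⊕ y ⊗ (geo t s ⊕ t ^ s) ⊗ o ∎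
        where
        t = q ^ (2 * r + 2)
        y = q ^ ((2 * r + 2) * m)
        o = Odd j (suc r) (d * suc b)
        pow≈ : q ^ ((2 * r + 2) * (m + s)) ≈ y ⊗ t ^ s
        pow≈ = trans (^-congʳ q (ℕ.*-distribˡ-+ (2 * r + 2) m s))
          (trans (^-homo-* q ((2 * r + 2) * m) ((2 * r + 2) * s)) (*-congˡ (sym (^-assocʳ q (2 * r + 2) s))))

      below : ∀ b c s → c ≤ d → s < c → ∃[ x ] (x < d × d * b + c ∸ s ≡ d * b + suc x)
      below b c s c≤d s<c = c ∸ suc s ,
        ℕ.<-≤-trans (ℕ.∸-monoʳ-< {c} {suc s} {0} (s≤s z≤n) s<c) c≤d ,
        ≡.trans (ℕ.+-∸-assoc (d * b) (ℕ.<⇒≤ s<c)) (≡.cong (λ x → d * b + x) (ℕ.+-∸-assoc 1 s<c))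

      Even-suc : ∀ j r β i → suc β + i ≡ k →
        Even j r (d * suc i + e) ≈ Even j r (d * i + e) ⊕ q ^ ((2 * r + 2) * (d * i + e)) ⊗ geo (q ^ (2 * r + 2)) d ⊗ Odd j (suc r) (d * suc β)
      Even-suc j r β i h = trans (reflexive (≡.cong (Even j r) (lemma₁ d i e)))
        (Even-run j r β (d * i + e) d λ s s<d → let x , x<d , eq = below β d s ℕ.≤-refl s<d in x , x<d , ≡.trans (M∸ s) eq)
        where
        lemma₁ : ∀ d i e → d * suc i + e ≡ d * i + e + d
        lemma₁ = solve-∀
        lemma₂ : ∀ d β i e → d * (suc β + i) + e ≡ d * i + e + (d * β + d)
        lemma₂ = solve-∀
        M∸ : ∀ s → M ∸ (d * i + e + s) ≡ d * β + d ∸ s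
        M∸ s = ≡.trans (≡.cong (_∸ (d * i + e + s)) (≡.trans (≡.cong (λ k → d * k + e) (≡.sym h)) (lemma₂ d β i e)))
          (ℕ.[m+n]∸[m+o]≡n∸o (d * i + e) (d * β + d) s)

      -- The short block: the bounds M - s with s < e lie in (d k, d k + e] and round up to d (k +
      -- 1), while M - e is d k itself. Since e ≤ d, no bound overshoots. This is why the closed
      -- form must also cover b = k + 1.
      Even-top : ∀ j r → Even j r (d * 0 + e) ≈ geo (q ^ (2 * r + 2)) e ⊗ Odd j (suc r) (d * suc k)
      Even-top j r = begin
        Even j r (d * 0 + e)
          ≡⟨ ≡.cong (λ z → Even j r (z + e)) (ℕ.*-zeroʳ d) ⟩
        Even j r (0 + e)
          ≈⟨ Even-run j r k 0 e (λ s s<e → below k e s (e≤d parity) s<e) ⟩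
        Even j r 0 ⊕ q ^ ((2 * r + 2) * 0) ⊗ g ⊗ o
          ≈⟨ +-cong (Even-zero j r) (*-congʳ (*-congʳ (^-congʳ q (ℕ.*-zeroʳ (2 * r + 2))))) ⟩
        0# ⊕ 1# ⊗ g ⊗ o
          ≈⟨ solve 2 (λ g o → con 0ℤ :+ con 1ℤ :* g :* o := g :* o) refl g o ⟩
        g ⊗ o ∎
        where
        g = geo (q ^ (2 * r + 2)) e
        o = Odd j (suc r) (d * suc k)

      Y : Carrier
      Y = pr 0 (2 * ℓ)

      -- Denominators are cleared throughout; Y stands for (Q; Q)∞.
      Closed : ℕ → ℕ → Set
      Closed j r = ∀ β i → β + i ≡ k → Odd j r (d * suc β) ⊗ Y ⊗ W j r ≈ Hb β i r ⊗ V j r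

      -- Induction on i, beginning with the short block. The factor 1 - t gained by `W` turns each
      -- full geometric sum into 1 - t^d, the factor gained by `V`, and the remaining relation is
      -- the E recurrence.
      Even-closed : ∀ j r → Closed j (suc r) → ∀ i β → β + i ≡ k → Even j r (d * i + e) ⊗ Y ⊗ W (suc j) r ≈ Eb β i r ⊗ V (suc j) r
      Even-closed j r closed zero    β h with ≡.refl ← ≡.trans (≡.sym (ℕ.+-identityʳ β)) h = begin
        Even j r (d * 0 + e) ⊗ Y ⊗ ((1# ⊝ t) ⊗ W j (suc r))
          ≈⟨ *-congʳ (*-congʳ (Even-top j r)) ⟩
        geo t e ⊗ o ⊗ Y ⊗ ((1# ⊝ t) ⊗ W j (suc r))
          ≈⟨ solve 5 (λ g o y t w → g :* o :* y :* ((con 1ℤ :- t) :* w) := (g :* (con 1ℤ :- t)) :* (o :* y :* w)) refl (geo t e) o Y t (W j (suc r)) ⟩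
        (geo t e ⊗ (1# ⊝ t)) ⊗ (o ⊗ Y ⊗ W j (suc r))
          ≈⟨ *-cong (geo-closed t e) (closed k 0 h) ⟩
        (1# ⊝ t ^ e) ⊗ (Hb k 0 (suc r) ⊗ V j (suc r))
          ≈⟨ sym (*-assoc _ _ _) ⟩
        (1# ⊝ t ^ e) ⊗ Hb k 0 (suc r) ⊗ V j (suc r)
          ≈⟨ *-congʳ (Eb-top r) ⟩
        (1# ⊝ t ^ d) ⊗ Eb k 0 r ⊗ V j (suc r)
          ≈⟨ trans (*-congʳ (*-comm _ _)) (*-assoc _ _ _) ⟩
        Eb k 0 r ⊗ ((1# ⊝ t ^ d) ⊗ V j (suc r)) ∎
        where
        t = q ^ (2 * r + 2)
        o = Odd j (suc r) (d * suc k)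
      Even-closed j r closed (suc i) β h = begin
        Even j r (d * suc i + e) ⊗ Y ⊗ ((1# ⊝ t) ⊗ W j (suc r))
          ≈⟨ *-congʳ (*-congʳ (Even-suc j r β i h′)) ⟩
        (Even j r (d * i + e) ⊕ x ⊗ geo t d ⊗ o) ⊗ Y ⊗ ((1# ⊝ t) ⊗ W j (suc r))
          ≈⟨ solve 7 (λ a x g o y t w → (a :+ x :* g :* o) :* y :* ((con 1ℤ :- t) :* w)
               := a :* y :* ((con 1ℤ :- t) :* w) :+ x :* (g :* (con 1ℤ :- t)) :* (o :* y :* w)) refl (Even j r (d * i + e)) x (geo t d) o Y t (W j (suc r)) ⟩
        Even j r (d * i + e) ⊗ Y ⊗ ((1# ⊝ t) ⊗ W j (suc r)) ⊕ x ⊗ (geo t d ⊗ (1# ⊝ t)) ⊗ (o ⊗ Y ⊗ W j (suc r))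
          ≈⟨ +-cong (Even-closed j r closed i (suc β) h′) (*-cong (*-cong x≈ (geo-closed t d)) (closed β (suc i) h)) ⟩
        Eb (suc β) i r ⊗ V (suc j) r ⊕ p (suc r * (2 * i + w)) ⊗ (1# ⊝ t ^ d) ⊗ (Hb β (suc i) (suc r) ⊗ V j (suc r))
          ≈⟨ solve 5 (λ a b c d e → a :* (c :* d) :+ b :* c :* (e :* d) := (a :+ b :* e) :* (c :* d)) refl
               (Eb (suc β) i r) (p (suc r * (2 * i + w))) (1# ⊝ t ^ d) (V j (suc r)) (Hb β (suc i) (suc r)) ⟩
        (Eb (suc β) i r ⊕ p (suc r * (2 * i + w)) ⊗ Hb β (suc i) (suc r)) ⊗ V (suc j) r
          ≈⟨ *-congʳ (sym (Eb-suc β i r h′)) ⟩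
        Eb β (suc i) r ⊗ V (suc j) r ∎
        where
        h′ = ≡.trans (≡.sym (ℕ.+-suc β i)) h
        t = q ^ (2 * r + 2)
        x = q ^ ((2 * r + 2) * (d * i + e))
        o = Odd j (suc r) (d * suc β)
        lemma₁ : ∀ r d i e → (2 * r + 2) * (d * i + e) ≡ suc r * (2 * (d * i) + 2 * e)
        lemma₁ = solve-∀
        lemma₂ : ∀ r d i w → suc r * (2 * (d * i) + w * d) ≡ d * (suc r * (2 * i + w))
        lemma₂ = solve-∀
        -- The even part size 2r + 2 doubles e, and 2e = w d makes the exponent a multiple of d;
        -- this is how q enters only through Q.
        x≈ : x ≈ p (suc r * (2 * i + w))
        x≈ = q^≈p (suc r * (2 * i + w)) (≡.trans (lemma₁ r d i e)
          (≡.trans (≡.cong (λ z → suc r * (2 * (d * i) + z)) (2e≡wd parity)) (lemma₂ r d i w)))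

      closed-step : ∀ j r → Closed j (suc r) → Closed (suc j) r
      closed-step j r closed = go
        where
        lemma₀ : ∀ r b → (2 * r + 1) * (d * b) ≡ d * ((2 * r + 1) * b)
        lemma₀ r b = lemma d r b
          where
          lemma : ∀ d r b → (2 * r + 1) * (d * b) ≡ d * ((2 * r + 1) * b)
          lemma = solve-∀
        shift : ∀ b i → b + i ≡ k → q ^ ((2 * r + 1) * (d * b)) ⊗ Even j r (M ∸ d * b) ⊗ Y ⊗ W (suc j) r
                  ≈ p ((2 * r + 1) * b) ⊗ Eb b i r ⊗ V (suc j) r
        shift b i h = begin
          x ⊗ Even j r (M ∸ d * b) ⊗ Y ⊗ W (suc j) r      ≡⟨ ≡.cong (λ m → x ⊗ Even j r m ⊗ Y ⊗ W (suc j) r) M∸≡ ⟩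
          x ⊗ Even j r (d * i + e) ⊗ Y ⊗ W (suc j) r      ≈⟨ trans (*-congʳ (*-assoc _ _ _)) (*-assoc _ _ _) ⟩
          x ⊗ (Even j r (d * i + e) ⊗ Y ⊗ W (suc j) r)    ≈⟨ *-cong (q^≈p ((2 * r + 1) * b) (lemma₀ r b)) (Even-closed j r closed i b h) ⟩
          p ((2 * r + 1) * b) ⊗ (Eb b i r ⊗ V (suc j) r)  ≈⟨ sym (*-assoc _ _ _) ⟩
          p ((2 * r + 1) * b) ⊗ Eb b i r ⊗ V (suc j) r    ∎
          where
          x = q ^ ((2 * r + 1) * (d * b))
          lemma : ∀ d b i e → d * (b + i) + e ≡ d * b + (d * i + e)
          lemma = solve-∀
          M∸≡ : M ∸ d * b ≡ d * i + e
          M∸≡ = ≡.trans (≡.cong (_∸ d * b) (≡.trans (≡.cong (λ k → d * k + e) (≡.sym h)) (lemma d b i e))) (ℕ.m+n∸m≡n (d * b) _)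
        go : Closed (suc j) r
        go zero i h with ≡.refl ← h = begin
          Odd (suc j) r (d * 1) ⊗ Y ⊗ W (suc j) r
            ≈⟨ *-congʳ (*-congʳ (trans (Odd-step j r 0) (trans (+-congʳ (Odd-zero j r)) (+-identityˡ _)))) ⟩
          q ^ ((2 * r + 1) * (d * 0)) ⊗ Even j r (M ∸ d * 0) ⊗ Y ⊗ W (suc j) r
            ≈⟨ shift 0 k ≡.refl ⟩
          p ((2 * r + 1) * 0) ⊗ Eb 0 k r ⊗ V (suc j) r
            ≈⟨ *-congʳ (sym (Hb-zero r)) ⟩
          Hb 0 k r ⊗ V (suc j) r ∎
        go (suc β) i h = begin
          Odd (suc j) r (d * suc (suc β)) ⊗ Y ⊗ W (suc j) r
            ≈⟨ *-congʳ (*-congʳ (Odd-step j r (suc β))) ⟩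
          (o ⊕ x) ⊗ Y ⊗ W (suc j) r
            ≈⟨ trans (*-congʳ (distribʳ _ _ _)) (distribʳ _ _ _) ⟩
          o ⊗ Y ⊗ W (suc j) r ⊕ x ⊗ Y ⊗ W (suc j) r
            ≈⟨ +-cong (go β (suc i) (≡.trans (ℕ.+-suc β i) h)) (shift (suc β) i h) ⟩
          Hb β (suc i) r ⊗ V (suc j) r ⊕ p ((2 * r + 1) * suc β) ⊗ Eb (suc β) i r ⊗ V (suc j) r
            ≈⟨ sym (distribʳ _ _ _) ⟩
          (Hb β (suc i) r ⊕ p ((2 * r + 1) * suc β) ⊗ Eb (suc β) i r) ⊗ V (suc j) r
            ≈⟨ *-congʳ (sym (Hb-suc β i r h)) ⟩
          Hb (suc β) i r ⊗ V (suc j) r ∎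
          where
          o = Odd (suc j) r (d * suc β)
          x = q ^ ((2 * r + 1) * (d * suc β)) ⊗ Even j r (M ∸ d * suc β)

      -- With no part sizes left only the empty partition remains, and `Y` is exactly the value that
      -- H takes at r = ℓ.
      closed-base : Closed 0 ℓ
      closed-base β i h = begin
        Odd 0 ℓ (d * suc β) ⊗ Y ⊗ 1#   ≈⟨ *-congʳ (*-congʳ (Odd-base ℓ _)) ⟩
        1# ⊗ Y ⊗ 1#                    ≈⟨ *-congʳ (*-identityˡ Y) ⟩
        Y ⊗ 1#                         ≈⟨ *-congʳ (sym limit) ⟩
        Hb β i ℓ ⊗ 1#                  ∎
        where
        limit : Hb β i ℓ ≈ Y
        limit with c , eq ← positive k = trans (reflexive (≡.cong (λ ν → H ν (suc β) (β + (2 * i + w)) ℓ) eq)) (H-limit 1≤ℓ c β (β + (2 * i + w)) ℓ ℕ.≤-refl)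

      closed-all : ∀ j r → j + r ≡ ℓ → Closed j r
      closed-all zero    r ≡.refl = closed-base
      closed-all (suc j) r h      = closed-step j r (closed-all j (suc r) (≡.trans (ℕ.+-suc j r) h))

-- Jacobi's triple product, finite form and limit

module TripleProduct (R : CommutativeRing 0ℓ 0ℓ) (P : CommutativeRing.Carrier R) where

  open CommutativeRing R hiding (_+_; _*_; _-_; zero)
  open CommutativeRing R using () renaming (_+_ to infixl 6 _⊕_; _-_ to infixl 6 _⊝_; _*_ to infixl 7 _⊗_)
  open import Algebra.Properties.Semiring.Exp semiring using (_^_; ^-homo-*; ^-congʳ)
  open import Relation.Binary.Reasoning.Setoid setoid
  open IntegerSolver R
  open Sums R

  -- c n m is the Gaussian binomial coefficient [ 2 n , n + m ] in base P, defined by the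
  -- recurrence that multiplication by (1 - z Pⁿ)(1 - z′ Pⁿ) forces on the theta terms.
  c : ℕ → ℕ → Carrier
  c zero    zero    = 1#
  c zero    (suc m) = 0#
  c (suc n) zero    = (1# ⊕ P ^ suc (2 * n)) ⊗ c n 0 ⊕ P ^ suc n ⊗ c n 1 ⊕ P ^ suc n ⊗ c n 1
  c (suc n) (suc m) = (1# ⊕ P ^ suc (2 * n)) ⊗ c n (suc m) ⊕ P ^ (n ∸ m) ⊗ c n m ⊕ P ^ (suc (n + suc m)) ⊗ c n (suc (suc m))

  c-zero : ∀ n m → n < m → c n m ≈ 0#
  c-zero zero    (suc m) _         = refl
  c-zero (suc n) (suc m) (s≤s n<m) = begin
    x ⊗ c n (suc m) ⊕ y ⊗ c n m ⊕ z ⊗ c n (suc (suc m))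
      ≈⟨ +-cong (+-cong (*-congˡ (c-zero n _ (ℕ.m<n⇒m<1+n n<m))) (*-congˡ (c-zero n m n<m)))
           (*-congˡ (c-zero n _ (ℕ.m<n⇒m<1+n (ℕ.m<n⇒m<1+n n<m)))) ⟩
    x ⊗ 0# ⊕ y ⊗ 0# ⊕ z ⊗ 0#
      ≈⟨ solve 3 (λ x y z → x :* con 0ℤ :+ y :* con 0ℤ :+ z :* con 0ℤ := con 0ℤ) refl x y z ⟩
    0# ∎
    where
    x = 1# ⊕ P ^ suc (2 * n)
    y = P ^ (n ∸ m)
    z = P ^ (suc (n + suc m))

  F : ℕ → Carrier
  F = poch P P

  -- The quotient formula for the Gaussian binomial with denominators cleared; i stands for n - m.
  Gaussian : ℕ → Set
  Gaussian n = ∀ m i → m + i ≡ n → c n m ⊗ F (n + m) ⊗ F i ≈ F (2 * n)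

  -- The multiplier keeps `F i` with i = n - m, one factor more than the formula at m + 1 contains.
  -- This common multiplier lets the terms of the recurrence for `c` be added without division.
  gaussian₁ : ∀ n → Gaussian n → ∀ m i → m + i ≡ n → c n (suc m) ⊗ F (n + suc m) ⊗ F i ≈ F (2 * n) ⊗ (1# ⊝ P ^ i)
  gaussian₁ n g m zero h = begin
    c n (suc m) ⊗ F (n + suc m) ⊗ 1#  ≈⟨ *-congʳ (*-congʳ (c-zero n (suc m) (s≤s (ℕ.≤-reflexive (≡.trans (≡.sym h) (ℕ.+-identityʳ m)))))) ⟩
    0# ⊗ F (n + suc m) ⊗ 1#           ≈⟨ solve 2 (λ a b → con 0ℤ :* a :* con 1ℤ := b :* (con 1ℤ :- con 1ℤ)) refl (F (n + suc m)) (F (2 * n)) ⟩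
    F (2 * n) ⊗ (1# ⊝ 1#)             ∎
  gaussian₁ n g m (suc i) h = trans (sym (*-assoc _ _ _)) (*-congʳ (g (suc m) i (≡.trans (≡.sym (ℕ.+-suc m i)) h)))

  -- At i = 0 the truncated i ∸ 1 is harmless because the other factor vanishes.
  gaussian₂ : ∀ n → Gaussian n → ∀ m i → m + i ≡ n →
    c n (suc (suc m)) ⊗ F (n + suc (suc m)) ⊗ F i ≈ F (2 * n) ⊗ ((1# ⊝ P ^ (i ∸ 1)) ⊗ (1# ⊝ P ^ i))
  gaussian₂ n g m zero h = begin
    c n (suc (suc m)) ⊗ F (n + suc (suc m)) ⊗ 1#  ≈⟨ *-congʳ (*-congʳ (c-zero n (suc (suc m)) (ℕ.m<n⇒m<1+n (s≤s (ℕ.≤-reflexive (≡.trans (≡.sym h) (ℕ.+-identityʳ m))))))) ⟩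
    0# ⊗ F (n + suc (suc m)) ⊗ 1#                 ≈⟨ solve 2 (λ a b → con 0ℤ :* a :* con 1ℤ := b :* ((con 1ℤ :- con 1ℤ) :* (con 1ℤ :- con 1ℤ))) refl (F (n + suc (suc m))) (F (2 * n)) ⟩
    F (2 * n) ⊗ ((1# ⊝ 1#) ⊗ (1# ⊝ 1#))           ∎
  gaussian₂ n g m (suc i) h = begin
    c n (suc (suc m)) ⊗ F (n + suc (suc m)) ⊗ (F i ⊗ (1# ⊝ P ^ suc i))   ≈⟨ sym (*-assoc _ _ _) ⟩
    c n (suc (suc m)) ⊗ F (n + suc (suc m)) ⊗ F i ⊗ (1# ⊝ P ^ suc i)     ≈⟨ *-congʳ (gaussian₁ n g (suc m) i (≡.trans (≡.sym (ℕ.+-suc m i)) h)) ⟩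
    F (2 * n) ⊗ (1# ⊝ P ^ i) ⊗ (1# ⊝ P ^ suc i)                          ≈⟨ *-assoc _ _ _ ⟩
    F (2 * n) ⊗ ((1# ⊝ P ^ i) ⊗ (1# ⊝ P ^ suc i))                        ∎

  F-2suc : ∀ n → F (2 * suc n) ≈ F (2 * n) ⊗ (1# ⊝ P ^ suc (2 * n)) ⊗ (1# ⊝ P ⊗ P ^ suc (2 * n))
  F-2suc n = reflexive (≡.cong F (ℕ.*-suc 2 n))

  pred-absorbs : ∀ i → P ⊗ P ^ (i ∸ 1) ⊗ (1# ⊝ P ^ i) ≈ P ^ i ⊗ (1# ⊝ P ^ i)
  pred-absorbs zero    = solve 1 (λ p → p :* con 1ℤ :* (con 1ℤ :- con 1ℤ) := con 1ℤ :* (con 1ℤ :- con 1ℤ)) refl P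
  pred-absorbs (suc i) = refl

  -- After clearing denominators the recurrence for `c` becomes a polynomial identity: in P and Pⁿ
  -- at m = 0, and otherwise in P, u = Pⁱ and y = P^(n+m+1), linked to the recurrence by P^(2n+1) =
  -- u y.
  gaussian : ∀ n → Gaussian n
  gaussian zero    zero    zero    h = solve 0 (con 1ℤ :* con 1ℤ :* con 1ℤ := con 1ℤ) refl
  gaussian (suc n) zero    .(suc n) ≡.refl = begin
    (x ⊗ C₀ ⊕ a ⊗ C₁ ⊕ a ⊗ C₁) ⊗ F (suc n + 0) ⊗ (F n ⊗ (1# ⊝ a))
      ≡⟨ ≡.cong (λ k → (x ⊗ C₀ ⊕ a ⊗ C₁ ⊕ a ⊗ C₁) ⊗ F k ⊗ (F n ⊗ (1# ⊝ a))) (ℕ.+-identityʳ (suc n)) ⟩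
    (x ⊗ C₀ ⊕ a ⊗ C₁ ⊕ a ⊗ C₁) ⊗ (F n ⊗ (1# ⊝ a)) ⊗ (F n ⊗ (1# ⊝ a))
      ≈⟨ solve 5 (λ x y z f a → (x :* y :+ a :* z :+ a :* z) :* (f :* (con 1ℤ :- a)) :* (f :* (con 1ℤ :- a))
           := (y :* f :* f) :* (x :* (con 1ℤ :- a) :* (con 1ℤ :- a)) :+ (z :* (f :* (con 1ℤ :- a)) :* f) :* ((a :+ a) :* (con 1ℤ :- a)))
         refl x C₀ C₁ (F n) a ⟩
    (C₀ ⊗ F n ⊗ F n) ⊗ (x ⊗ (1# ⊝ a) ⊗ (1# ⊝ a)) ⊕ (C₁ ⊗ F (suc n) ⊗ F n) ⊗ ((a ⊕ a) ⊗ (1# ⊝ a))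
      ≈⟨ +-cong (*-cong (trans (*-congʳ (*-congˡ (reflexive (≡.cong F (≡.sym (ℕ.+-identityʳ n)))))) (gaussian n 0 n ≡.refl)) (*-congʳ (*-congʳ (+-congˡ π≈))))
           (*-congʳ (trans (*-congʳ (*-congˡ (reflexive (≡.cong F (≡.sym (ℕ.+-comm n 1)))))) (gaussian₁ n (gaussian n) 0 n ≡.refl))) ⟩
    F (2 * n) ⊗ ((1# ⊕ P ⊗ b ⊗ b) ⊗ (1# ⊝ a) ⊗ (1# ⊝ a)) ⊕ (F (2 * n) ⊗ (1# ⊝ b)) ⊗ ((a ⊕ a) ⊗ (1# ⊝ a))
      ≈⟨ solve 3 (λ f p b → f :* ((con 1ℤ :+ p :* b :* b) :* (con 1ℤ :- p :* b) :* (con 1ℤ :- p :* b)) :+ (f :* (con 1ℤ :- b)) :* ((p :* b :+ p :* b) :* (con 1ℤ :- p :* b))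
           := f :* (con 1ℤ :- p :* b :* b) :* (con 1ℤ :- p :* (p :* b :* b))) refl (F (2 * n)) P b ⟩
    F (2 * n) ⊗ (1# ⊝ P ⊗ b ⊗ b) ⊗ (1# ⊝ P ⊗ (P ⊗ b ⊗ b))
      ≈⟨ *-cong (*-congˡ (1⊝-cong (sym π≈))) (1⊝-cong (*-congˡ (sym π≈))) ⟩
    F (2 * n) ⊗ (1# ⊝ P ^ suc (2 * n)) ⊗ (1# ⊝ P ⊗ P ^ suc (2 * n))
      ≈⟨ sym (F-2suc n) ⟩
    F (2 * suc n) ∎
    where
    x = 1# ⊕ P ^ suc (2 * n)
    C₀ = c n 0
    C₁ = c n 1
    a = P ^ suc n
    b = P ^ n
    π≈ : P ^ suc (2 * n) ≈ P ⊗ b ⊗ b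
    π≈ = trans (^-homo-* P (suc n) (n + 0)) (*-congˡ (^-congʳ P (ℕ.+-identityʳ n)))
  gaussian (suc n) (suc m) i h = begin
    (x ⊗ C₁ ⊕ P ^ (n ∸ m) ⊗ C₀ ⊕ P ^ suc (n + suc m) ⊗ C₂) ⊗ F (suc n + suc m) ⊗ F i
      ≈⟨ *-congʳ (*-cong (+-cong (+-congˡ (*-congʳ (^-congʳ P n∸m≡i))) (*-congʳ y₂≈)) F≈) ⟩
    (x ⊗ C₁ ⊕ u ⊗ C₀ ⊕ P ⊗ y ⊗ C₂) ⊗ (F (n + m) ⊗ (1# ⊝ y) ⊗ (1# ⊝ P ⊗ y)) ⊗ F i
      ≈⟨ solve 9 (λ x c₁ u c₀ p y c₂ f g →
           (x :* c₁ :+ u :* c₀ :+ p :* y :* c₂) :* (f :* (con 1ℤ :- y) :* (con 1ℤ :- p :* y)) :* g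
           := (c₁ :* (f :* (con 1ℤ :- y)) :* g) :* (x :* (con 1ℤ :- p :* y)) :+ (c₀ :* f :* g) :* (u :* (con 1ℤ :- y) :* (con 1ℤ :- p :* y))
              :+ (c₂ :* (f :* (con 1ℤ :- y) :* (con 1ℤ :- p :* y)) :* g) :* (p :* y))
         refl x C₁ u C₀ P y C₂ (F (n + m)) (F i) ⟩
    (C₁ ⊗ (F (n + m) ⊗ (1# ⊝ y)) ⊗ F i) ⊗ (x ⊗ (1# ⊝ P ⊗ y)) ⊕ (C₀ ⊗ F (n + m) ⊗ F i) ⊗ (u ⊗ (1# ⊝ y) ⊗ (1# ⊝ P ⊗ y))
      ⊕ (C₂ ⊗ (F (n + m) ⊗ (1# ⊝ y) ⊗ (1# ⊝ P ⊗ y)) ⊗ F i) ⊗ (P ⊗ y)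
      ≈⟨ +-cong (+-cong (*-cong g₁ (*-congʳ (+-congˡ π≈))) (*-congʳ (gaussian n m i h′))) (*-congʳ g₂) ⟩
    (f ⊗ (1# ⊝ u)) ⊗ ((1# ⊕ u ⊗ y) ⊗ (1# ⊝ P ⊗ y)) ⊕ f ⊗ (u ⊗ (1# ⊝ y) ⊗ (1# ⊝ P ⊗ y)) ⊕ f ⊗ ((1# ⊝ u⁻) ⊗ (1# ⊝ u)) ⊗ (P ⊗ y)
      ≈⟨ solve 5 (λ f u y p v →
           (f :* (con 1ℤ :- u)) :* ((con 1ℤ :+ u :* y) :* (con 1ℤ :- p :* y)) :+ f :* (u :* (con 1ℤ :- y) :* (con 1ℤ :- p :* y)) :+ f :* ((con 1ℤ :- v) :* (con 1ℤ :- u)) :* (p :* y)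
           := (f :* (con 1ℤ :- u)) :* ((con 1ℤ :+ u :* y) :* (con 1ℤ :- p :* y)) :+ f :* (u :* (con 1ℤ :- y) :* (con 1ℤ :- p :* y))
              :+ f :* y :* (p :* (con 1ℤ :- u) :- p :* v :* (con 1ℤ :- u))) refl f u y P u⁻ ⟩
    (f ⊗ (1# ⊝ u)) ⊗ ((1# ⊕ u ⊗ y) ⊗ (1# ⊝ P ⊗ y)) ⊕ f ⊗ (u ⊗ (1# ⊝ y) ⊗ (1# ⊝ P ⊗ y)) ⊕ f ⊗ y ⊗ (P ⊗ (1# ⊝ u) ⊝ P ⊗ u⁻ ⊗ (1# ⊝ u))
      ≈⟨ +-congˡ (*-congˡ (+-congˡ (-‿cong (pred-absorbs i)))) ⟩
    (f ⊗ (1# ⊝ u)) ⊗ ((1# ⊕ u ⊗ y) ⊗ (1# ⊝ P ⊗ y)) ⊕ f ⊗ (u ⊗ (1# ⊝ y) ⊗ (1# ⊝ P ⊗ y)) ⊕ f ⊗ y ⊗ (P ⊗ (1# ⊝ u) ⊝ u ⊗ (1# ⊝ u))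
      ≈⟨ solve 4 (λ f u y p →
           (f :* (con 1ℤ :- u)) :* ((con 1ℤ :+ u :* y) :* (con 1ℤ :- p :* y)) :+ f :* (u :* (con 1ℤ :- y) :* (con 1ℤ :- p :* y))
              :+ f :* y :* (p :* (con 1ℤ :- u) :- u :* (con 1ℤ :- u))
           := f :* (con 1ℤ :- u :* y) :* (con 1ℤ :- p :* (u :* y))) refl f u y P ⟩
    f ⊗ (1# ⊝ u ⊗ y) ⊗ (1# ⊝ P ⊗ (u ⊗ y))
      ≈⟨ *-cong (*-congˡ (1⊝-cong (sym π≈))) (1⊝-cong (*-congˡ (sym π≈))) ⟩
    f ⊗ (1# ⊝ P ^ suc (2 * n)) ⊗ (1# ⊝ P ⊗ P ^ suc (2 * n))
      ≈⟨ sym (F-2suc n) ⟩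
    F (2 * suc n) ∎
    where
    h′ : m + i ≡ n
    h′ = ℕ.suc-injective h
    f = F (2 * n)
    x = 1# ⊕ P ^ suc (2 * n)
    C₀ = c n m
    C₁ = c n (suc m)
    C₂ = c n (suc (suc m))
    u = P ^ i
    u⁻ = P ^ (i ∸ 1)
    y = P ^ suc (n + m)
    n∸m≡i : n ∸ m ≡ i
    n∸m≡i = ≡.trans (≡.cong (_∸ m) (≡.sym h′)) (ℕ.m+n∸m≡n m i)
    y₂≈ : P ^ suc (n + suc m) ≈ P ⊗ y
    y₂≈ = ^-congʳ P (≡.cong suc (ℕ.+-suc n m))
    F≈ : F (suc n + suc m) ≈ F (n + m) ⊗ (1# ⊝ y) ⊗ (1# ⊝ P ⊗ y)
    F≈ = reflexive (≡.cong (λ k → F (suc k)) (ℕ.+-suc n m))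
    π≈ : P ^ suc (2 * n) ≈ u ⊗ y
    π≈ = trans (^-congʳ P (≡.trans (≡.cong (λ k → suc (k + (n + 0))) (≡.sym h′)) (e m i n))) (^-homo-* P i (suc (n + m)))
      where
      e : ∀ m i n → suc (m + i + (n + 0)) ≡ i + suc (n + m)
      e = solve-∀
    g₁ : C₁ ⊗ (F (n + m) ⊗ (1# ⊝ y)) ⊗ F i ≈ f ⊗ (1# ⊝ u)
    g₁ = trans (*-congʳ (*-congˡ (reflexive (≡.cong F (≡.sym (ℕ.+-suc n m)))))) (gaussian₁ n (gaussian n) m i h′)
    g₂ : C₂ ⊗ (F (n + m) ⊗ (1# ⊝ y) ⊗ (1# ⊝ P ⊗ y)) ⊗ F i ≈ f ⊗ ((1# ⊝ u⁻) ⊗ (1# ⊝ u))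
    g₂ = trans (*-congʳ (*-congˡ (trans (sym F≈) (reflexive (≡.cong F (≡.sym (ℕ.+-suc n (suc m)))))))) (gaussian₂ n (gaussian n) m i h′)

  module Theta (z z′ : Carrier) (zz′≈P : z ⊗ z′ ≈ P) where

    -- The terms of index m and -m of the bilateral theta series taken together, with `z′` in the
    -- role of P/z because z is not invertible. Thus `τ 0` is 2, as the three-term relation at m = 0
    -- requires, whereas `θ` counts index 0 once.
    τ : ℕ → Carrier
    τ m = sgn m ⊗ (z ^ m ⊕ z′ ^ m) ⊗ P ^ tri m

    θ : ℕ → Carrier
    θ zero    = 1#
    θ (suc m) = τ (suc m)

    -- Comes from (z + z′)(zᵐ⁺¹ + z′ᵐ⁺¹) = (zᵐ⁺² + z′ᵐ⁺²) + z z′ (zᵐ + z′ᵐ). The factor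
    -- `c n (suc m)` is included because it vanishes whenever `n ∸ suc m` would truncate.
    τ-step : ∀ n m → c n (suc m) ⊗ ((z ⊕ z′) ⊗ P ^ n) ⊗ τ (suc m)
      ≈ - (P ^ (n ∸ suc m) ⊗ c n (suc m) ⊗ τ (suc (suc m)) ⊕ P ^ suc (n + m) ⊗ c n (suc m) ⊗ τ m)
    τ-step n m with suc m ℕ.≤? n
    ... | no m≥n = begin
      C ⊗ ((z ⊕ z′) ⊗ P ^ n) ⊗ τ (suc m)
        ≈⟨ *-congʳ (*-congʳ C≈0) ⟩
      0# ⊗ ((z ⊕ z′) ⊗ P ^ n) ⊗ τ (suc m)
        ≈⟨ solve 6 (λ a b u v x y → con 0ℤ :* a :* b := :- (u :* con 0ℤ :* x :+ v :* con 0ℤ :* y)) refl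
             ((z ⊕ z′) ⊗ P ^ n) (τ (suc m)) (P ^ (n ∸ suc m)) (P ^ suc (n + m)) (τ (suc (suc m))) (τ m) ⟩
      - (P ^ (n ∸ suc m) ⊗ 0# ⊗ τ (suc (suc m)) ⊕ P ^ suc (n + m) ⊗ 0# ⊗ τ m)
        ≈⟨ -‿cong (+-cong (*-congʳ (*-congˡ (sym C≈0))) (*-congʳ (*-congˡ (sym C≈0)))) ⟩
      - (P ^ (n ∸ suc m) ⊗ C ⊗ τ (suc (suc m)) ⊕ P ^ suc (n + m) ⊗ C ⊗ τ m) ∎
      where
      C = c n (suc m)
      C≈0 = c-zero n (suc m) (ℕ.≰⇒> m≥n)
    ... | yes m<n = begin
      C ⊗ ((z ⊕ z′) ⊗ P ^ n) ⊗ ((- 1# ⊗ s) ⊗ (z ⊗ Z ⊕ z′ ⊗ Z′) ⊗ P ^ (tri m + m))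
        ≈⟨ *-cong (*-congˡ (*-congˡ Pⁿ≈)) (*-congˡ (^-homo-* P (tri m) m)) ⟩
      C ⊗ ((z ⊕ z′) ⊗ (x ⊗ (P ⊗ y))) ⊗ ((- 1# ⊗ s) ⊗ (z ⊗ Z ⊕ z′ ⊗ Z′) ⊗ (T ⊗ y))
        ≈⟨ solve 10 (λ C z z′ x P y s Z Z′ T →
             C :* ((z :+ z′) :* (x :* (P :* y))) :* (((:- con 1ℤ) :* s) :* (z :* Z :+ z′ :* Z′) :* (T :* y))
             := :- (x :* C :* (((:- con 1ℤ) :* ((:- con 1ℤ) :* s)) :* (z :* (z :* Z) :+ z′ :* (z′ :* Z′)) :* (T :* y :* (P :* y)))
                 :+ (x :* (P :* y)) :* (z :* z′) :* y :* C :* (s :* (Z :+ Z′) :* T)))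
           refl C z z′ x P y s Z Z′ T ⟩
      - (x ⊗ C ⊗ ((- 1# ⊗ (- 1# ⊗ s)) ⊗ (z ⊗ (z ⊗ Z) ⊕ z′ ⊗ (z′ ⊗ Z′)) ⊗ (T ⊗ y ⊗ (P ⊗ y))) ⊕ (x ⊗ (P ⊗ y)) ⊗ (z ⊗ z′) ⊗ y ⊗ C ⊗ τ m)
        ≈⟨ -‿cong (+-cong (*-congˡ (*-congˡ (trans (*-congʳ (sym (^-homo-* P (tri m) m))) (sym (^-homo-* P (tri m + m) (suc m))))))
             (*-congʳ (*-congʳ y≈))) ⟩
      - (x ⊗ C ⊗ τ (suc (suc m)) ⊕ P ^ suc (n + m) ⊗ C ⊗ τ m) ∎
      where
      C = c n (suc m)
      s = sgn m
      Z = z ^ m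
      Z′ = z′ ^ m
      T = P ^ tri m
      x = P ^ (n ∸ suc m)
      y = P ^ m
      Pⁿ≈ : P ^ n ≈ x ⊗ (P ⊗ y)
      Pⁿ≈ = trans (^-congʳ P (≡.sym (ℕ.m∸n+n≡m m<n))) (^-homo-* P (n ∸ suc m) (suc m))
      y≈ : (x ⊗ (P ⊗ y)) ⊗ (z ⊗ z′) ⊗ y ≈ P ^ suc (n + m)
      y≈ = begin
        (x ⊗ (P ⊗ y)) ⊗ (z ⊗ z′) ⊗ y   ≈⟨ *-congʳ (*-cong (sym Pⁿ≈) zz′≈P) ⟩
        P ^ n ⊗ P ⊗ y                  ≈⟨ trans (*-congʳ (*-comm _ _)) (*-assoc _ _ _) ⟩
        P ⊗ (P ^ n ⊗ y)                ≈⟨ *-congˡ (sym (^-homo-* P n m)) ⟩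
        P ^ suc (n + m)                ∎

    -- Induction on n: the two new factors multiply to 1 + P^(2n+1) - (z + z′) Pⁿ, and z + z′ moves
    -- a theta term to both neighbouring indices, as the recurrence for `c` prescribes. Any K beyond
    -- n will do because `c n` vanishes there.
    finite : ∀ n K → n < K → poch z P n ⊗ poch z′ P n ≈ Σ (λ m → c n m ⊗ θ m) K
    finite zero    (suc K) _ = sym (begin
      Σ (λ m → c 0 m ⊗ θ m) (suc K)                   ≈⟨ Σ-suc _ K ⟩
      1# ⊗ 1# ⊕ Σ (λ m → 0# ⊗ θ (suc m)) K            ≈⟨ +-congˡ (Σ-zero _ K λ m _ → zeroˡ _) ⟩
      1# ⊗ 1# ⊕ 0#                                    ≈⟨ +-identityʳ _ ⟩
      1# ⊗ 1#                                         ∎)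
    finite (suc n) (suc K) (s≤s n<K) = begin
      poch z P n ⊗ (1# ⊝ z ⊗ b) ⊗ (poch z′ P n ⊗ (1# ⊝ z′ ⊗ b))
        ≈⟨ solve 5 (λ u v z z′ b → u :* (con 1ℤ :- z :* b) :* (v :* (con 1ℤ :- z′ :* b))
             := (con 1ℤ :+ z :* z′ :* (b :* b) :- (z :+ z′) :* b) :* (u :* v)) refl (poch z P n) (poch z′ P n) z z′ b ⟩
      (1# ⊕ z ⊗ z′ ⊗ (b ⊗ b) ⊝ ζ) ⊗ (poch z P n ⊗ poch z′ P n)
        ≈⟨ *-cong (+-congʳ (+-congˡ π≈)) (finite n (suc K) (ℕ.m<n⇒m<1+n n<K)) ⟩
      A ⊗ Σ (λ m → c n m ⊗ θ m) (suc K)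
        ≈⟨ *-congˡ (Σ-suc _ K) ⟩
      A ⊗ (c n 0 ⊗ 1# ⊕ Σ (λ m → c n (suc m) ⊗ τ (suc m)) K)
        ≈⟨ trans (distribˡ _ _ _) (+-congˡ (sym (Σ-*ˡ A _ K))) ⟩
      A ⊗ (c n 0 ⊗ 1#) ⊕ Σ G K
        ≈⟨ rearrange ⟩
      c (suc n) 0 ⊗ 1# ⊕ (a 0 ⊕ Σ G K)
        ≈⟨ +-congˡ (sym (Σ-shift _ G a K shift)) ⟩
      c (suc n) 0 ⊗ 1# ⊕ (Σ (λ m → c (suc n) (suc m) ⊗ τ (suc m)) K ⊕ a K)
        ≈⟨ +-congˡ (trans (+-congˡ aK≈0) (+-identityʳ _)) ⟩
      c (suc n) 0 ⊗ 1# ⊕ Σ (λ m → c (suc n) (suc m) ⊗ τ (suc m)) K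
        ≈⟨ sym (Σ-suc _ K) ⟩
      Σ (λ m → c (suc n) m ⊗ θ m) (suc K) ∎
      where
      b = P ^ n
      ζ = (z ⊕ z′) ⊗ b
      π = P ^ suc (2 * n)
      A = 1# ⊕ π ⊝ ζ
      G = λ m → A ⊗ (c n (suc m) ⊗ τ (suc m))
      a : ℕ → Carrier
      -- Net flux between indices m and m + 1: what moves up from m minus what moves down from m +
      -- 1.
      a m = P ^ (n ∸ m) ⊗ c n m ⊗ τ (suc m) ⊝ P ^ suc (n + m) ⊗ c n (suc m) ⊗ τ m
      π≈ : z ⊗ z′ ⊗ (b ⊗ b) ≈ π
      π≈ = trans (*-cong zz′≈P (sym (^-homo-* P n n))) (^-congʳ P (≡.cong suc (≡.cong (λ x → n + x) (≡.sym (ℕ.+-identityʳ n)))))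
      aK≈0 : a K ≈ 0#
      aK≈0 = trans (+-cong (*-congʳ (*-congˡ (c-zero n K n<K))) (-‿cong (*-congʳ (*-congˡ (c-zero n (suc K) (ℕ.m<n⇒m<1+n n<K))))))
        (solve 4 (λ x y u v → x :* con 0ℤ :* y :- u :* con 0ℤ :* v := con 0ℤ) refl _ _ _ _)
      shift : ∀ m → c (suc n) (suc m) ⊗ τ (suc m) ⊕ a (suc m) ≈ a m ⊕ G m
      shift m = begin
        ((1# ⊕ π) ⊗ C ⊕ x ⊗ C₀ ⊕ y ⊗ C₂) ⊗ t₁ ⊕ (x₁ ⊗ C ⊗ t₂ ⊝ y ⊗ C₂ ⊗ t₁)
          ≈⟨ solve 11 (λ π C x C₀ y C₂ t₁ x₁ t₂ y₀ t₀ →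
               ((con 1ℤ :+ π) :* C :+ x :* C₀ :+ y :* C₂) :* t₁ :+ (x₁ :* C :* t₂ :- y :* C₂ :* t₁)
               := (x :* C₀ :* t₁ :- y₀ :* C :* t₀) :+ ((con 1ℤ :+ π) :* (C :* t₁) :- (:- (x₁ :* C :* t₂ :+ y₀ :* C :* t₀))))
             refl π C x C₀ y C₂ t₁ x₁ t₂ y₀ t₀ ⟩
        a m ⊕ ((1# ⊕ π) ⊗ (C ⊗ t₁) ⊝ - (x₁ ⊗ C ⊗ t₂ ⊕ y₀ ⊗ C ⊗ t₀))
          ≈⟨ +-congˡ (+-congˡ (-‿cong (sym (τ-step n m)))) ⟩
        a m ⊕ ((1# ⊕ π) ⊗ (C ⊗ t₁) ⊝ C ⊗ ζ ⊗ t₁)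
          ≈⟨ +-congˡ (solve 4 (λ π C t₁ ζ → (con 1ℤ :+ π) :* (C :* t₁) :- C :* ζ :* t₁ := (con 1ℤ :+ π :- ζ) :* (C :* t₁)) refl π C t₁ ζ) ⟩
        a m ⊕ G m ∎
        where
        C₀ = c n m
        C = c n (suc m)
        C₂ = c n (suc (suc m))
        x = P ^ (n ∸ m)
        x₁ = P ^ (n ∸ suc m)
        y₀ = P ^ suc (n + m)
        y = P ^ suc (n + suc m)
        t₀ = τ m
        t₁ = τ (suc m)
        t₂ = τ (suc (suc m))
      -- Index 0 receives a contribution from each of the indices 1 and -1, hence the doubled
      -- summand in `c (suc n) 0`; it cancels against `τ 0` = 2 inside `a 0`.
      rearrange : A ⊗ (c n 0 ⊗ 1#) ⊕ Σ G K ≈ c (suc n) 0 ⊗ 1# ⊕ (a 0 ⊕ Σ G K)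
      rearrange = trans
        (solve 7 (λ π z z′ b C₀ q S → (con 1ℤ :+ π :- (z :+ z′) :* b) :* (C₀ :* con 1ℤ) :+ S
          := ((con 1ℤ :+ π) :* C₀ :+ q :+ q) :* con 1ℤ
             :+ (b :* C₀ :* (((:- con 1ℤ) :* con 1ℤ) :* (z :* con 1ℤ :+ z′ :* con 1ℤ) :* con 1ℤ) :- q :* (con 1ℤ :* (con 1ℤ :+ con 1ℤ) :* con 1ℤ) :+ S))
          refl π z z′ b (c n 0) (P ^ suc n ⊗ c n 1) (Σ G K))
        (+-congˡ (+-congʳ (+-congˡ (-‿cong (*-congʳ (*-congʳ (^-congʳ P (≡.cong suc (≡.sym (ℕ.+-identityʳ n))))))))))

    module Limit (ℓ : ℕ) (nil : P ^ ℓ ≈ 0#) (nilz : z ^ ℓ ≈ 0#) (nilz′ : z′ ^ ℓ ≈ 0#) (Y⁻¹ : Carrier) (inv : F ℓ ⊗ Y⁻¹ ≈ 1#) where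

      F-stable : ∀ n → F (n + ℓ) ≈ F ℓ
      F-stable zero    = refl
      F-stable (suc n) = begin
        F (n + ℓ) ⊗ (1# ⊝ P ^ suc (n + ℓ))  ≈⟨ *-cong (F-stable n) (1⊝-cong (^-zero P ℓ _ nil (ℕ.m≤n+m ℓ (suc n)))) ⟩
        F ℓ ⊗ (1# ⊝ 0#)                     ≈⟨ solve 1 (λ x → x :* (con 1ℤ :- con 0ℤ) := x) refl (F ℓ) ⟩
        F ℓ                                 ∎

      F-stable′ : ∀ n → ℓ ≤ n → F n ≈ F ℓ
      F-stable′ n ℓ≤n = trans (reflexive (≡.cong F (≡.sym (ℕ.m∸n+n≡m ℓ≤n)))) (F-stable (n ∸ ℓ))

      τ-zero : ∀ m → ℓ ≤ m → τ m ≈ 0#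
      τ-zero m ℓ≤m = trans (*-congʳ (*-congˡ (+-cong (^-zero z ℓ m nilz ℓ≤m) (^-zero z′ ℓ m nilz′ ℓ≤m))))
        (solve 2 (λ s t → s :* (con 0ℤ :+ con 0ℤ) :* t := con 0ℤ) refl (sgn m) (P ^ tri m))

      -- Twice ℓ, so that n₀ - m ≥ ℓ for all m ≤ ℓ, the range where `θ` may be nonzero.
      n₀ : ℕ
      n₀ = ℓ + ℓ

      -- All symbols in the quotient formula have stabilised at `F ℓ`, so it reads C Y Y = Y; the
      -- inverse cancels one Y.
      c-limit : ∀ m → m ≤ ℓ → c n₀ m ⊗ F ℓ ≈ 1#
      c-limit m m≤ℓ = begin
        C ⊗ Y                            ≈⟨ sym (*-identityʳ _) ⟩
        C ⊗ Y ⊗ 1#                       ≈⟨ *-congˡ (sym inv) ⟩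
        C ⊗ Y ⊗ (Y ⊗ Y⁻¹)                ≈⟨ sym (*-assoc _ _ _) ⟩
        C ⊗ Y ⊗ Y ⊗ Y⁻¹                  ≈⟨ *-congʳ (*-cong (*-congˡ (sym (F-stable′ (n₀ + m) (ℕ.≤-trans (ℕ.m≤m+n ℓ ℓ) (ℕ.m≤m+n n₀ m)))))
                                              (sym (F-stable′ (n₀ ∸ m) (≡.subst (ℓ ≤_) (≡.sym (ℕ.+-∸-assoc ℓ m≤ℓ)) (ℕ.m≤m+n ℓ _))))) ⟩
        C ⊗ F (n₀ + m) ⊗ F (n₀ ∸ m) ⊗ Y⁻¹  ≈⟨ *-congʳ (gaussian n₀ m (n₀ ∸ m) (ℕ.m+[n∸m]≡n (ℕ.≤-trans m≤ℓ (ℕ.m≤m+n ℓ ℓ)))) ⟩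
        F (2 * n₀) ⊗ Y⁻¹                 ≈⟨ *-congʳ (F-stable′ (2 * n₀) (ℕ.≤-trans (ℕ.m≤m+n ℓ ℓ) (ℕ.m≤m+n n₀ _))) ⟩
        Y ⊗ Y⁻¹                          ≈⟨ inv ⟩
        1#                               ∎
        where
        C = c n₀ m
        Y = F ℓ

      triple-product : poch z P n₀ ⊗ poch z′ P n₀ ⊗ F ℓ ≈ Σ θ (suc ℓ)
      triple-product = begin
        poch z P n₀ ⊗ poch z′ P n₀ ⊗ F ℓ              ≈⟨ *-congʳ (finite n₀ (suc n₀) ℕ.≤-refl) ⟩
        Σ (λ m → c n₀ m ⊗ θ m) (suc n₀) ⊗ F ℓ         ≈⟨ *-comm _ _ ⟩
        F ℓ ⊗ Σ (λ m → c n₀ m ⊗ θ m) (suc n₀)         ≈⟨ sym (Σ-*ˡ _ _ (suc n₀)) ⟩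
        Σ (λ m → F ℓ ⊗ (c n₀ m ⊗ θ m)) (suc n₀)       ≈⟨ Σ-suc _ n₀ ⟩
        f 0 ⊕ Σ (λ m → f (suc m)) (ℓ + ℓ)             ≈⟨ +-cong (f≈ 0 z≤n) (truncate ℓ) ⟩
        θ 0 ⊕ Σ (λ m → θ (suc m)) ℓ                   ≈⟨ sym (Σ-suc θ ℓ) ⟩
        Σ θ (suc ℓ)                                   ∎
        where
        f : ℕ → Carrier
        f m = F ℓ ⊗ (c n₀ m ⊗ θ m)
        f≈ : ∀ m → m ≤ ℓ → f m ≈ θ m
        f≈ m m≤ℓ = begin
          F ℓ ⊗ (c n₀ m ⊗ θ m)    ≈⟨ solve 3 (λ a b c → a :* (b :* c) := (b :* a) :* c) refl (F ℓ) (c n₀ m) (θ m) ⟩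
          (c n₀ m ⊗ F ℓ) ⊗ θ m    ≈⟨ *-congʳ (c-limit m m≤ℓ) ⟩
          1# ⊗ θ m                ≈⟨ *-identityˡ _ ⟩
          θ m                     ∎
        truncate : ∀ j → Σ (λ m → f (suc m)) (j + ℓ) ≈ Σ (λ m → θ (suc m)) ℓ
        truncate zero    = Σ-cong ℓ λ m m<ℓ → f≈ (suc m) m<ℓ
        truncate (suc j) = trans (+-cong (truncate j)
          (trans (*-congˡ (*-congˡ (τ-zero (suc (j + ℓ)) (ℕ.m≤n+m ℓ (suc j))))) (trans (*-congˡ (zeroʳ _)) (zeroʳ _)))) (+-identityʳ _)

-- From the solved recurrence to the product side

module Assembly (R : CommutativeRing 0ℓ 0ℓ) where

  open CommutativeRing R hiding (_+_; _*_; _-_; zero)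
  open CommutativeRing R using () renaming (_+_ to infixl 6 _⊕_; _-_ to infixl 6 _⊝_; _*_ to infixl 7 _⊗_)
  open import Algebra.Properties.Semiring.Exp semiring using (_^_; ^-homo-*; ^-congʳ; ^-assocʳ)
  open import Relation.Binary.Reasoning.Setoid setoid
  open IntegerSolver R
  open Sums R

  ^-∣-zero : ∀ x ℓ m → x ^ ℓ ≈ 0# → (x ^ suc m) ^ ℓ ≈ 0#
  ^-∣-zero x ℓ m h = trans (^-assocʳ x (suc m) ℓ) (^-zero x ℓ _ h (ℕ.m≤m+n ℓ (m * ℓ)))

  -- At r = 0 the Pochhammer symbol is 1 and the n-th term becomes (-1)ⁿ (z′ⁿ P^(tri n) - zⁿ⁺¹
  -- P^(tri (n+1))). Its second half has the sign and shape of a theta term of index n + 1, so the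
  -- two series differ only in grouping.
  H-θ : ∀ Q ν b b̄ ℓ (zz′≈P : Q ^ suc b ⊗ Q ^ suc b̄ ≈ Q ^ suc ν) → 1 ≤ ℓ → Q ^ ℓ ≈ 0# →
    Σ (QDifference.hterm R Q ν (suc b) (suc b̄) 0) ℓ ≈ Σ (TripleProduct.Theta.θ R (Q ^ suc ν) (Q ^ suc b) (Q ^ suc b̄) zz′≈P) (suc ℓ)
  H-θ Q ν b b̄ ℓ zz′≈P 1≤ℓ nil = trans (Σ-telescope (hterm ν (suc b) (suc b̄) 0) θ a ℓ shift refl (aℓ≈0 ℓ nilz))
    (sym (trans (+-congˡ (θℓ≈0 ℓ 1≤ℓ nilz nilz′)) (+-identityʳ _)))
    where
    open QDifference R Q
    open TripleProduct.Theta R (Q ^ suc ν) (Q ^ suc b) (Q ^ suc b̄) zz′≈P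
    P = Q ^ suc ν
    z = Q ^ suc b
    z′ = Q ^ suc b̄
    nilz = ^-∣-zero Q ℓ b nil
    nilz′ = ^-∣-zero Q ℓ b̄ nil
    v : ℕ → Carrier
    v n = sgn n ⊗ z ^ n ⊗ P ^ tri n
    a : ℕ → Carrier
    -- Not `- v 0`: the theta series has a single term at index 0, already given by the first power
    -- of the H term.
    a zero    = 0#
    a (suc n) = - v (suc n)
    aℓ≈0 : ∀ m → z ^ m ≈ 0# → a m ≈ 0#
    aℓ≈0 zero    _ = refl
    aℓ≈0 (suc m) h = trans (-‿cong (*-congʳ (*-congˡ h)))
      (solve 2 (λ s t → :- (s :* con 0ℤ :* t) := con 0ℤ) refl (sgn (suc m)) (P ^ tri (suc m)))
    θℓ≈0 : ∀ m → 1 ≤ m → z ^ m ≈ 0# → z′ ^ m ≈ 0# → θ m ≈ 0#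
    θℓ≈0 (suc m) _ h h′ = trans (*-congʳ (*-congˡ (+-cong h h′)))
      (solve 2 (λ s t → s :* (con 0ℤ :+ con 0ℤ) :* t := con 0ℤ) refl (sgn (suc m)) (P ^ tri (suc m)))
    first≈ : ∀ n → p (suc ν * tri n + ν * 0 * n + suc b̄ * n) ≈ z′ ^ n ⊗ P ^ tri n
    first≈ n = trans (p-split (suc b̄ * n) (suc ν * tri n) (e ν b̄ n (tri n)))
      (*-cong (sym (^-assocʳ Q (suc b̄) n)) (sym (^-assocʳ Q (suc ν) (tri n))))
      where
      e : ∀ ν b̄ n t → suc ν * t + ν * 0 * n + suc b̄ * n ≡ suc b̄ * n + suc ν * t
      e = solve-∀
    second≈ : ∀ n → p (suc ν * tri n + ν * 0 * n + (suc ν + suc b) * n + suc b * (2 * 0 + 1)) ≈ z ^ suc n ⊗ P ^ tri (suc n)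
    second≈ n = trans (p-split (suc b * suc n) (suc ν * tri (suc n)) (e ν b n (tri n)))
      (*-cong (sym (^-assocʳ Q (suc b) (suc n))) (sym (^-assocʳ Q (suc ν) (tri (suc n)))))
      where
      e : ∀ ν b n t → suc ν * t + ν * 0 * n + (suc ν + suc b) * n + suc b * (2 * 0 + 1) ≡ suc b * suc n + suc ν * (t + n)
      e = solve-∀
    expand : ∀ n → hterm ν (suc b) (suc b̄) 0 n ≈ sgn n ⊗ 1# ⊗ (z′ ^ n ⊗ P ^ tri n ⊝ z ^ suc n ⊗ P ^ tri (suc n))
    expand n = *-congˡ (+-cong (first≈ n) (-‿cong (second≈ n)))
    shift : ∀ n → hterm ν (suc b) (suc b̄) 0 n ⊕ a (suc n) ≈ a n ⊕ θ n
    shift zero = trans (+-congʳ (expand 0))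
      (solve 1 (λ z → con 1ℤ :* con 1ℤ :* (con 1ℤ :* con 1ℤ :- z :* con 1ℤ :* con 1ℤ) :+ (:- (((:- con 1ℤ) :* con 1ℤ) :* (z :* con 1ℤ) :* con 1ℤ))
        := con 0ℤ :+ con 1ℤ) refl z)
    shift (suc n) = trans (+-congʳ (expand (suc n)))
      (solve 6 (λ s z′ⁿ T z zⁿ T′ →
        s :* con 1ℤ :* (z′ⁿ :* T :- (z :* zⁿ) :* T′) :+ (:- (((:- con 1ℤ) :* s) :* (z :* zⁿ) :* T′))
        := (:- (s :* zⁿ :* T)) :+ s :* (zⁿ :+ z′ⁿ) :* T)
        refl (sgn (suc n)) (z′ ^ suc n) (P ^ tri (suc n)) z (z ^ suc n) (P ^ tri (suc (suc n))))

  poch-double : ∀ Q n → poch Q Q (2 * n) ≈ poch Q (Q ^ 2) n ⊗ poch (Q ^ 2) (Q ^ 2) n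
  poch-double Q zero    = sym (*-identityˡ 1#)
  poch-double Q (suc n) = begin
    poch Q Q (2 * suc n)
      ≡⟨ ≡.cong (poch Q Q) (ℕ.*-suc 2 n) ⟩
    poch Q Q (2 * n) ⊗ (1# ⊝ Q ⊗ Q ^ (2 * n)) ⊗ (1# ⊝ Q ⊗ (Q ⊗ Q ^ (2 * n)))
      ≈⟨ *-cong (*-cong (poch-double Q n) (1⊝-cong (*-congˡ (sym (^-assocʳ Q 2 n)))))
           (1⊝-cong (trans (*-congˡ (*-congˡ (sym (^-assocʳ Q 2 n)))) (solve 2 (λ Q x → Q :* (Q :* x) := Q :* (Q :* con 1ℤ) :* x) refl Q (Q2 ^ n)))) ⟩
    poch Q Q2 n ⊗ poch Q2 Q2 n ⊗ (1# ⊝ Q ⊗ Q2 ^ n) ⊗ (1# ⊝ Q2 ⊗ Q2 ^ n)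
      ≈⟨ solve 4 (λ a b c d → a :* b :* c :* d := a :* c :* (b :* d)) refl (poch Q Q2 n) (poch Q2 Q2 n) (1# ⊝ Q ⊗ Q2 ^ n) (1# ⊝ Q2 ⊗ Q2 ^ n) ⟩
    poch Q Q2 n ⊗ (1# ⊝ Q ⊗ Q2 ^ n) ⊗ (poch Q2 Q2 n ⊗ (1# ⊝ Q2 ⊗ Q2 ^ n)) ∎
    where Q2 = Q ^ 2

  module Main (q : Carrier) (d k e w : ℕ) (parity : Parity d e w)
    (ℓ : ℕ) (1≤ℓ : 1 ≤ ℓ) (nil : (q ^ d) ^ ℓ ≈ 0#) where

    open Levels R q d k e w parity
    open Truncation ℓ 1≤ℓ nil

    W≈poch : ∀ j r → W j r ≈ poch (q ^ (2 * r + 2)) (q ^ 2) j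
    W≈poch zero    r = refl
    W≈poch (suc j) r = sym (trans (poch-shift _ _ j)
      (*-congˡ (trans (poch-cong j (trans (sym (^-homo-* q (2 * r + 2) 2)) (^-congʳ q (lemma r))) refl) (sym (W≈poch j (suc r))))))
      where
      lemma : ∀ r → 2 * r + 2 + 2 ≡ 2 * suc r + 2
      lemma = solve-∀

    V≈poch : ∀ j r → V j r ≈ poch ((q ^ (2 * r + 2)) ^ d) (Q ^ 2) j
    V≈poch zero    r = refl
    V≈poch (suc j) r = sym (trans (poch-shift _ _ j) (*-congˡ (trans (poch-cong j step refl) (sym (V≈poch j (suc r))))))
      where
      lemma : ∀ r d → (2 * r + 2) * d + d * 2 ≡ (2 * suc r + 2) * d
      lemma = solve-∀
      step : (q ^ (2 * r + 2)) ^ d ⊗ Q ^ 2 ≈ (q ^ (2 * suc r + 2)) ^ d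
      step = begin
        (q ^ (2 * r + 2)) ^ d ⊗ Q ^ 2          ≈⟨ *-cong (^-assocʳ q (2 * r + 2) d) (^-assocʳ q d 2) ⟩
        q ^ ((2 * r + 2) * d) ⊗ q ^ (d * 2)    ≈⟨ sym (^-homo-* q ((2 * r + 2) * d) (d * 2)) ⟩
        q ^ ((2 * r + 2) * d + d * 2)          ≈⟨ ^-congʳ q (lemma r d) ⟩
        q ^ ((2 * suc r + 2) * d)              ≈⟨ sym (^-assocʳ q (2 * suc r + 2) d) ⟩
        (q ^ (2 * suc r + 2)) ^ d              ∎

    module Product
      (Odd Even : (j r B : ℕ) → Carrier)
      (Odd-base : ∀ r B → Odd 0 r B ≈ 1#)
      (Odd-skip : ∀ j r b x → x < d → Odd j r (d * b + suc x) ≈ Odd j r (d * suc b))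
      (Odd-zero : ∀ j r → Odd (suc j) r (d * 0) ≈ 0#)
      (Odd-step : ∀ j r b → Odd (suc j) r (d * suc b) ≈ Odd (suc j) r (d * b) ⊕ q ^ ((2 * r + 1) * (d * b)) ⊗ Even j r (d * k + e ∸ d * b))
      (Even-zero : ∀ j r → Even j r 0 ≈ 0#)
      (Even-step : ∀ j r m → Even j r (suc m) ≈ Even j r m ⊕ q ^ ((2 * r + 2) * m) ⊗ Odd j (suc r) (d * k + e ∸ m))
      where

      open Recurrence Odd Even Odd-base Odd-skip Odd-zero Odd-step Even-zero Even-step

      -- `Y` splits as (Q; Q²)(Q²; Q²), and its even half equals `V ℓ 0`. Cancelling that half
      -- through its inverse leaves the denominator (Q; Q²)(q²; q²) of the theorem, with the theta
      -- product on the other side.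
      product : ∀ β i → β + i ≡ k → (Q2⁻¹ P⁻¹ : Carrier) →
        poch (Q ^ 2) (Q ^ 2) ℓ ⊗ Q2⁻¹ ≈ 1# → poch (Q ^ suc ν) (Q ^ suc ν) ℓ ⊗ P⁻¹ ≈ 1# →
        Odd ℓ 0 (d * suc β) ⊗ (poch Q (Q ^ 2) ℓ ⊗ poch (q ^ 2) (q ^ 2) ℓ)
          ≈ poch (Q ^ suc β) (Q ^ suc ν) (ℓ + ℓ) ⊗ poch (Q ^ (β + (2 * i + w))) (Q ^ suc ν) (ℓ + ℓ) ⊗ poch (Q ^ suc ν) (Q ^ suc ν) ℓ
      product β i h Q2⁻¹ P⁻¹ invQ2 invP = begin
        o ⊗ (oddF ⊗ W₀)
          ≈⟨ sym (*-identityʳ _) ⟩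
        o ⊗ (oddF ⊗ W₀) ⊗ 1#
          ≈⟨ *-congˡ (sym invQ2) ⟩
        o ⊗ (oddF ⊗ W₀) ⊗ (evenF ⊗ Q2⁻¹)
          ≈⟨ solve 5 (λ o a b c e → o :* (a :* b) :* (c :* e) := o :* (a :* c) :* b :* e) refl o oddF W₀ evenF Q2⁻¹ ⟩
        o ⊗ (oddF ⊗ evenF) ⊗ W₀ ⊗ Q2⁻¹
          ≈⟨ *-congʳ (*-cong (*-congˡ (trans (sym (poch-double Q ℓ)) (poch-cong (2 * ℓ) (sym (*-identityʳ Q)) refl))) (sym (W≈poch ℓ 0))) ⟩
        o ⊗ Y ⊗ W ℓ 0 ⊗ Q2⁻¹
          ≈⟨ *-congʳ (closed-all ℓ 0 (ℕ.+-identityʳ ℓ) β i h) ⟩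
        Hb β i 0 ⊗ V ℓ 0 ⊗ Q2⁻¹
          ≈⟨ *-assoc _ _ _ ⟩
        Hb β i 0 ⊗ (V ℓ 0 ⊗ Q2⁻¹)
          ≈⟨ *-congˡ (trans (*-congʳ (trans (V≈poch ℓ 0) (poch-cong ℓ Q2≈ refl))) invQ2) ⟩
        Hb β i 0 ⊗ 1#
          ≈⟨ *-identityʳ _ ⟩
        Hb β i 0
          ≈⟨ theta (β + (2 * i + w)) (proj₂ b̄≡) ν≡′ ⟩
        poch (Q ^ suc β) (Q ^ suc ν) (ℓ + ℓ) ⊗ poch (Q ^ (β + (2 * i + w))) (Q ^ suc ν) (ℓ + ℓ) ⊗ poch (Q ^ suc ν) (Q ^ suc ν) ℓ ∎
        where
        o = Odd ℓ 0 (d * suc β)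
        oddF = poch Q (Q ^ 2) ℓ
        evenF = poch (Q ^ 2) (Q ^ 2) ℓ
        W₀ = poch (q ^ 2) (q ^ 2) ℓ
        Q2≈ : (q ^ 2) ^ d ≈ Q ^ 2
        Q2≈ = trans (^-assocʳ q 2 d) (trans (^-congʳ q (ℕ.*-comm 2 d)) (sym (^-assocʳ q d 2)))
        b̄≡ : ∃[ b̄ ] β + (2 * i + w) ≡ suc b̄
        b̄≡ with c , eq ← positive i = β + c , ≡.trans (≡.cong (λ x → β + x) eq) (ℕ.+-suc β c)
        ν≡′ : suc β + (β + (2 * i + w)) ≡ suc ν
        ν≡′ = ≡.cong suc (≡.trans (lemma β i w) (≡.cong (λ k → 2 * k + w) h))
          where
          lemma : ∀ β i w → β + (β + (2 * i + w)) ≡ 2 * (β + i) + w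
          lemma = solve-∀
        theta : ∀ b {b̄} → b ≡ suc b̄ → suc β + b ≡ suc ν → Σ (QDifference.hterm R Q ν (suc β) b 0) ℓ
          ≈ poch (Q ^ suc β) (Q ^ suc ν) (ℓ + ℓ) ⊗ poch (Q ^ b) (Q ^ suc ν) (ℓ + ℓ) ⊗ poch (Q ^ suc ν) (Q ^ suc ν) ℓ
        theta _ {b̄} ≡.refl eq = trans (H-θ Q ν β b̄ ℓ zz′≈P 1≤ℓ nil)
          (sym (TripleProduct.Theta.Limit.triple-product R (Q ^ suc ν) (Q ^ suc β) (Q ^ suc b̄) zz′≈P ℓ
            (^-∣-zero Q ℓ ν nil) (^-∣-zero Q ℓ β nil) (^-∣-zero Q ℓ b̄ nil) P⁻¹ invP))
          where
          zz′≈P : Q ^ suc β ⊗ Q ^ suc b̄ ≈ Q ^ suc ν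
          zz′≈P = trans (sym (^-homo-* Q (suc β) (suc b̄))) (^-congʳ Q eq)

-- Truncated power series

module PowerSeries where

  open ≡ using (refl; sym; trans; cong; cong₂)
  module ∑ = Algebra.Properties.Semiring.Sum ℤ.+-*-semiring

  infixl 6 _⊞_
  infix  8 ⊟_

  𝟘 : Series
  𝟘 _ = 0ℤ

  _⊞_ : Series → Series → Series
  (f ⊞ g) n = f n ℤ.+ g n

  ⊟_ : Series → Series
  (⊟ f) n = ℤ.- f n

  infix 4 _≋[_]_
  _≋[_]_ : Series → ℕ → Series → Set
  f ≋[ L ] g = ∀ n → n < L → f n ≡ g n

  ⊛-zeroˡ : ∀ f g → (∀ n → f n ≡ 0ℤ) → ∀ n → (f ⊛ g) n ≡ 0ℤ
  ⊛-zeroˡ f g f≡0 n = sum-zero {suc n} _ λ i → trans (cong (ℤ._* g (n ∸ toℕ i)) (f≡0 (toℕ i))) (ℤ.*-zeroˡ (g (n ∸ toℕ i)))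

  ⊛-cong-upTo : ∀ L f f′ g g′ → f ≋[ L ] f′ → g ≋[ L ] g′ → (f ⊛ g) ≋[ L ] (f′ ⊛ g′)
  ⊛-cong-upTo L f f′ g g′ f≋ g≋ n n<L = ∑.sum-cong-≗ {suc n} λ i →
    cong₂ ℤ._*_ (f≋ _ (ℕ.≤-<-trans (toℕ≤pred[n] i) n<L)) (g≋ _ (ℕ.≤-<-trans (ℕ.m∸n≤m n (toℕ i)) n<L))

  -- By definition the convolution at `suc n` is `f 0 ℤ.* g (suc n)` plus `(f ∘ suc ⊛ g) n`. This
  -- induction and the similar ones below therefore let `f` vary.
  ⊛-scale : ∀ a f g n → ((λ m → a ℤ.* f m) ⊛ g) n ≡ a ℤ.* (f ⊛ g) n
  ⊛-scale a f g zero    = e a (f 0) (g 0)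
    where
    e : ∀ a x y → a ℤ.* x ℤ.* y ℤ.+ 0ℤ ≡ a ℤ.* (x ℤ.* y ℤ.+ 0ℤ)
    e = ℤ-solve-∀
  ⊛-scale a f g (suc n) = trans (cong (λ x → a ℤ.* f 0 ℤ.* g (suc n) ℤ.+ x) (⊛-scale a (f ∘ suc) g n)) (e a (f 0) (g (suc n)) ((f ∘ suc ⊛ g) n))
    where
    e : ∀ a x y z → a ℤ.* x ℤ.* y ℤ.+ a ℤ.* z ≡ a ℤ.* (x ℤ.* y ℤ.+ z)
    e = ℤ-solve-∀

  ⊛-distribʳ : ∀ h f g n → ((f ⊞ g) ⊛ h) n ≡ (f ⊛ h ⊞ g ⊛ h) n
  ⊛-distribʳ h f g zero    = e (f 0) (g 0) (h 0)
    where
    e : ∀ x y z → (x ℤ.+ y) ℤ.* z ℤ.+ 0ℤ ≡ x ℤ.* z ℤ.+ 0ℤ ℤ.+ (y ℤ.* z ℤ.+ 0ℤ)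
    e = ℤ-solve-∀
  ⊛-distribʳ h f g (suc n) = trans (cong (λ x → (f 0 ℤ.+ g 0) ℤ.* h (suc n) ℤ.+ x) (⊛-distribʳ h (f ∘ suc) (g ∘ suc) n))
    (e (f 0) (g 0) (h (suc n)) ((f ∘ suc ⊛ h) n) ((g ∘ suc ⊛ h) n))
    where
    e : ∀ x y z u v → (x ℤ.+ y) ℤ.* z ℤ.+ (u ℤ.+ v) ≡ x ℤ.* z ℤ.+ u ℤ.+ (y ℤ.* z ℤ.+ v)
    e = ℤ-solve-∀

  ⊛-sucʳ : ∀ f g n → (f ⊛ g) (suc n) ≡ (f ⊛ (g ∘ suc)) n ℤ.+ f (suc n) ℤ.* g 0
  ⊛-sucʳ f g zero    = e (f 0) (g 1) (f 1) (g 0)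
    where
    e : ∀ x y u v → x ℤ.* y ℤ.+ (u ℤ.* v ℤ.+ 0ℤ) ≡ x ℤ.* y ℤ.+ 0ℤ ℤ.+ u ℤ.* v
    e = ℤ-solve-∀
  ⊛-sucʳ f g (suc n) = trans (cong (λ x → f 0 ℤ.* g (suc (suc n)) ℤ.+ x) (⊛-sucʳ (f ∘ suc) g n)) (sym (ℤ.+-assoc (f 0 ℤ.* g (suc (suc n))) ((f ∘ suc ⊛ g ∘ suc) n) _))

  ⊛-comm : ∀ f g n → (f ⊛ g) n ≡ (g ⊛ f) n
  ⊛-comm f g zero    = cong (ℤ._+ 0ℤ) (ℤ.*-comm (f 0) (g 0))
  ⊛-comm f g (suc n) = begin
    f 0 ℤ.* g (suc n) ℤ.+ (f ∘ suc ⊛ g) n   ≡⟨ ℤ.+-comm (f 0 ℤ.* g (suc n)) _ ⟩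
    (f ∘ suc ⊛ g) n ℤ.+ f 0 ℤ.* g (suc n)   ≡⟨ cong₂ ℤ._+_ (⊛-comm (f ∘ suc) g n) (ℤ.*-comm (f 0) (g (suc n))) ⟩
    (g ⊛ f ∘ suc) n ℤ.+ g (suc n) ℤ.* f 0   ≡⟨ sym (⊛-sucʳ g f n) ⟩
    (g ⊛ f) (suc n)                         ∎
    where open ≡.≡-Reasoning

  ⊛-congˡ : ∀ f g g′ → (∀ n → g n ≡ g′ n) → ∀ n → (f ⊛ g) n ≡ (f ⊛ g′) n
  ⊛-congˡ f g g′ h n = ⊛-cong-upTo (suc n) f f g g′ (λ _ _ → refl) (λ m _ → h m) n ℕ.≤-refl

  ⊛-distribˡ : ∀ h f g n → (h ⊛ (f ⊞ g)) n ≡ (h ⊛ f ⊞ h ⊛ g) n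
  ⊛-distribˡ h f g n = trans (⊛-comm h (f ⊞ g) n) (trans (⊛-distribʳ h f g n) (cong₂ ℤ._+_ (⊛-comm f h n) (⊛-comm g h n)))

  -- The shift of f ⊛ g is definitionally the sum of `g ∘ suc` scaled by `f 0` and of `f ∘ suc ⊛ g`;
  -- the induction hypothesis handles the second summand.
  ⊛-assoc : ∀ f g h n → ((f ⊛ g) ⊛ h) n ≡ (f ⊛ (g ⊛ h)) n
  ⊛-assoc f g h zero    = e (f 0) (g 0) (h 0)
    where
    e : ∀ x y z → (x ℤ.* y ℤ.+ 0ℤ) ℤ.* z ℤ.+ 0ℤ ≡ x ℤ.* (y ℤ.* z ℤ.+ 0ℤ) ℤ.+ 0ℤ
    e = ℤ-solve-∀
  ⊛-assoc f g h (suc n) = begin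
    (f 0 ℤ.* g 0 ℤ.+ 0ℤ) ℤ.* h (suc n) ℤ.+ (((λ m → f 0 ℤ.* g (suc m)) ⊞ (f ∘ suc ⊛ g)) ⊛ h) n
      ≡⟨ cong (λ x → (f 0 ℤ.* g 0 ℤ.+ 0ℤ) ℤ.* h (suc n) ℤ.+ x) (⊛-distribʳ h (λ m → f 0 ℤ.* g (suc m)) (f ∘ suc ⊛ g) n) ⟩
    (f 0 ℤ.* g 0 ℤ.+ 0ℤ) ℤ.* h (suc n) ℤ.+ (((λ m → f 0 ℤ.* g (suc m)) ⊛ h) n ℤ.+ ((f ∘ suc ⊛ g) ⊛ h) n)
      ≡⟨ cong (λ x → (f 0 ℤ.* g 0 ℤ.+ 0ℤ) ℤ.* h (suc n) ℤ.+ x) (cong₂ ℤ._+_ (⊛-scale (f 0) (g ∘ suc) h n) (⊛-assoc (f ∘ suc) g h n)) ⟩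
    (f 0 ℤ.* g 0 ℤ.+ 0ℤ) ℤ.* h (suc n) ℤ.+ (f 0 ℤ.* (g ∘ suc ⊛ h) n ℤ.+ (f ∘ suc ⊛ (g ⊛ h)) n)
      ≡⟨ e (f 0) (g 0) (h (suc n)) ((g ∘ suc ⊛ h) n) ((f ∘ suc ⊛ (g ⊛ h)) n) ⟩
    f 0 ℤ.* (g 0 ℤ.* h (suc n) ℤ.+ (g ∘ suc ⊛ h) n) ℤ.+ (f ∘ suc ⊛ (g ⊛ h)) n ∎
    where
    open ≡.≡-Reasoning
    e : ∀ x y z u v → (x ℤ.* y ℤ.+ 0ℤ) ℤ.* z ℤ.+ (x ℤ.* u ℤ.+ v) ≡ x ℤ.* (y ℤ.* z ℤ.+ u) ℤ.+ v
    e = ℤ-solve-∀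

  ⊛-identityˡ : ∀ f n → (𝟙 ⊛ f) n ≡ f n
  ⊛-identityˡ f zero    = trans (ℤ.+-identityʳ _) (ℤ.*-identityˡ (f 0))
  ⊛-identityˡ f (suc n) = trans (cong₂ ℤ._+_ (ℤ.*-identityˡ (f (suc n))) (⊛-zeroˡ (𝟙 ∘ suc) f (λ _ → refl) n)) (ℤ.+-identityʳ _)

  -- ℤ[[q]]/(q^L), with series as representatives.
  truncated : ℕ → CommutativeRing 0ℓ 0ℓ
  truncated L = record
    { Carrier = Series
    ; _≈_ = _≋[ L ]_
    ; _+_ = _⊞_
    ; _*_ = _⊛_
    ; -_ = ⊟_
    ; 0# = 𝟘
    ; 1# = 𝟙
    ; isCommutativeRing = record
      { isRing = record
        { +-isAbelianGroup = record
          { isGroup = record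
            { isMonoid = record
              { isSemigroup = record
                { isMagma = record
                  { isEquivalence = record
                    { refl = λ _ _ → refl
                    ; sym = λ p n n<L → sym (p n n<L)
                    ; trans = λ p r n n<L → trans (p n n<L) (r n n<L)
                    }
                  ; ∙-cong = λ p r n n<L → cong₂ ℤ._+_ (p n n<L) (r n n<L)
                  }
                ; assoc = λ f g h n _ → ℤ.+-assoc (f n) (g n) (h n)
                }
              ; identity = (λ f n _ → ℤ.+-identityˡ (f n)) , (λ f n _ → ℤ.+-identityʳ (f n))
              }
            ; inverse = (λ f n _ → ℤ.+-inverseˡ (f n)) , (λ f n _ → ℤ.+-inverseʳ (f n))
            ; ⁻¹-cong = λ p n n<L → cong ℤ.-_ (p n n<L)
            }
          ; comm = λ f g n _ → ℤ.+-comm (f n) (g n)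
          }
        ; *-cong = λ {f} {f′} {g} {g′} → ⊛-cong-upTo L f f′ g g′
        ; *-assoc = λ f g h n _ → ⊛-assoc f g h n
        ; *-identity = (λ f n _ → ⊛-identityˡ f n) , (λ f n _ → trans (⊛-comm f 𝟙 n) (⊛-identityˡ f n))
        ; distrib = (λ h f g n _ → ⊛-distribˡ h f g n) , (λ h f g n _ → ⊛-distribʳ h f g n)
        }
      ; *-comm = λ f g n _ → ⊛-comm f g n
      }
    }

  q⊛-zero : ∀ f → (q ⊛ f) 0 ≡ 0ℤ
  q⊛-zero f = trans (ℤ.+-identityʳ _) (ℤ.*-zeroˡ (f 0))

  q⊛-suc : ∀ f n → (q ⊛ f) (suc n) ≡ f n
  q⊛-suc f n = begin
    0ℤ ℤ.* f (suc n) ℤ.+ (q ∘ suc ⊛ f) n  ≡⟨ cong₂ ℤ._+_ (ℤ.*-zeroˡ (f (suc n))) (⊛-comm (q ∘ suc) f n) ⟩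
    0ℤ ℤ.+ (f ⊛ q ∘ suc) n                ≡⟨ ℤ.+-identityˡ _ ⟩
    (f ⊛ q ∘ suc) n                       ≡⟨ ⊛-congˡ f (q ∘ suc) 𝟙 (λ { zero → refl ; (suc _) → refl }) n ⟩
    (f ⊛ 𝟙) n                             ≡⟨ ⊛-comm f 𝟙 n ⟩
    (𝟙 ⊛ f) n                             ≡⟨ ⊛-identityˡ f n ⟩
    f n                                   ∎
    where open ≡.≡-Reasoning

  q^-diagonal : ∀ n → (q^ n) n ≡ 1ℤ
  q^-diagonal zero    = refl
  q^-diagonal (suc n) = trans (q⊛-suc (q^ n) n) (q^-diagonal n)

  q^-off-diagonal : ∀ m n → m ≢ n → (q^ m) n ≡ 0ℤ
  q^-off-diagonal zero    zero    m≢n = contradiction refl m≢n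
  q^-off-diagonal zero    (suc n) _   = refl
  q^-off-diagonal (suc m) zero    _   = q⊛-zero (q^ m)
  q^-off-diagonal (suc m) (suc n) m≢n = trans (q⊛-suc (q^ m) n) (q^-off-diagonal m n (m≢n ∘ cong suc))

open PowerSeries

-- Infinite products as finite ones modulo q^L

module InfiniteProducts (L : ℕ) where

  open CommutativeRing (truncated L) hiding (_+_; _*_; _-_; zero)
  open Sums (truncated L)
  open import Algebra.Properties.Semiring.Exp semiring using (_^_; ^-assocʳ; ^-congʳ)

  ^≡^ˢ : ∀ f n → f ^ n ≡ f ^ˢ n
  ^≡^ˢ f zero    = ≡.refl
  ^≡^ˢ f (suc n) = ≡.cong (f ⊛_) (^≡^ˢ f n)

  poch≡⟨⨾⟩ : ∀ a x n → poch a x n ≡ ⟨ a ⨾ x ⟩ n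
  poch≡⟨⨾⟩ a x zero    = ≡.refl
  poch≡⟨⨾⟩ a x (suc n) = ≡.cong₂ (λ u v → u ⊛ (𝟙 ⊖ a ⊛ v)) (poch≡⟨⨾⟩ a x n) (^≡^ˢ x n)

  poch≈⟨⨾⟩∞ : ∀ a x K → a 0 ≡ 0ℤ → x 0 ≡ 0ℤ → L ≤ K → poch a x K ≈ ⟨ a ⨾ x ⟩∞
  poch≈⟨⨾⟩∞ a x K a₀ x₀ L≤K m m<L = ≡.trans (≡.cong (λ f → f m) (poch≡⟨⨾⟩ a x K))
    (proj₂ (⟨⨾⟩-converges a x a₀ x₀ m) K (ℕ.≤-trans (ℕ.<⇒≤ m<L) L≤K))

  poch-constant : ∀ a x n → a 0 ≡ 0ℤ → poch a x n 0 ≡ 1ℤ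
  poch-constant a x zero    a₀ = ≡.refl
  poch-constant a x (suc n) a₀ = ⊛-constant (poch a x n) (𝟙 ⊖ a ⊛ x ^ n) (poch-constant a x n a₀) factor
    where
    factor : 1ℤ ℤ.- (a ⊛ x ^ n) 0 ≡ 1ℤ
    factor rewrite a₀ = ≡.cong (λ z → 1ℤ ℤ.- (z ℤ.+ 0ℤ)) (ℤ.*-zeroˡ ((x ^ n) 0))

  poch-inverse : ∀ a x n → a 0 ≡ 0ℤ → poch a x n ⊛ inverse (poch a x n) ≈ 𝟙
  poch-inverse a x n a₀ m _ = inverseʳ (poch a x n) (poch-constant a x n a₀) m

  ^-constant : ∀ f n → f 0 ≡ 0ℤ → (f ^ suc n) 0 ≡ 0ℤ
  ^-constant f n f₀ = ≡.trans (≡.cong (λ g → g 0) (^≡^ˢ f (suc n))) (^-vanishes f f₀ (suc n) 0 (s≤s z≤n))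

  q^^≈ : ∀ d m {n} → d * m ≡ n → (q ^ d) ^ m ≈ q^ n
  q^^≈ d m {n} h = trans (^-assocʳ q d m) (trans (^-congʳ q h) (reflexive (^≡^ˢ q n)))

  q^-nilpotent : ∀ d → 1 ≤ d → (q ^ d) ^ L ≈ 0#
  q^-nilpotent d (s≤s {n = d′} _) = trans (q^^≈ d L ≡.refl) λ m m<L → ^-vanishes q ≡.refl (d * L) m (ℕ.<-≤-trans m<L (ℕ.m≤m+n L (d′ * L)))

-- Enumeration of the partitions

module PartitionEnumeration where

  open ≡ using (refl; sym; trans; cong; cong₂; subst)

  φ-++ : ∀ i xs ys → φ i (xs ++ ys) ≡ φ i xs + φ i ys
  φ-++ i xs ys = trans (cong length (filter-++ (i ℕ.≟_) xs ys)) (length-++ (filter (i ℕ.≟_) xs))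

  φ-absent : ∀ i xs → All (i ≢_) xs → φ i xs ≡ 0
  φ-absent i xs h = cong length (filter-none (i ℕ.≟_) h)

  φ-replicate-≡ : ∀ c p → φ c (replicate p c) ≡ p
  φ-replicate-≡ c p = trans (cong length (filter-all (c ℕ.≟_) (All.replicate⁺ p refl))) (length-replicate p)

  φ-replicate-≢ : ∀ {i c} p → i ≢ c → φ i (replicate p c) ≡ 0
  φ-replicate-≢ p i≢c = φ-absent _ _ (All.replicate⁺ p i≢c)

  φ-below : ∀ {c} xs → All (suc c ≤_) xs → φ c xs ≡ 0
  φ-below xs h = φ-absent _ xs (All.map (λ { c<c refl → ℕ.<-irrefl refl c<c }) h)

  φ-++-replicate-≡ : ∀ {c} xs p → All (suc c ≤_) xs → φ c (xs ++ replicate p c) ≡ p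
  φ-++-replicate-≡ {c} xs p h = trans (φ-++ c xs _) (cong₂ _+_ (φ-below xs h) (φ-replicate-≡ c p))

  φ-++-replicate-≢ : ∀ {i c} xs p → i ≢ c → φ i (xs ++ replicate p c) ≡ φ i xs
  φ-++-replicate-≢ {i} xs p i≢c = trans (φ-++ i xs _) (trans (cong (λ x → φ i xs + x) (φ-replicate-≢ p i≢c)) (ℕ.+-identityʳ _))

  replicate-sorted : ∀ p c → Linked _≥_ (replicate p c)
  replicate-sorted zero          c = []
  replicate-sorted (suc zero)    c = [-]
  replicate-sorted (suc (suc p)) c = ℕ.≤-refl ∷ replicate-sorted (suc p) c

  ++-replicate-sorted : ∀ {c} xs p → Linked _≥_ xs → All (suc c ≤_) xs → Linked _≥_ (xs ++ replicate p c)
  ++-replicate-sorted     []           p       _        _             = replicate-sorted p _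
  ++-replicate-sorted     (x ∷ [])     zero    _        _             = [-]
  ++-replicate-sorted     (x ∷ [])     (suc p) _        (c<x ∷ _)     = ℕ.<⇒≤ c<x ∷ replicate-sorted (suc p) _
  ++-replicate-sorted     (x ∷ y ∷ xs) p       (x≥y ∷ s) (_ ∷ h)      = x≥y ∷ ++-replicate-sorted (y ∷ xs) p s h

  sorted-head : ∀ {x xs} → Linked _≥_ (x ∷ xs) → All (_≤ x) xs
  sorted-head [-]          = []
  sorted-head (x≥y ∷ s)    = x≥y ∷ All.map (λ z≤y → ℕ.≤-trans z≤y x≥y) (sorted-head s)

  split-smallest : ∀ c xs → Linked _≥_ xs → All (c ≤_) xs →
    ∃[ μ ] ∃[ p ] (xs ≡ μ ++ replicate p c × Linked _≥_ μ × All (suc c ≤_) μ)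
  split-smallest c []       _ _           = [] , 0 , refl , [] , []
  split-smallest c (x ∷ xs) s (c≤x ∷ h) with c ℕ.≟ x
  ... | yes refl = [] , suc (length xs) , cong (c ∷_) (constant xs (sorted-head s) h) , [] , []
    where
    constant : ∀ ys → All (_≤ c) ys → All (c ≤_) ys → ys ≡ replicate (length ys) c
    constant []       _         _         = refl
    constant (y ∷ ys) (u ∷ us) (l ∷ ls) = cong₂ _∷_ (ℕ.≤-antisym u l) (constant ys us ls)
  ... | no c≢x with split-smallest c xs (Linked.tail s) h
  ...   | μ , p , refl , sμ , hμ = x ∷ μ , p , refl , cons μ s sμ , ℕ.≤∧≢⇒< c≤x c≢x ∷ hμ
    where
    cons : ∀ μ → Linked _≥_ (x ∷ μ ++ replicate p c) → Linked _≥_ μ → Linked _≥_ (x ∷ μ)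
    cons []      _         _  = [-]
    cons (y ∷ _) (x≥y ∷ _) sμ = x≥y ∷ sμ

  -- `key` recovers from an element the block it was built in, so distinct blocks are disjoint.
  unique-concatMap : ∀ {A B : Set} (f : A → List B) (key : B → A) → (∀ p {x} → x ∈ f p → key x ≡ p) →
    (∀ p → Unique (f p)) → ∀ {ps} → Unique ps → Unique (concatMap f ps)
  unique-concatMap f key h u []       = []
  unique-concatMap f key h u {p ∷ ps} (p∉ ∷ ups) = Unique.++⁺ (u p) (unique-concatMap f key h u ups) disjoint
    where
    disjoint : ∀ {x} → ¬ (x ∈ f p × x ∈ concatMap f ps)
    disjoint (x∈p , x∈ps) with p′ , p′∈ , x∈p′ ← find (∈-concatMap⁻ f {xs = ps} x∈ps) =
      All.lookup p∉ p′∈ (trans (sym (h p x∈p)) (h p′ x∈p′))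

  module Enumeration (d M : ℕ) where

    Allowed : ℕ → ℕ → Set
    Allowed c p = c % 2 ≡ 1 → d ∣ p

    allowed? : ∀ c → Decidable (Allowed c)
    allowed? c p = (c % 2 ℕ.≟ 1) →-dec (d ∣? p)

    odd%2 : ∀ i → (2 * i + 1) % 2 ≡ 1
    odd%2 i = trans (cong (_% 2) (trans (ℕ.+-comm (2 * i) 1) (cong suc (ℕ.*-comm 2 i)))) ([m+kn]%n≡m%n 1 i 2)

    odd-form : ∀ c → c % 2 ≡ 1 → 2 * (c / 2) + 1 ≡ c
    odd-form c h = trans (ℕ.+-comm (2 * (c / 2)) 1) (trans (cong₂ _+_ (sym h) (ℕ.*-comm 2 (c / 2))) (sym (m≡m%n+[m/n]*n c 2)))

    -- Partitions into parts c, …, c + j ∸ 1 with fewer than B parts equal to c, built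
    -- by choosing the multiplicity p of c and then a partition into larger parts.
    enum : (j c B : ℕ) → List (List ℕ)
    extend : (j c p : ℕ) → List (List ℕ)
    enum zero    c B = [] ∷ []
    enum (suc j) c B = concatMap (extend j c) (filter (allowed? c) (downFrom B))
    extend j c p = map (_++ replicate p c) (enum j (suc c) (M ∸ p))

    -- Admissibility relative to a least part size c, with the sum left free: the invariant under
    -- removal of all copies of c.
    record Good (c B : ℕ) (λs : List ℕ) : Set where
      constructor mkGood
      field
        sorted   : Linked _≥_ λs
        lower    : All (c ≤_) λs
        adjacent : ∀ i → c ≤ i → φ i λs + φ (suc i) λs < M
        first    : φ c λs < B
        odds     : ∀ i → d ∣ φ (2 * i + 1) λs

    ∈-enum⁻ : ∀ j c B {λs} → λs ∈ enum (suc j) c B →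
      ∃[ p ] ∃[ μ ] (p < B × Allowed c p × μ ∈ enum j (suc c) (M ∸ p) × λs ≡ μ ++ replicate p c)
    ∈-enum⁻ j c B λs∈
      with p , p∈ , λs∈p ← find (∈-concatMap⁻ (extend j c) {xs = filter (allowed? c) (downFrom B)} λs∈)
      with μ , μ∈ , eq ← ∈-map⁻ (_++ replicate p c) λs∈p
      with p∈′ , ok ← ∈-filter⁻ (allowed? c) {xs = downFrom B} p∈ = p , μ , ∈-downFrom⁻ p∈′ , ok , μ∈ , eq

    enum-lower : ∀ j c B {λs} → λs ∈ enum j c B → All (c ≤_) λs
    enum-lower zero    c B (here refl) = []
    enum-lower (suc j) c B λs∈ with p , μ , _ , _ , μ∈ , refl ← ∈-enum⁻ j c B λs∈ =
      All.++⁺ (All.map ℕ.<⇒≤ (enum-lower j (suc c) (M ∸ p) μ∈)) (All.replicate⁺ p ℕ.≤-refl)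

    enum-unique : ∀ j c B → Unique (enum j c B)
    enum-unique zero    c B = [] ∷ []
    enum-unique (suc j) c B = unique-concatMap (extend j c) (φ c) key
      (λ p → Unique.map⁺ (λ {xs} {ys} → ++-cancelʳ (replicate p c) xs ys) (enum-unique j (suc c) (M ∸ p)))
      (Unique.filter⁺ (allowed? c) (Unique.downFrom⁺ B))
      where
      key : ∀ p {x} → x ∈ extend j c p → φ c x ≡ p
      key p x∈ with μ , μ∈ , refl ← ∈-map⁻ (_++ replicate p c) x∈ = φ-++-replicate-≡ μ p (enum-lower j (suc c) (M ∸ p) μ∈)

    -- The bounds on B are self-propagating: p < B ≤ M gives 1 ≤ M - p ≤ M, so the subtraction never
    -- truncates and the next multiplicity bound is exactly the adjacency condition at c.
    enum-sound : ∀ j c B {λs} → 1 ≤ B → B ≤ M → λs ∈ enum j c B → Good c B λs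
    enum-sound zero    c B 1≤B B≤M (here refl) = mkGood [] [] (λ _ _ → ℕ.≤-trans 1≤B B≤M) 1≤B (λ _ → d ∣0)
    enum-sound (suc j) c B 1≤B B≤M λs∈ with p , μ , p<B , ok , μ∈ , refl ← ∈-enum⁻ j c B λs∈ =
      mkGood (++-replicate-sorted μ p μ.sorted μ.lower) (enum-lower (suc j) c B λs∈) adj
        (subst (_< B) (sym φc) p<B) odd
      where
      p<M = ℕ.<-≤-trans p<B B≤M
      module μ = Good (enum-sound j (suc c) (M ∸ p) (ℕ.m<n⇒0<n∸m p<M) (ℕ.m∸n≤m M p) μ∈)
      φc : φ c (μ ++ replicate p c) ≡ p
      φc = φ-++-replicate-≡ μ p μ.lower
      adj : ∀ i → c ≤ i → φ i (μ ++ replicate p c) + φ (suc i) (μ ++ replicate p c) < M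
      adj i c≤i with c ℕ.≟ i
      ... | yes refl = subst (_< M) (sym (cong₂ _+_ φc (φ-++-replicate-≢ μ p ℕ.1+n≢n)))
        (subst (p + φ (suc c) μ <_) (ℕ.m+[n∸m]≡n (ℕ.<⇒≤ p<M)) (ℕ.+-monoʳ-< p μ.first))
      ... | no c≢i = subst (_< M) (sym (cong₂ _+_ (φ-++-replicate-≢ μ p (c≢i ∘ sym))
          (φ-++-replicate-≢ μ p (λ { refl → ℕ.<-irrefl refl c≤i }))))
        (μ.adjacent i (ℕ.≤∧≢⇒< c≤i c≢i))
      odd : ∀ i → d ∣ φ (2 * i + 1) (μ ++ replicate p c)
      odd i with 2 * i + 1 ℕ.≟ c
      ... | yes refl = subst (d ∣_) (sym φc) (ok (odd%2 i))
      ... | no  i≢c  = subst (d ∣_) (sym (φ-++-replicate-≢ μ p i≢c)) (μ.odds i)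

    -- In a non-increasing list the copies of the least allowed part form a suffix. Once it is split
    -- off, the adjacency condition at c becomes the bound M - p on the multiplicity of c + 1.
    enum-complete : ∀ j c B {λs} → Good c B λs → All (_< c + j) λs → λs ∈ enum j c B
    enum-complete zero c B {[]}     g _        = here refl
    enum-complete zero c B {x ∷ xs} g (x< ∷ _) with c≤x ∷ _ ← Good.lower g =
      contradiction (ℕ.<-≤-trans x< (ℕ.≤-trans (ℕ.≤-reflexive (ℕ.+-identityʳ c)) c≤x)) (ℕ.<-irrefl refl)
    enum-complete (suc j) c B {λs} g upper
      with μ , p , refl , sμ , lμ ← split-smallest c λs (Good.sorted g) (Good.lower g) =
      ∈-concatMap⁺ (extend j c) (lose (∈-filter⁺ (allowed? c) (∈-downFrom⁺ (subst (_< B) φc g.first)) ok)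
        (∈-map⁺ (_++ replicate p c) (enum-complete j (suc c) (M ∸ p) good upperμ)))
      where
      module g = Good g
      φc : φ c (μ ++ replicate p c) ≡ p
      φc = φ-++-replicate-≡ μ p lμ
      ok : Allowed c p
      ok h = subst (d ∣_) φc (subst (λ c′ → d ∣ φ c′ (μ ++ replicate p c)) (odd-form c h) (g.odds (c / 2)))
      upperμ : All (_< suc c + j) μ
      upperμ = All.map (λ {x} → subst (x <_) (ℕ.+-suc c j)) (All.++⁻ˡ μ upper)
      same : ∀ i → suc c ≤ i → φ i (μ ++ replicate p c) ≡ φ i μ
      same i c<i = φ-++-replicate-≢ μ p (λ { refl → ℕ.<-irrefl refl c<i })
      odd : ∀ i → d ∣ φ (2 * i + 1) μ
      odd i with 2 * i + 1 ℕ.≟ c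
      ... | yes refl = subst (d ∣_) (sym (φ-below μ lμ)) (d ∣0)
      ... | no  i≢c  = subst (d ∣_) (φ-++-replicate-≢ μ p i≢c) (g.odds i)
      good : Good (suc c) (M ∸ p) μ
      good = mkGood sμ lμ
        (λ i c<i → subst (_< M) (cong₂ _+_ (same i c<i) (same (suc i) (ℕ.m<n⇒m<1+n c<i))) (g.adjacent i (ℕ.<⇒≤ c<i)))
        (ℕ.m+n≤o⇒m≤o∸n _ (subst (_≤ M) (cong suc (trans (cong₂ _+_ φc (same (suc c) ℕ.≤-refl)) (ℕ.+-comm p _))) (g.adjacent c ℕ.≤-refl)))
        odd

  -- Both lists are duplicate-free with the same members, hence permutations of each other. Every
  -- part of a partition of n is at most n ≤ j, so limiting the part sizes loses nothing.
  B̅-enum : ∀ d k e a n j → 1 ≤ d * a → d * a ≤ d * k + e → n ≤ j →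
    B̅ d k e a n ≡ length (filter (λ λs → sum λs ℕ.≟ n) (Enumeration.enum d (d * k + e) j 1 (d * a)))
  B̅-enum d k e a n j 1≤da da≤M n≤j = ↭-length (∼bag⇒↭ (unique∧set⇒bag
    (BPartitions-unique d k e a n) (Unique.filter⁺ (λ λs → sum λs ℕ.≟ n) (enum-unique j 1 (d * a))) (mk⇔ to from)))
    where
    open Enumeration d (d * k + e)
    to : ∀ {λs} → λs ∈ BPartitions d k e a n → λs ∈ filter (λ λs → sum λs ℕ.≟ n) (enum j 1 (d * a))
    to {λs} λs∈ with mkIsPartition s pos refl , mkAdmissible adj ones odds ← Equivalence.to (∈-BPartitions d k e a n λs) λs∈ =
      ∈-filter⁺ (λ λs → sum λs ℕ.≟ n)
        (enum-complete j 1 (d * a) (mkGood s pos adj ones odds) (All.map (λ x≤ → s≤s (ℕ.≤-trans x≤ n≤j)) (parts≤sum λs))) refl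
    from : ∀ {λs} → λs ∈ filter (λ λs → sum λs ℕ.≟ n) (enum j 1 (d * a)) → λs ∈ BPartitions d k e a n
    from {λs} λs∈ with λs∈′ , sum≡n ← ∈-filter⁻ (λ λs → sum λs ℕ.≟ n) {xs = enum j 1 (d * a)} λs∈
      with mkGood s pos adj ones odds ← enum-sound j 1 (d * a) 1≤da da≤M λs∈′ =
      Equivalence.from (∈-BPartitions d k e a n λs) (mkIsPartition s pos sum≡n , mkAdmissible adj ones odds)

open PartitionEnumeration

-- Generating functions of the enumerated partitions

gf : List (List ℕ) → Series
gf []        = 𝟘
gf (λs ∷ xs) = q^ sum λs ⊞ gf xs

gf-coefficient : ∀ xs n → gf xs n ≡ + length (filter (λ λs → sum λs ℕ.≟ n) xs)
gf-coefficient []        n = ≡.refl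
gf-coefficient (λs ∷ xs) n = case (sum λs ℕ.≟ n)
  where
  sum≟n : Decidable (λ λs → sum λs ≡ n)
  sum≟n λs = sum λs ℕ.≟ n
  case : Dec (sum λs ≡ n) → gf (λs ∷ xs) n ≡ + length (filter sum≟n (λs ∷ xs))
  case (yes s≡n) = ≡.trans (≡.cong₂ ℤ._+_ (≡.trans (≡.cong (q^ sum λs) (≡.sym s≡n)) (q^-diagonal (sum λs))) (gf-coefficient xs n))
    (≡.cong (λ ys → + length ys) (≡.sym (filter-accept sum≟n {λs} {xs} s≡n)))
  case (no s≢n) = ≡.trans (≡.trans (≡.cong₂ ℤ._+_ (q^-off-diagonal (sum λs) n s≢n) (gf-coefficient xs n)) (ℤ.+-identityˡ _))
    (≡.cong (λ ys → + length ys) (≡.sym (filter-reject sum≟n {λs} {xs} s≢n)))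

sum-replicate : ∀ p c → sum (replicate p c) ≡ c * p
sum-replicate zero    c = ≡.sym (ℕ.*-zeroʳ c)
sum-replicate (suc p) c = ≡.trans (≡.cong (λ s → c + s) (sum-replicate p c)) (≡.sym (ℕ.*-suc c p))

module GeneratingFunctions (L d M : ℕ) where

  open CommutativeRing (truncated L) hiding (_+_; _*_; _-_; zero)
  open CommutativeRing (truncated L) using () renaming (_+_ to infixl 6 _⊕_; _-_ to infixl 6 _⊝_; _*_ to infixl 7 _⊗_)
  open import Algebra.Properties.Semiring.Exp semiring using (_^_; ^-homo-*)
  open import Relation.Binary.Reasoning.Setoid setoid
  open Enumeration d M
  open InfiniteProducts L using (^≡^ˢ)

  gf-++ : ∀ xs ys → gf (xs ++ ys) ≈ gf xs ⊕ gf ys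
  gf-++ []        ys = sym (+-identityˡ (gf ys))
  gf-++ (λs ∷ xs) ys = trans (+-congˡ {q^ sum λs} (gf-++ xs ys)) (sym (+-assoc (q^ sum λs) (gf xs) (gf ys)))

  gf-append : ∀ p c xs → gf (map (_++ replicate p c) xs) ≈ q ^ (c * p) ⊗ gf xs
  gf-append p c []        = sym (zeroʳ (q ^ (c * p)))
  gf-append p c (λs ∷ xs) = begin
    q^ sum (λs ++ replicate p c) ⊕ gf (map (_++ replicate p c) xs)
      ≈⟨ +-cong {q^ sum (λs ++ replicate p c)} power (gf-append p c xs) ⟩
    q ^ (c * p) ⊗ q^ sum λs ⊕ q ^ (c * p) ⊗ gf xs
      ≈⟨ sym (distribˡ (q ^ (c * p)) (q^ sum λs) (gf xs)) ⟩
    q ^ (c * p) ⊗ (q^ sum λs ⊕ gf xs) ∎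
    where
    power : q^ sum (λs ++ replicate p c) ≈ q ^ (c * p) ⊗ q^ sum λs
    power = begin
      q^ sum (λs ++ replicate p c)     ≡⟨ ≡.cong q^_ (≡.trans (sum-++ λs (replicate p c)) (≡.trans (≡.cong (λ s → sum λs + s) (sum-replicate p c)) (ℕ.+-comm (sum λs) (c * p)))) ⟩
      q^ (c * p + sum λs)              ≡⟨ ≡.sym (^≡^ˢ q (c * p + sum λs)) ⟩
      q ^ (c * p + sum λs)             ≈⟨ ^-homo-* q (c * p) (sum λs) ⟩
      q ^ (c * p) ⊗ q ^ sum λs         ≡⟨ ≡.cong (q ^ (c * p) ⊗_) (^≡^ˢ q (sum λs)) ⟩
      q ^ (c * p) ⊗ q^ sum λs          ∎

  -- `downFrom (suc B)` is `B ∷ downFrom B`, so raising the bound by one adds the partitions with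
  -- exactly B copies of c.
  enum-accept : ∀ j c B → Allowed c B → gf (enum (suc j) c (suc B)) ≈ gf (enum (suc j) c B) ⊕ q ^ (c * B) ⊗ gf (enum j (suc c) (M ∸ B))
  enum-accept j c B ok = begin
    gf (enum (suc j) c (suc B))
      ≡⟨ ≡.cong (λ ps → gf (concatMap (extend j c) ps)) (filter-accept (allowed? c) {B} {downFrom B} ok) ⟩
    gf (extend j c B ++ enum (suc j) c B)
      ≈⟨ gf-++ (extend j c B) (enum (suc j) c B) ⟩
    gf (extend j c B) ⊕ gf (enum (suc j) c B)
      ≈⟨ +-comm (gf (extend j c B)) (gf (enum (suc j) c B)) ⟩
    gf (enum (suc j) c B) ⊕ gf (extend j c B)
      ≈⟨ +-congˡ {gf (enum (suc j) c B)} (gf-append B c (enum j (suc c) (M ∸ B))) ⟩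
    gf (enum (suc j) c B) ⊕ q ^ (c * B) ⊗ gf (enum j (suc c) (M ∸ B)) ∎

  enum-reject : ∀ j c B → ¬ Allowed c B → gf (enum (suc j) c (suc B)) ≡ gf (enum (suc j) c B)
  enum-reject j c B rejected = ≡.cong (λ ps → gf (concatMap (extend j c) ps)) (filter-reject (allowed? c) {B} {downFrom B} rejected)

  -- Factors of 2 stand on the right so that `suc j * 2` and `suc r * 2` reduce; peeling one part
  -- size then turns one family into the other definitionally.
  Odd Even : (j r B : ℕ) → Series
  Odd  j r B = gf (enum (j * 2) (suc (r * 2)) B)
  Even j r B = gf (enum (suc (j * 2)) (suc (suc (r * 2))) B)

  Odd-base : ∀ r B → Odd 0 r B ≈ 1#
  Odd-base r B = +-identityʳ 1#

  odd-allowed : ∀ r B → d ∣ B → Allowed (suc (r * 2)) B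
  odd-allowed r B d∣B _ = d∣B

  odd-rejected : ∀ r b y → suc y < d → ¬ Allowed (suc (r * 2)) (d * b + suc y)
  odd-rejected r b y y<d ok = >⇒∤ y<d (∣m+n∣m⇒∣n (ok ([m+kn]%n≡m%n 1 r 2)) (m∣m*n b))

  even-allowed : ∀ r B → Allowed (suc (suc (r * 2))) B
  even-allowed r B h = contradiction (≡.trans (≡.sym (m*n%n≡0 (suc r) 2)) h) λ ()

  -- Multiplicities strictly between d b and d (b + 1) are not divisible by d, so the bound can be
  -- lowered past them.
  Odd-flat : ∀ j r b x → x < d → Odd (suc j) r (d * b + suc x) ≡ Odd (suc j) r (suc (d * b))
  Odd-flat j r b zero    x<d = ≡.cong (Odd (suc j) r) (ℕ.+-comm (d * b) 1)
  Odd-flat j r b (suc x) x<d = ≡.trans (≡.cong (Odd (suc j) r) (ℕ.+-suc (d * b) (suc x)))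
    (≡.trans (enum-reject (suc (j * 2)) (suc (r * 2)) (d * b + suc x) (odd-rejected r b x x<d)) (Odd-flat j r b x (ℕ.<⇒≤ x<d)))

  Odd-full : 1 ≤ d → ∀ j r b → Odd (suc j) r (d * suc b) ≡ Odd (suc j) r (suc (d * b))
  Odd-full 1≤d@(s≤s {n = d′} _) j r b = ≡.trans (≡.cong (Odd (suc j) r) (≡.trans (ℕ.*-suc d b) (ℕ.+-comm d (d * b)))) (Odd-flat j r b d′ ℕ.≤-refl)

  Odd-skip : 1 ≤ d → ∀ j r b x → x < d → Odd j r (d * b + suc x) ≈ Odd j r (d * suc b)
  Odd-skip 1≤d zero    r b x x<d = refl {Odd 0 r 0}
  Odd-skip 1≤d (suc j) r b x x<d = reflexive (≡.trans (Odd-flat j r b x x<d) (≡.sym (Odd-full 1≤d j r b)))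

  Odd-zero : ∀ j r → Odd (suc j) r (d * 0) ≈ 0#
  Odd-zero j r = reflexive (≡.cong (Odd (suc j) r) (ℕ.*-zeroʳ d))

  Odd-step : 1 ≤ d → ∀ j r b → Odd (suc j) r (d * suc b) ≈ Odd (suc j) r (d * b) ⊕ q ^ ((2 * r + 1) * (d * b)) ⊗ Even j r (M ∸ d * b)
  Odd-step 1≤d j r b = begin
    Odd (suc j) r (d * suc b)
      ≡⟨ Odd-full 1≤d j r b ⟩
    Odd (suc j) r (suc (d * b))
      ≈⟨ enum-accept (suc (j * 2)) (suc (r * 2)) (d * b) (odd-allowed r (d * b) (m∣m*n b)) ⟩
    Odd (suc j) r (d * b) ⊕ q ^ (suc (r * 2) * (d * b)) ⊗ Even j r (M ∸ d * b)
      ≡⟨ ≡.cong (λ c → Odd (suc j) r (d * b) ⊕ q ^ (c * (d * b)) ⊗ Even j r (M ∸ d * b)) (lemma r) ⟩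
    Odd (suc j) r (d * b) ⊕ q ^ ((2 * r + 1) * (d * b)) ⊗ Even j r (M ∸ d * b) ∎
    where
    lemma : ∀ r → suc (r * 2) ≡ 2 * r + 1
    lemma = solve-∀

  Even-zero : ∀ j r → Even j r 0 ≈ 0#
  Even-zero j r = refl {0#}

  Even-step : ∀ j r m → Even j r (suc m) ≈ Even j r m ⊕ q ^ ((2 * r + 2) * m) ⊗ Odd j (suc r) (M ∸ m)
  Even-step j r m = begin
    Even j r (suc m)
      ≈⟨ enum-accept (j * 2) (suc (suc (r * 2))) m (even-allowed r m) ⟩
    Even j r m ⊕ q ^ (suc (suc (r * 2)) * m) ⊗ Odd j (suc r) (M ∸ m)
      ≡⟨ ≡.cong (λ c → Even j r m ⊕ q ^ (c * m) ⊗ Odd j (suc r) (M ∸ m)) (lemma r) ⟩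
    Even j r m ⊕ q ^ ((2 * r + 2) * m) ⊗ Odd j (suc r) (M ∸ m) ∎
    where
    lemma : ∀ r → suc (suc (r * 2)) ≡ 2 * r + 2
    lemma = solve-∀

-- The identity of power series and its coefficients

generating-product : ∀ k d e w → Parity d e w → 1 ≤ d → ∀ β i → suc β + i ≡ k → ∀ L →
  let N = 2 * d * k + 2 * e + d in
  gf (Enumeration.enum d (d * k + e) (suc L * 2) 1 (d * suc β)) ⊛ (⟨ q^ d ⨾ q^ (2 * d) ⟩∞ ⊛ ⟨ q^ 2 ⨾ q^ 2 ⟩∞)
    ≋[ suc L ] ⟨ q^ (d * suc β) ∷ q^ (2 * d * k ∸ d * suc β + 2 * e + d) ∷ q^ N ∷ [] ⨾ q^ N ⟩∞*
generating-product k d e w parity 1≤d@(s≤s {n = d′} _) β i h L = begin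
  o ⊗ (⟨ q^ d ⨾ q^ (2 * d) ⟩∞ ⊗ ⟨ q^ 2 ⨾ q^ 2 ⟩∞)
    ≈⟨ *-congˡ {o} (*-cong (sym (trans (poch-cong ℓ (reflexive (^≡^ˢ q d)) (q^^≈ d 2 (ℕ.*-comm d 2)))
         (poch≈⟨⨾⟩∞ (q^ d) (q^ (2 * d)) ℓ (q^-constant d 1≤d) (q^-constant (2 * d) (ℕ.≤-trans 1≤d (ℕ.m≤m+n d _))) ℕ.≤-refl)))
         (sym (poch≈⟨⨾⟩∞ (q^ 2) (q^ 2) ℓ ≡.refl ≡.refl ℕ.≤-refl))) ⟩
  o ⊗ (poch Q (Q ^ 2) ℓ ⊗ poch (q ^ 2) (q ^ 2) ℓ)
    -- The index i is k - a with a = β + 1, while `product` expects k - β. Both inverted symbols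
    -- have constant term 1.
    ≈⟨ product β (suc i) (≡.trans (ℕ.+-suc β i) h) (inverse (poch (Q ^ 2) (Q ^ 2) ℓ)) (inverse (poch P P ℓ))
         (poch-inverse (Q ^ 2) (Q ^ 2) ℓ (^-constant Q 1 Q₀)) (poch-inverse P P ℓ P₀) ⟩
  poch (Q ^ suc β) P (ℓ + ℓ) ⊗ poch (Q ^ (β + (2 * suc i + w))) P (ℓ + ℓ) ⊗ poch P P ℓ
    ≈⟨ *-cong (*-cong
         (convert (q^^≈ d (suc β) ≡.refl) (q^-constant (d * suc β) (ℕ.≤-trans 1≤d (ℕ.m≤m*n d (suc β)))) (ℕ.m≤m+n ℓ ℓ))
         (convert (q^^≈ d (β + (2 * suc i + w)) z′≡) (q^-constant (2 * d * k ∸ d * suc β + 2 * e + d) (ℕ.≤-trans 1≤d (ℕ.m≤n+m d _))) (ℕ.m≤m+n ℓ ℓ)))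
         (convert P≈ (q^-constant N 1≤N) ℕ.≤-refl) ⟩
  f₁ ⊗ f₂ ⊗ f₃
    ≈⟨ *-assoc f₁ f₂ f₃ ⟩
  f₁ ⊗ (f₂ ⊗ f₃)
    ≈⟨ *-congˡ {f₁} (*-congˡ {f₂} (sym (*-identityʳ f₃))) ⟩
  f₁ ⊗ (f₂ ⊗ (f₃ ⊗ 𝟙)) ∎
  where
  ℓ = suc L
  open CommutativeRing (truncated ℓ) hiding (_+_; _*_; _-_; zero)
  open CommutativeRing (truncated ℓ) using () renaming (_*_ to infixl 7 _⊗_)
  open import Algebra.Properties.Semiring.Exp semiring using (_^_)
  open import Relation.Binary.Reasoning.Setoid setoid
  open Sums (truncated ℓ)
  open GeneratingFunctions ℓ d (d * k + e)
  open InfiniteProducts ℓ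
  open Assembly.Main (truncated ℓ) q d k e w parity ℓ (s≤s z≤n) (q^-nilpotent d 1≤d)
  open Product Odd Even Odd-base (Odd-skip 1≤d) Odd-zero (Odd-step 1≤d) Even-zero Even-step
  N = 2 * d * k + 2 * e + d
  Q = q ^ d
  P = Q ^ suc (2 * k + w)
  o = gf (Enumeration.enum d (d * k + e) (ℓ * 2) 1 (d * suc β))
  f₁ = ⟨ q^ (d * suc β) ⨾ q^ N ⟩∞
  f₂ = ⟨ q^ (2 * d * k ∸ d * suc β + 2 * e + d) ⨾ q^ N ⟩∞
  f₃ = ⟨ q^ N ⨾ q^ N ⟩∞
  Q₀ : Q 0 ≡ 0ℤ
  Q₀ = ^-constant q d′ ≡.refl
  P₀ : P 0 ≡ 0ℤ
  P₀ = ^-constant Q (2 * k + w) Q₀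
  2e≡ : 2 * e ≡ w * d
  2e≡ = 2e≡wd parity
  1≤N : 1 ≤ N
  1≤N = ℕ.≤-trans 1≤d (ℕ.m≤n+m d _)
  P≈ : P ≈ q^ N
  P≈ = q^^≈ d (suc (2 * k + w)) (≡.trans (lemma d k w) (≡.cong (λ x → 2 * d * k + x + d) (≡.sym 2e≡)))
    where
    lemma : ∀ d k w → d * suc (2 * k + w) ≡ 2 * d * k + w * d + d
    lemma = solve-∀
  z′≡ : d * (β + (2 * suc i + w)) ≡ 2 * d * k ∸ d * suc β + 2 * e + d
  z′≡ = ≡.trans (lemma₁ d β i w) (≡.cong₂ (λ x y → x + y + d) (≡.sym ∸≡) (≡.sym 2e≡))
    where
    lemma₁ : ∀ d β i w → d * (β + (2 * suc i + w)) ≡ d * suc β + 2 * d * i + w * d + d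
    lemma₁ = solve-∀
    lemma₂ : ∀ d β i → 2 * d * (suc β + i) ≡ d * suc β + (d * suc β + 2 * d * i)
    lemma₂ = solve-∀
    ∸≡ : 2 * d * k ∸ d * suc β ≡ d * suc β + 2 * d * i
    ∸≡ = ≡.trans (≡.cong (λ k → 2 * d * k ∸ d * suc β) (≡.sym h))
      (≡.trans (≡.cong (_∸ d * suc β) (lemma₂ d β i)) (ℕ.m+n∸m≡n (d * suc β) _))
  convert : ∀ {f g K} → f ≈ g → g 0 ≡ 0ℤ → ℓ ≤ K → poch f P K ≈ ⟨ g ⨾ q^ N ⟩∞
  convert {f} {g} {K} f≈g g₀ ℓ≤K = trans (poch-cong K f≈g P≈) (poch≈⟨⨾⟩∞ g (q^ N) K g₀ (q^-constant N 1≤N) ℓ≤K)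

theorem3p1 : ∀ (a k d e : ℕ) → 1 ≤ a → a ≤ k → 1 ≤ d → d ≤ k → (e ≡ d) ⊎ (2 * e ≡ d) →
    (λ n → + B̅ d k e a n)
    ≋ ⟨ q^ (d * a) ∷ q^ (2 * d * k ∸ d * a + 2 * e + d) ∷ q^ (2 * d * k + 2 * e + d) ∷ [] ⨾ q^ (2 * d * k + 2 * e + d) ⟩∞*
    ⊘ (⟨ q^ d ⨾ q^ (2 * d) ⟩∞ ⊛ ⟨ q^ 2 ⨾ q^ 2 ⟩∞)
theorem3p1 a@(suc β) k d e 1≤a a≤k 1≤d d≤k e≡ n = begin
  + B̅ d k e a n                      ≡⟨ ≡.cong +_ (B̅-enum d k e a n j (ℕ.*-mono-≤ 1≤d 1≤a) (ℕ.≤-trans (ℕ.*-monoʳ-≤ d a≤k) (ℕ.m≤m+n _ e)) n≤j) ⟩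
  _                                  ≡⟨ ≡.sym (gf-coefficient (enum j 1 (d * a)) n) ⟩
  o n                                ≡⟨ ≡.sym (R.*-identityʳ o n ℕ.≤-refl) ⟩
  (o ⊛ 𝟙) n                          ≡⟨ ≡.sym (⊛-congˡ o (den ⊛ inverse den) 𝟙 (inverseʳ den (⊛-constant ⟨ q^ d ⨾ q^ (2 * d) ⟩∞ ⟨ q^ 2 ⨾ q^ 2 ⟩∞ ≡.refl ≡.refl)) n) ⟩
  (o ⊛ (den ⊛ inverse den)) n        ≡⟨ ≡.sym (⊛-assoc o den (inverse den) n) ⟩
  (o ⊛ den ⊛ inverse den) n          ≡⟨ R.*-congʳ {inverse den} {o ⊛ den} {num} (identity e≡) n ℕ.≤-refl ⟩
  (num ⊘ den) n                      ∎
  where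
  open ≡.≡-Reasoning
  open Enumeration d (d * k + e)
  module R = CommutativeRing (truncated (suc n))
  -- One pair of part sizes for each of the n + 1 coefficients kept: the parts range up to 2n + 2,
  -- and the same n + 1 serves as the truncation order.
  j = suc n * 2
  o = gf (enum j 1 (d * a))
  den = ⟨ q^ d ⨾ q^ (2 * d) ⟩∞ ⊛ ⟨ q^ 2 ⨾ q^ 2 ⟩∞
  num = ⟨ q^ (d * a) ∷ q^ (2 * d * k ∸ d * a + 2 * e + d) ∷ q^ (2 * d * k + 2 * e + d) ∷ [] ⨾ q^ (2 * d * k + 2 * e + d) ⟩∞*
  n≤j : n ≤ j
  n≤j = ℕ.≤-trans (ℕ.n≤1+n n) (ℕ.m≤m*n (suc n) 2)
  identity : (e ≡ d) ⊎ (2 * e ≡ d) → o ⊛ den ≋[ suc n ] num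
  identity (inj₁ e≡d)  = generating-product k d e 2 (inj₁ (e≡d , ≡.refl)) 1≤d β (k ∸ a) (ℕ.m+[n∸m]≡n a≤k) n
  identity (inj₂ 2e≡d) = generating-product k d e 1 (inj₂ (2e≡d , ≡.refl)) 1≤d β (k ∸ a) (ℕ.m+[n∸m]≡n a≤k) n
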